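{- Let $n,k\ge 1$ be integers and let $\lambda$ be a partition of $n$ with $\ell(\lambda)<n+1-k$. Then $$p_k^{\lambda}(n)=\frac{\sum_{i\geq 1}\binom{k+2i}{k-1}\,p_{k+2i}^{\lambda}(n)\, q^{\lambda}+\sum_{i\geq 1}\ \sum_{\mu\rhd_{2i+1}\lambda}\kappa_{\mu,\lambda}\,p_k^{\mu}(n)\, q^{\mu}}{q^{\lambda}\,[n+1-k-\ell(\lambda)]}.$$
   Context: Permutations of $[n]=\{1,\dots,n\}$ are composed as maps (right to left). A plane permutation on $[n]$ is a pair $\mathfrak p=(s,\pi)$ with $s$ an $n$-cycle and $\pi$ an arbitrary permutation of $[n]$; its diagonal is $D_{\mathfrak p}=s\pi^{ -1}$. For a partition $\lambda$ of $n$, $\ell(\lambda)$ is its number of parts and $q^\lambda$ is the number of permutations of $[n]$ of cycle-type $\lambda$. For a fixed permutation $D$ of $[n]$ of cycle-type $\lambda$, $p_k^\lambda(n)$ is the number of plane permutations $(s,\pi)$ on $[n]$ with diagonal $D$ such that $\pi$ has exactly $k$ cycles (this depends only on $\lambda$, not on the choice of $D$). For partitions $\mu,\lambda$ of $n$, $\mu\rhd_{2i+1}\lambda$ means that $\mu$ can be obtained from $\lambda$ by splitting one part of $\lambda$ into $2i+1$ non-zero parts, and $\kappa_{\mu,\lambda}$ is the number of ways to obtain $\lambda$ from $\mu$ by merging $\ell(\mu)-\ell(\lambda)+1$ parts of $\mu$ into one, where the parts of $\mu$ are regarded as distinguishable (so one counts the subsets of $\ell(\mu)-\ell(\lambda)+1$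 parts of $\mu$ whose merging gives $\lambda$). -}

module Defs where

open import Data.Bool.Base using (true; false)
open import Data.Fin.Base using (Fin; zero; toℕ; _≤_)
open import Data.Fin.Permutation using (Permutation′; _⟨$⟩ʳ_; _∘ₚ_; flip; insert; _≈_)
  renaming (id to idₚ)
open import Data.Fin.Properties using (_≟_; _≤?_; all?; any?)
open import Data.Fin.Subset using (Subset; ∣_∣; ∁; _∈_)
open import Data.Fin.Subset.Properties using (_∈?_)
open import Data.List.Base
  using (List; []; _∷_; _++_; map; concatMap; filter; length; lookup; upTo; allFin;
         cartesianProduct; removeAt)
import Data.List.Membership.DecPropositional as DecMembership
open import Data.List.Relation.Binary.Permutation.Propositional
  using (_↭_; ↭-refl; ↭-sym; ↭-trans; ↭-prep; ↭-swap)
open import Data.List.Relation.Binary.Permutation.Propositional.Properties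
  using (∈-resp-↭; drop-∷; ¬x∷xs↭[])
import Data.List.Membership.Propositional as List
open import Data.List.Relation.Unary.All as All using (All)
open import Data.List.Relation.Unary.Any as Any using (Any; here; there; _─_)
open import Data.List.Relation.Unary.Linked as Linked using (Linked)
open import Data.Nat.Base as ℕ using (ℕ; zero; suc; _+_; _∸_)
open import Data.Nat.GeneralisedArithmetic using (iterate)
open import Data.Nat.ListAction using (sum)
import Data.Nat.Properties as ℕ
open import Data.Product.Base using (_×_; _,_; proj₁; proj₂; ∃)
import Data.Vec.Base as Vec
open import Relation.Binary.PropositionalEquality using (_≡_; refl)
open import Relation.Nullary using (Dec; yes; no)
open import Relation.Nullary.Decidable using (map′; _×-dec_; _→-dec_)

-- Every permutation of Fin n occurs exactly once up to _≈_: the image i of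
-- zero and the permutation of the remaining points determine it
-- (Data.Fin.Permutation.insert-remove).
permutations : ∀ n → List (Permutation′ n)
permutations zero    = idₚ ∷ []
permutations (suc n) =
  concatMap (λ i → map (insert zero i) (permutations n)) (allFin (suc n))

_≈?_ : ∀ {n} (π ρ : Permutation′ n) → Dec (π ≈ ρ)
π ≈? ρ = all? λ i → (π ⟨$⟩ʳ i) ≟ (ρ ⟨$⟩ʳ i)

-- j = π^m(i) for some m; a cycle has at most n elements, so m < n suffices.
SameCycle : ∀ {n} → Permutation′ n → Fin n → Fin n → Set
SameCycle {n} π i j = ∃ λ (m : Fin n) → iterate (π ⟨$⟩ʳ_) i (toℕ m) ≡ j

sameCycle? : ∀ {n} (π : Permutation′ n) i j → Dec (SameCycle π i j)
sameCycle? π i j = any? λ m → iterate (π ⟨$⟩ʳ_) i (toℕ m) ≟ j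

IsFullCycle : ∀ {n} → Permutation′ n → Set
IsFullCycle π = ∀ i j → SameCycle π i j

isFullCycle? : ∀ {n} (π : Permutation′ n) → Dec (IsFullCycle π)
isFullCycle? π = all? λ i → all? λ j → sameCycle? π i j

IsCycleMin : ∀ {n} → Permutation′ n → Fin n → Set
IsCycleMin π i = ∀ j → SameCycle π i j → i ≤ j

isCycleMin? : ∀ {n} (π : Permutation′ n) i → Dec (IsCycleMin π i)
isCycleMin? π i = all? λ j → sameCycle? π i j →-dec (i ≤? j)

cycleLength : ∀ {n} → Permutation′ n → Fin n → ℕ
cycleLength {n} π i = length (filter (sameCycle? π i) (allFin n))

-- One entry per cycle (fixed points included), each cycle being represented
-- by its least element.
cycleLengths : ∀ {n} → Permutation′ n → List ℕ
cycleLengths {n} π = map (cycleLength π) (filter (isCycleMin? π) (allFin n))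

#cycles : ∀ {n} → Permutation′ n → ℕ
#cycles π = length (cycleLengths π)

HasCycleType : ∀ {n} → List ℕ → Permutation′ n → Set
HasCycleType μ π = cycleLengths π ↭ μ

private
  open DecMembership ℕ._≟_ using () renaming (_∈?_ to _∈ℕ?_)

  extract : ∀ {x : ℕ} {ys} (x∈ys : x List.∈ ys) → ys ↭ x ∷ (ys ─ x∈ys)
  extract (here refl)           = ↭-refl
  extract {x} {y ∷ _} (there p) =
    ↭-trans (↭-prep y (extract p)) (↭-swap y x ↭-refl)

infix 4 _↭?_

_↭?_ : (xs ys : List ℕ) → Dec (xs ↭ ys)
[]       ↭? []       = yes ↭-refl
[]       ↭? (y ∷ ys) = no λ p → ¬x∷xs↭[] (↭-sym p)
(x ∷ xs) ↭? ys with x ∈ℕ? ys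
... | no  x∉ys = no λ p → x∉ys (∈-resp-↭ p (here refl))
... | yes x∈ys =
  map′ (λ p → ↭-trans (↭-prep x p) (↭-sym (extract x∈ys)))
       (λ p → drop-∷ (↭-trans p (extract x∈ys)))
       (xs ↭? (ys ─ x∈ys))

infix 4 _⊢_

_⊢_ : List ℕ → ℕ → Set
μ ⊢ n = All (0 ℕ.<_) μ × Linked ℕ._≥_ μ × sum μ ≡ n

_⊢?_ : ∀ μ n → Dec (μ ⊢ n)
μ ⊢? n = All.all? (0 ℕ.<?_) μ ×-dec Linked.linked? ℕ._≥?_ μ ×-dec sum μ ℕ.≟ n

extend : List ℕ → List (List ℕ)
extend []       = (1 ∷ []) ∷ []
extend (a ∷ as) = (1 ∷ a ∷ as) ∷ (suc a ∷ as) ∷ []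

-- All lists of positive integers with sum n, each exactly once: a composition
-- of n + 1 either starts with a part 1 followed by a composition of n, or
-- arises by adding 1 to the first part of a non-empty composition of n.
compositions : ℕ → List (List ℕ)
compositions zero    = [] ∷ []
compositions (suc n) = concatMap extend (compositions n)

partitions : ℕ → List (List ℕ)
partitions n = filter (_⊢? n) (compositions n)

-- μ ▷[ r ] ν: some part ν_j of ν can be split into r non-zero parts (the
-- entries of a composition of ν_j of length r) so as to give μ.
_▷[_]_ : List ℕ → ℕ → List ℕ → Set
μ ▷[ r ] ν = ∃ λ (j : Fin (length ν)) →
  Any (λ bs → length bs ≡ r × bs ++ removeAt ν j ↭ μ) (compositions (lookup ν j))

_▷[_]?_ : ∀ μ r ν → Dec (μ ▷[ r ] ν)
μ ▷[ r ]? ν = any? λ j →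
  Any.any? (λ bs → length bs ℕ.≟ r ×-dec (bs ++ removeAt ν j ↭? μ)) (compositions (lookup ν j))

subsets : ∀ m → List (Subset m)
subsets zero    = Vec.[] ∷ []
subsets (suc m) = map (true Vec.∷_) (subsets m) ++ map (false Vec.∷_) (subsets m)

partsIn : (μ : List ℕ) → Subset (length μ) → List ℕ
partsIn μ S = map (lookup μ) (filter (_∈? S) (allFin (length μ)))

mergeParts : (μ : List ℕ) → Subset (length μ) → List ℕ
mergeParts μ S = sum (partsIn μ S) ∷ partsIn μ (∁ S)

-- The parts of μ are distinguished by their positions.
κ : List ℕ → List ℕ → ℕ
κ μ ν = length (filter
  (λ S → (∣ S ∣ ℕ.≟ length μ ∸ length ν + 1) ×-dec (mergeParts μ S ↭? ν))
  (subsets (length μ)))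

planePermutations : ∀ n → List (Permutation′ n × Permutation′ n)
planePermutations n =
  filter (λ (s , _) → isFullCycle? s) (cartesianProduct (permutations n) (permutations n))

-- s π⁻¹ as a composition of maps (π⁻¹ is applied first); _∘ₚ_ applies its
-- left argument first.
diagonal : ∀ {n} → Permutation′ n × Permutation′ n → Permutation′ n
diagonal (s , π) = flip π ∘ₚ s

-- Number of plane permutations (s , π) with diagonal D such that π has
-- k cycles; this is p_k^μ(n) when D has cycle type μ.
p : ∀ {n} → ℕ → Permutation′ n → ℕ
p {n} k D = length (filter
  (λ (s , π) → (diagonal (s , π) ≈? D) ×-dec (#cycles π ℕ.≟ k))
  (planePermutations n))

q : ℕ → List ℕ → ℕ
q n μ = length (filter (λ π → cycleLengths π ↭? μ) (permutations n))

∑-syntax : ∀ {A : Set} → List A → (A → ℕ) → ℕ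
∑-syntax xs f = sum (map f xs)

infix 6 ∑-syntax
syntax ∑-syntax xs (λ x → e) = ∑[ x ∈ xs ] e

[1⋯_] : ℕ → List ℕ
[1⋯ N ] = map suc (upTo N)

splittings : ℕ → ℕ → List ℕ → List (List ℕ)
splittings n r ν = filter (λ μ → μ ▷[ r ]? ν) (partitions n)

{-# OPTIONS --safe #-}

-- For an n-cycle s, written as a word, put α = s D⁻¹, a conjugate of π = D⁻¹ s.
-- A point i is an anti-exceedance of α if α i does not come after i in the word.
-- As s = α D, the anti-exceedances of α and those of D number n + 1 together.
--
-- For fixed D, anti-exceedances of α (over all words) correspond to sets of an
-- odd number of cycles of α, regarded as merged into one; this is the idea of
-- Chapuy's trisections.  To see it, mark an odd set U of cycles of α and an
-- anti-exceedance i in the last of them, cycles being ordered by their first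
-- points in the word.  If a₂ = α i is not the first point a₁ of its cycle, let a₃
-- be the first point after a₂ among those met on the cycle from a₁ before a₂, and
-- exchange the intervals [a₁, a₂) and [a₂, a₃) of the word: the cycle splits into
-- those of a₁, a₂ and a₃, while U (as a set of points), i and the type of the
-- merged permutation persist.  Conversely, if U has more than one cycle, then it
-- has at least three, and the same exchange glues the last three.  Hence the
-- marks with α i = a₁, one for each U, are as many as those for which U is a
-- single cycle, one for each anti-exceedance.
--
-- Counting the sets U of 2i + 1 cycles for α with k cycles after merging gives
-- the binomial sum; exchanging the roles of α and D by reversing the word, and
-- keeping track of the cycle type of D, gives the sum over μ ▷ ν.  The terms with
-- i = 0 are k and ℓ(ν) times the left-hand side, whence the factor n + 1 - k - ℓ(ν).

module Submission where

open import Defs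
open import Data.Bool.Base using (true; false; if_then_else_)
open import Data.Empty using (⊥; ⊥-elim)
open import Data.Fin.Base as Fin using (Fin; zero; suc; toℕ; fromℕ; fromℕ<; inject₁)
open import Data.Fin.Permutation
  using (Permutation′; transpose; reverse; _⟨$⟩ʳ_; _⟨$⟩ˡ_; _∘ₚ_; flip; insert; remove; permutation; _≈_; inverseˡ; inverseʳ; insert-remove)
  renaming (id to idₚ)
import Data.Fin.Properties as Fin
open import Data.Fin.Properties using (_≟_; any?; all?; toℕ-injective; toℕ<n; toℕ-fromℕ<)
open import Data.Fin.Subset using (Subset; ∣_∣; ∁) renaming (_∈_ to _∈ₛ_)
open import Data.Fin.Subset.Properties using (⊆-antisym) renaming (_∈?_ to _∈ₛ?_)
open import Data.Integer.Base using (+_)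
import Data.Integer.Base as ℤ
import Data.Integer.Properties as ℤ
open import Data.List.Base
  using (List; []; _∷_; _++_; map; filter; length; lookup; allFin; tabulate; cartesianProduct; removeAt)
open import Data.List.Properties as List
  using (length-map; map-∘; map-++; filter-all; length-tabulate)
open import Data.List.Membership.Propositional using (_∈_; find; lose)
open import Data.List.Membership.Propositional.Properties
  using (∈-allFin; ∈-filter⁺; ∈-filter⁻; ∈-map⁺; ∈-map⁻; ∈-++⁺ˡ; ∈-++⁺ʳ; ∈-++⁻; ∈-concat⁺′; ∈-concat⁻′;
         ∈-∃++; ∈-cartesianProduct⁺; ∈-cartesianProduct⁻; ∈-upTo⁺; ∈-upTo⁻)
import Data.List.Relation.Binary.Pointwise as Pointwise
open import Data.List.Relation.Binary.Permutation.Propositional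
  using (_↭_; ↭-refl; ↭-sym; ↭-trans; ↭-prep; ↭-reflexive; ↭⇒↭ₛ)
import Data.List.Relation.Binary.Permutation.Propositional as Perm
open import Data.List.Relation.Binary.Permutation.Propositional.Properties
  using (∈-resp-↭; ↭-length; shift; drop-∷; ++⁺ˡ; map⁺)
import Data.List.Relation.Binary.Permutation.Setoid.Properties as PermSetoid
open import Data.List.Relation.Unary.All as All using (All; []; _∷_)
import Data.List.Relation.Unary.All.Properties as All
open import Data.List.Relation.Unary.AllPairs as AllPairs using (AllPairs; []; _∷_)
import Data.List.Relation.Unary.AllPairs.Properties as AllPairs
open import Data.List.Relation.Unary.Any as Any using (Any; here; there)
import Data.List.Relation.Unary.Any.Properties as Any
open import Data.List.Relation.Unary.Linked using (Linked)
import Data.List.Relation.Unary.Sorted.TotalOrder.Properties as Sorted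
import Data.List.Relation.Unary.Unique.Setoid as UniqueSetoid
import Data.List.Relation.Unary.Unique.Setoid.Properties as UniqueSetoid
import Data.List.Sort as Sort
open import Data.Nat.Base as ℕ using (ℕ; zero; suc; _+_; _∸_; _*_; _≤_; _<_; NonZero; z≤n; s≤s; z<s)
open import Data.Nat.Combinatorics using (_C_; nCk+nC[k+1]≡[n+1]C[k+1]; nCk≡nC[n∸k]; nC1≡n)
open import Data.Nat.GeneralisedArithmetic using (iterate)
open import Data.Nat.ListAction using (sum)
open import Data.Nat.ListAction.Properties using (sum-++; sum-↭)
import Data.Nat.DivMod as ℕ
import Data.Nat.Properties as ℕ
open import Data.Product.Base using (Σ-syntax; ∃; _×_; _,_; proj₁; proj₂)
open import Data.Product.Relation.Binary.Pointwise.NonDependent using (×-setoid)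
open import Data.Rational.Base using (_/_)
import Data.Rational.Properties as ℚ
import Data.Rational.Unnormalised.Base as ℚᵘ
open import Data.Sum.Base using (_⊎_; inj₁; inj₂; [_,_]′)
open import Data.Vec.Base as Vec using (Vec; []; _∷_)
import Data.Vec.Properties as Vec
open import Function.Base using (_∘_; id)
open import Level using (0ℓ)
open import Relation.Binary.Bundles using (Setoid; DecTotalOrder)
import Relation.Binary.Construct.Flip.EqAndOrd as Flip
open import Relation.Binary.PropositionalEquality
  using (_≡_; _≢_; refl; sym; trans; cong; cong₂; subst; subst₂; setoid; module ≡-Reasoning)
open import Relation.Nullary using (Dec; yes; no; ¬_; contradiction)
open import Relation.Nullary.Decidable using (map′; _×-dec_; _⊎-dec_; _→-dec_; ¬?)

-- The factors q^λ and q^μ arise because D cannot stay fixed throughout. An exchange changes s and α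
-- but keeps D, which suits the binomial sum; for the sum over μ the roles are interchanged: α is
-- kept, and the cycles of D are the ones that are merged. Both identities are therefore summed over
-- all pairs of a word and a permutation D. As all n-cycles are conjugate, and likewise all D of one
-- type, the number of such pairs with D of type μ and j cycles in α is a multiple of p_j^μ q^μ,
-- with a ratio that depends neither on j nor on μ. Words are counted instead of n-cycles because
-- anti-exceedances and first points of cycles depend on where an n-cycle is cut open. An exchange
-- alters s, and hence α, by a 3-cycle on a₁, a₂, a₃. This 3-cycle is written as two transpositions,
-- with `β` between them, so that the cycles need to be followed across one transposition at a time
-- only. The same `β` expresses which points are met before a₂ without any mention of exponents.

private variable
  A B : Set
  n : ℕ

-- Finite sums, counting and matchings

𝟙 : {P : Set} → Dec P → ℕ
𝟙 (yes _) = 1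
𝟙 (no  _) = 0

𝟙-cong : {P Q : Set} → (P → Q) → (Q → P) → (d : Dec P) (e : Dec Q) → 𝟙 d ≡ 𝟙 e
𝟙-cong f g (yes p) (yes q) = refl
𝟙-cong f g (yes p) (no ¬q) = contradiction (f p) ¬q
𝟙-cong f g (no ¬p) (yes q) = contradiction (g q) ¬p
𝟙-cong f g (no ¬p) (no ¬q) = refl

𝟙-yes : {P : Set} (d : Dec P) → P → 𝟙 d ≡ 1
𝟙-yes (yes _) p = refl
𝟙-yes (no ¬p) p = contradiction p ¬p

𝟙-no : {P : Set} (d : Dec P) → ¬ P → 𝟙 d ≡ 0
𝟙-no (yes p) ¬p = contradiction p ¬p
𝟙-no (no  _) ¬p = refl

𝟙-× : {P Q : Set} (d : Dec P) (e : Dec Q) → 𝟙 (d ×-dec e) ≡ 𝟙 d * 𝟙 e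
𝟙-× (yes _) (yes _) = refl
𝟙-× (yes _) (no  _) = refl
𝟙-× (no  _) _       = refl

count : {P : A → Set} → (∀ x → Dec (P x)) → List A → ℕ
count P? xs = length (filter P? xs)

count≡∑ : {P : A → Set} (P? : ∀ x → Dec (P x)) (xs : List A) → count P? xs ≡ ∑[ x ∈ xs ] 𝟙 (P? x)
count≡∑ P? []       = refl
count≡∑ P? (x ∷ xs) with P? x
... | yes _ = cong suc (count≡∑ P? xs)
... | no  _ = count≡∑ P? xs

∑-cong∈ : (xs : List A) {f g : A → ℕ} → (∀ {x} → x ∈ xs → f x ≡ g x) → ∑-syntax xs f ≡ ∑-syntax xs g
∑-cong∈ []       h = refl
∑-cong∈ (x ∷ xs) h = cong₂ _+_ (h (here refl)) (∑-cong∈ xs (h ∘ there))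

∑-cong : (xs : List A) {f g : A → ℕ} → (∀ x → f x ≡ g x) → ∑-syntax xs f ≡ ∑-syntax xs g
∑-cong xs h = ∑-cong∈ xs (λ {x} _ → h x)

+-interchange : ∀ a b c d → (a + b) + (c + d) ≡ (a + c) + (b + d)
+-interchange a b c d = begin
  (a + b) + (c + d) ≡⟨ ℕ.+-assoc a b (c + d) ⟩
  a + (b + (c + d)) ≡⟨ cong (_+_ a) (trans (sym (ℕ.+-assoc b c d)) (trans (cong (_+ d) (ℕ.+-comm b c)) (ℕ.+-assoc c b d))) ⟩
  a + (c + (b + d)) ≡⟨ ℕ.+-assoc a c (b + d) ⟨
  (a + c) + (b + d) ∎
  where open ≡-Reasoning

∑-+ : (xs : List A) (f g : A → ℕ) → ∑[ x ∈ xs ] (f x + g x) ≡ (∑[ x ∈ xs ] (f x)) + (∑[ x ∈ xs ] (g x))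
∑-+ []       f g = refl
∑-+ (x ∷ xs) f g = trans (cong (_+_ (f x + g x)) (∑-+ xs f g)) (+-interchange (f x) (g x) _ _)

∑-0 : (xs : List A) → ∑[ _ ∈ xs ] 0 ≡ 0
∑-0 []       = refl
∑-0 (_ ∷ xs) = ∑-0 xs

∑-*ˡ : ∀ c (xs : List A) (f : A → ℕ) → ∑[ x ∈ xs ] (c * f x) ≡ c * (∑[ x ∈ xs ] (f x))
∑-*ˡ c []       f = sym (ℕ.*-zeroʳ c)
∑-*ˡ c (x ∷ xs) f = trans (cong (_+_ (c * f x)) (∑-*ˡ c xs f)) (sym (ℕ.*-distribˡ-+ c (f x) _))

∑-*ʳ : ∀ c (xs : List A) (f : A → ℕ) → ∑[ x ∈ xs ] (f x * c) ≡ (∑[ x ∈ xs ] (f x)) * c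
∑-*ʳ c xs f = trans (∑-cong xs (λ x → ℕ.*-comm (f x) c)) (trans (∑-*ˡ c xs f) (ℕ.*-comm c _))

∑-const : (xs : List A) (c : ℕ) → ∑[ _ ∈ xs ] c ≡ length xs * c
∑-const []       c = refl
∑-const (_ ∷ xs) c = cong (_+_ c) (∑-const xs c)

∑-++ : (xs ys : List A) (f : A → ℕ) → ∑-syntax (xs ++ ys) f ≡ ∑-syntax xs f + ∑-syntax ys f
∑-++ xs ys f = trans (cong sum (map-++ f xs ys)) (sum-++ (map f xs) (map f ys))

∑-map : (g : A → B) (xs : List A) (f : B → ℕ) → ∑-syntax (map g xs) f ≡ ∑[ x ∈ xs ] (f (g x))
∑-map g xs f = cong sum (sym (map-∘ xs))

∑-swap : (xs : List A) (ys : List B) (f : A → B → ℕ) →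
  ∑[ x ∈ xs ] (∑[ y ∈ ys ] (f x y)) ≡ ∑[ y ∈ ys ] (∑[ x ∈ xs ] (f x y))
∑-swap []       ys f = sym (∑-0 ys)
∑-swap (x ∷ xs) ys f =
  trans (cong (_+_ (∑[ y ∈ ys ] (f x y))) (∑-swap xs ys f)) (sym (∑-+ ys (f x) _))

∑-cartesianProduct : (xs : List A) (ys : List B) (f : A × B → ℕ) →
  ∑-syntax (cartesianProduct xs ys) f ≡ ∑[ x ∈ xs ] (∑[ y ∈ ys ] (f (x , y)))
∑-cartesianProduct []       ys f = refl
∑-cartesianProduct (x ∷ xs) ys f = trans (∑-++ (map (x ,_) ys) _ f)
  (cong₂ _+_ (∑-map (x ,_) ys f) (∑-cartesianProduct xs ys f))

∑-filter : {P : A → Set} (P? : ∀ x → Dec (P x)) (xs : List A) (f : A → ℕ) →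
  ∑-syntax (filter P? xs) f ≡ ∑[ x ∈ xs ] (𝟙 (P? x) * f x)
∑-filter P? []       f = refl
∑-filter P? (x ∷ xs) f with P? x
... | yes _ = cong₂ _+_ (sym (ℕ.+-identityʳ (f x))) (∑-filter P? xs f)
... | no  _ = ∑-filter P? xs f

∑≥1 : {xs : List A} {f : A → ℕ} {x : A} → x ∈ xs → 1 ≤ f x → 1 ≤ ∑-syntax xs f
∑≥1 (here refl) h = ℕ.≤-trans h (ℕ.m≤m+n _ _)
∑≥1 (there m)   h = ℕ.≤-trans (∑≥1 m h) (ℕ.m≤n+m _ _)

AllPairs-resp-↭ : {S : A → A → Set} → (∀ {x y} → S x y → S y x) →
  {xs ys : List A} → xs ↭ ys → AllPairs S xs → AllPairs S ys
AllPairs-resp-↭ S-sym p =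
  PermSetoid.AllPairs-resp-↭ (setoid _) S-sym ((λ { refl → id }) , (λ { refl → id })) (↭⇒↭ₛ p)

-- A relation that matches the members of xs with those of ys bijectively and
-- along which f and g agree.
match-↭ : {C : Set} {R : A → B → Set} {f : A → C} {g : B → C} {xs : List A} {ys : List B} →
  (∀ {x} → x ∈ xs → ∃ λ y → y ∈ ys × R x y) →
  (∀ {y} → y ∈ ys → ∃ λ x → x ∈ xs × R x y) →
  AllPairs (λ x x′ → ∀ y → R x y → R x′ y → ⊥) xs →
  AllPairs (λ y y′ → ∀ x → R x y → R x y′ → ⊥) ys →
  (∀ {x y} → R x y → f x ≡ g y) → map f xs ↭ map g ys
match-↭ {xs = []} {[]} to from dx dy fg = ↭-refl
match-↭ {xs = []} {y ∷ ys} to from dx dy fg with from (here refl)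
... | _ , () , _
match-↭ {f = f} {g} {x ∷ xs} {ys} to from (dx ∷ dxs) dy fg with to (here refl)
... | y , y∈ys , r with ∈-∃++ y∈ys
... | as , bs , refl with AllPairs-resp-↭ (λ h x r r′ → h x r′ r) (shift y as bs) dy
... | dy′ ∷ dys′ = ↭-trans (Perm.prep _ (match-↭ to′ from′ dxs dys′ fg))
    (↭-trans (↭-reflexive (cong (_∷ map g (as ++ bs)) (fg r))) (↭-sym (map⁺ g (shift y as bs))))
  where
  to′ : ∀ {x′} → x′ ∈ xs → ∃ λ y → y ∈ as ++ bs × _
  to′ x′∈ with to (there x′∈)
  ... | y′ , y′∈ , r′ with ∈-resp-↭ (shift y as bs) y′∈
  ... | here refl = ⊥-elim (All.lookup dx x′∈ _ r r′)
  ... | there y′∈′ = y′ , y′∈′ , r′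
  from′ : ∀ {y′} → y′ ∈ as ++ bs → ∃ λ x → x ∈ xs × _
  from′ y′∈ with from (∈-resp-↭ (↭-sym (shift y as bs)) (there y′∈))
  ... | x′ , here refl , r′ = ⊥-elim (All.lookup dy′ y′∈ _ r r′)
  ... | x′ , there x′∈ , r′ = x′ , x′∈ , r′

module _ {S T : Setoid 0ℓ 0ℓ} where
  private
    module S = Setoid S
    module T = Setoid T

  -- Listed permutations are distinct only up to `_≈_`, hence the setoids. All hypotheses may use
  -- `P` and `Q`, so that a relation can be a matching merely between the members that satisfy them.
  filter-match-↭ : {C : Set} {xs : List S.Carrier} {ys : List T.Carrier} →
    UniqueSetoid.Unique S xs → UniqueSetoid.Unique T ys →
    {P : S.Carrier → Set} (P? : ∀ x → Dec (P x)) {Q : T.Carrier → Set} (Q? : ∀ y → Dec (Q y))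
    (R : S.Carrier → T.Carrier → Set) {f : S.Carrier → C} {g : T.Carrier → C} →
    (∀ {x} → x ∈ xs → P x → ∃ λ y → y ∈ ys × Q y × R x y) →
    (∀ {y} → y ∈ ys → Q y → ∃ λ x → x ∈ xs × P x × R x y) →
    (∀ {x x′ y} → P x → P x′ → Q y → R x y → R x′ y → x S.≈ x′) →
    (∀ {x y y′} → P x → Q y → Q y′ → R x y → R x y′ → y T.≈ y′) →
    (∀ {x y} → P x → Q y → R x y → f x ≡ g y) →
    map f (filter P? xs) ↭ map g (filter Q? ys)
  filter-match-↭ {xs = xs} {ys} ux uy {P} P? {Q} Q? R to from injˡ injʳ fg =
    match-↭ {R = λ x y → P x × Q y × R x y}
      (λ m → let x∈ , p = ∈-filter⁻ P? m ; y , y∈ , q , r = to x∈ p in y , ∈-filter⁺ Q? y∈ q , p , q , r)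
      (λ m → let y∈ , q = ∈-filter⁻ Q? m ; x , x∈ , p , r = from y∈ q in x , ∈-filter⁺ P? x∈ p , p , q , r)
      (AllPairs.map (λ x≉ _ (p , q , r) (p′ , _ , r′) → x≉ (injˡ p p′ q r r′)) (AllPairs.filter⁺ P? ux))
      (AllPairs.map (λ y≉ _ (p , q , r) (_ , q′ , r′) → y≉ (injʳ p q q′ r r′)) (AllPairs.filter⁺ Q? uy))
      (λ (p , q , r) → fg p q r)

  count-match : {xs : List S.Carrier} {ys : List T.Carrier} →
    UniqueSetoid.Unique S xs → UniqueSetoid.Unique T ys →
    {P : S.Carrier → Set} (P? : ∀ x → Dec (P x)) {Q : T.Carrier → Set} (Q? : ∀ y → Dec (Q y))
    (R : S.Carrier → T.Carrier → Set) →
    (∀ {x} → x ∈ xs → P x → ∃ λ y → y ∈ ys × Q y × R x y) →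
    (∀ {y} → y ∈ ys → Q y → ∃ λ x → x ∈ xs × P x × R x y) →
    (∀ {x x′ y} → P x → P x′ → Q y → R x y → R x′ y → x S.≈ x′) →
    (∀ {x y y′} → P x → Q y → Q y′ → R x y → R x y′ → y T.≈ y′) →
    count P? xs ≡ count Q? ys
  count-match {xs} {ys} ux uy P? Q? R to from injˡ injʳ =
    trans (sym (length-map (λ _ → 0) (filter P? xs))) (trans
      (↭-length (filter-match-↭ ux uy P? Q? R {λ _ → 0} {λ _ → 0} to from injˡ injʳ (λ _ _ _ → refl)))
      (length-map (λ _ → 0) (filter Q? ys)))

count-cong : {P Q : A → Set} (P? : ∀ x → Dec (P x)) (Q? : ∀ x → Dec (Q x)) (xs : List A) →
  (∀ {x} → x ∈ xs → P x → Q x) → (∀ {x} → x ∈ xs → Q x → P x) → count P? xs ≡ count Q? xs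
count-cong P? Q? xs pq qp = trans (count≡∑ P? xs)
  (trans (∑-cong∈ xs (λ m → 𝟙-cong (pq m) (qp m) (P? _) (Q? _))) (sym (count≡∑ Q? xs)))

count-split : {P Q : A → Set} (P? : ∀ x → Dec (P x)) (Q? : ∀ x → Dec (Q x)) (xs : List A) →
  count P? xs ≡ count (λ x → P? x ×-dec Q? x) xs + count (λ x → P? x ×-dec ¬? (Q? x)) xs
count-split P? Q? xs = trans (count≡∑ P? xs) (trans (∑-cong xs step)
  (trans (∑-+ xs _ _) (sym (cong₂ _+_ (count≡∑ _ xs) (count≡∑ _ xs)))))
  where
  step : ∀ x → 𝟙 (P? x) ≡ 𝟙 (P? x ×-dec Q? x) + 𝟙 (P? x ×-dec ¬? (Q? x))
  step x with P? x | Q? x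
  ... | yes _ | yes _ = refl
  ... | yes _ | no  _ = refl
  ... | no  _ | yes _ = refl
  ... | no  _ | no  _ = refl

filter-cong∈ : {P Q : A → Set} (P? : ∀ x → Dec (P x)) (Q? : ∀ x → Dec (Q x)) (xs : List A) →
  (∀ {x} → x ∈ xs → P x → Q x) → (∀ {x} → x ∈ xs → Q x → P x) → filter P? xs ≡ filter Q? xs
filter-cong∈ P? Q? []       pq qp = refl
filter-cong∈ P? Q? (x ∷ xs) pq qp with P? x | Q? x
... | yes p | yes q = cong (x ∷_) (filter-cong∈ P? Q? xs (pq ∘ there) (qp ∘ there))
... | yes p | no ¬q = contradiction (pq (here refl) p) ¬q
... | no ¬p | yes q = contradiction (qp (here refl) q) ¬p
... | no ¬p | no ¬q = filter-cong∈ P? Q? xs (pq ∘ there) (qp ∘ there)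

-- Enumeration of permutations

permSetoid : ℕ → Setoid 0ℓ 0ℓ
permSetoid n = record
  { Carrier = Permutation′ n
  ; _≈_ = _≈_
  ; isEquivalence = record { refl = λ i → refl ; sym = λ h i → sym (h i) ; trans = λ h k i → trans (h i) (k i) }
  }

permutations-complete : ∀ {n} (π : Permutation′ n) → ∃ λ ρ → ρ ∈ permutations n × ρ ≈ π
permutations-complete {zero}  π = idₚ , here refl , λ ()
permutations-complete {suc n} π with permutations-complete (remove zero π)
... | ρ , ρ∈ , ρ≈ = insert zero i ρ
    , ∈-concat⁺′ (∈-map⁺ (insert zero i) ρ∈) (∈-map⁺ (λ i → map (insert zero i) (permutations n)) (∈-allFin i))
    , λ j → trans (insert-cong j) (insert-remove zero π j)
  where
  i = π ⟨$⟩ʳ zero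
  insert-cong : insert zero i ρ ≈ insert zero i (remove zero π)
  insert-cong zero    = refl
  insert-cong (suc j) = cong (Fin.punchIn i) (ρ≈ j)

permutations-unique : ∀ n → UniqueSetoid.Unique (permSetoid n) (permutations n)
permutations-unique zero    = [] ∷ []
permutations-unique (suc n) = AllPairs.concat⁺
  (All.map⁺ (All.universal (λ i → AllPairs.map⁺ (AllPairs.map (λ ne eq → ne (insert-injective i eq)) (permutations-unique n))) (allFin (suc n))))
  (AllPairs.map⁺ (AllPairs.map disjoint (UniqueSetoid.tabulate⁺ (setoid (Fin (suc n))) id)))
  where
  insert-injective : ∀ i {ρ ρ′ : Permutation′ n} → insert zero i ρ ≈ insert zero i ρ′ → ρ ≈ ρ′
  insert-injective i eq j = Fin.punchIn-injective i _ _ (eq (suc j))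
  disjoint : ∀ {i j} → i ≢ j →
    All (λ π → All (λ π′ → ¬ (π ≈ π′)) (map (insert zero j) (permutations n))) (map (insert zero i) (permutations n))
  disjoint i≢j = All.map⁺ (All.universal (λ _ → All.map⁺ (All.universal (λ _ eq → i≢j (eq zero)) _)) _)

allFin-unique : ∀ n → UniqueSetoid.Unique (setoid (Fin n)) (allFin n)
allFin-unique n = UniqueSetoid.tabulate⁺ (setoid (Fin n)) id

-- Cycles and transpositions

perm-injective : (π : Permutation′ n) {x y : Fin n} → π ⟨$⟩ʳ x ≡ π ⟨$⟩ʳ y → x ≡ y
perm-injective π eq = trans (sym (inverseˡ π)) (trans (cong (π ⟨$⟩ˡ_) eq) (inverseˡ π))

iterate-+ : (f : A → A) (x : A) (m k : ℕ) → iterate f x (m + k) ≡ iterate f (iterate f x m) k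
iterate-+ f x zero    k = refl
iterate-+ f x (suc m) k = iterate-+ f (f x) m k

iterate-suc : (f : A → A) (x : A) (m : ℕ) → iterate f x (suc m) ≡ f (iterate f x m)
iterate-suc f x zero    = refl
iterate-suc f x (suc m) = iterate-suc f (f x) m

iterate-injective : (π : Permutation′ n) {x y : Fin n} (m : ℕ) →
  iterate (π ⟨$⟩ʳ_) x m ≡ iterate (π ⟨$⟩ʳ_) y m → x ≡ y
iterate-injective π zero    eq = eq
iterate-injective π (suc m) eq = perm-injective π (iterate-injective π m eq)

iterate-return : (π : Permutation′ n) {x : Fin n} {i j : ℕ} → i ≤ j →
  iterate (π ⟨$⟩ʳ_) x i ≡ iterate (π ⟨$⟩ʳ_) x j → iterate (π ⟨$⟩ʳ_) x (j ∸ i) ≡ x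
iterate-return π {x} {i} {j} i≤j eq = sym (iterate-injective π i (begin
  iterate f x i                       ≡⟨ eq ⟩
  iterate f x j                       ≡⟨ cong (iterate f x) (ℕ.m∸n+n≡m i≤j) ⟨
  iterate f x (j ∸ i + i)             ≡⟨ iterate-+ f x (j ∸ i) i ⟩
  iterate f (iterate f x (j ∸ i)) i   ∎))
  where
  open ≡-Reasoning
  f = π ⟨$⟩ʳ_

iterate-* : (f : A → A) {x : A} {d : ℕ} → iterate f x d ≡ x → ∀ m → iterate f x (m * d) ≡ x
iterate-* f eq zero    = refl
iterate-* f {x} {d} eq (suc m) = trans (iterate-+ f x d (m * d))
  (trans (cong (λ y → iterate f y (m * d)) eq) (iterate-* f eq m))

returns : (π : Permutation′ n) (x : Fin n) →
  ∃ λ d → NonZero d × d ≤ n × iterate (π ⟨$⟩ʳ_) x d ≡ x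
returns {n} π x with Fin.pigeonhole (ℕ.n<1+n n) (λ j → iterate (π ⟨$⟩ʳ_) x (toℕ j))
... | i , j , i<j , eq = toℕ j ∸ toℕ i , ℕ.>-nonZero (ℕ.m<n⇒0<n∸m i<j)
    , ℕ.≤-trans (ℕ.m∸n≤m (toℕ j) (toℕ i)) (ℕ.≤-pred (toℕ<n j))
    , iterate-return π (ℕ.<⇒≤ i<j) eq

-- `SameCycle` admits only exponents below n. An arbitrary exponent is reduced modulo a return time,
-- which the pigeonhole principle bounds by n.
sameCycle⁺ : (π : Permutation′ n) {x y : Fin n} (m : ℕ) → iterate (π ⟨$⟩ʳ_) x m ≡ y → SameCycle π x y
sameCycle⁺ {n} π {x} m eq with returns π x
... | d , nz , d≤n , ret = fromℕ< r<n , trans (cong (iterate f x) (toℕ-fromℕ< r<n)) (trans (sym reduce) eq)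
  where
  f = π ⟨$⟩ʳ_
  instance _ = nz
  r<n : m ℕ.% d < n
  r<n = ℕ.<-≤-trans (ℕ.m%n<n m d) d≤n
  reduce : iterate f x m ≡ iterate f x (m ℕ.% d)
  reduce = begin
    iterate f x m                                            ≡⟨ cong (iterate f x) (trans (ℕ.m≡m%n+[m/n]*n m d) (ℕ.+-comm (m ℕ.% d) _)) ⟩
    iterate f x ((m ℕ./ d) * d + m ℕ.% d)                    ≡⟨ iterate-+ f x ((m ℕ./ d) * d) (m ℕ.% d) ⟩
    iterate f (iterate f x ((m ℕ./ d) * d)) (m ℕ.% d)        ≡⟨ cong (λ y → iterate f y (m ℕ.% d)) (iterate-* f ret (m ℕ./ d)) ⟩
    iterate f x (m ℕ.% d)                                    ∎
    where open ≡-Reasoning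

module _ (π : Permutation′ n) where
  private f = π ⟨$⟩ʳ_

  sc-refl : {x : Fin n} → SameCycle π x x
  sc-refl = sameCycle⁺ π 0 refl

  sc-step : (x : Fin n) → SameCycle π x (f x)
  sc-step x = sameCycle⁺ π 1 refl

  sc-trans : {x y z : Fin n} → SameCycle π x y → SameCycle π y z → SameCycle π x z
  sc-trans {x} (l , refl) (m , refl) = sameCycle⁺ π (toℕ l + toℕ m) (iterate-+ f x (toℕ l) (toℕ m))

  -- If d + 1 is a return time of x, then m * d steps lead from the m-th iterate back to x, since m
  -- + m * d = m * (d + 1).
  sc-sym : {x y : Fin n} → SameCycle π x y → SameCycle π y x
  sc-sym {x} (m , refl) with returns π x
  ... | suc d , _ , _ , ret = sameCycle⁺ π (toℕ m * d) (trans
      (sym (iterate-+ f x (toℕ m) (toℕ m * d)))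
      (trans (cong (iterate f x) (sym (ℕ.*-suc (toℕ m) d))) (iterate-* f ret (toℕ m))))

  sc-induction : (W : Fin n → Set) → (∀ z → W z → W (f z)) → {x y : Fin n} → W x → SameCycle π x y → W y
  sc-induction W step w (m , refl) = go (toℕ m) w
    where
    go : ∀ m {x} → W x → W (iterate f x m)
    go zero    w = w
    go (suc m) w = go m (step _ w)

sc-map : {m n : ℕ} (π : Permutation′ m) (ρ : Permutation′ n) (h : Fin m → Fin n) →
  (∀ x → h (π ⟨$⟩ʳ x) ≡ ρ ⟨$⟩ʳ (h x)) → {x y : Fin m} → SameCycle π x y → SameCycle ρ (h x) (h y)
sc-map π ρ h hom {x} = sc-induction π (λ z → SameCycle ρ (h x) (h z))
  (λ z s → subst (SameCycle ρ (h x)) (sym (hom z)) (sc-trans ρ s (sc-step ρ (h z)))) (sc-refl ρ)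

sc-transfer : (π ρ : Permutation′ n) {x y : Fin n} →
  (∀ z → SameCycle π x z → ρ ⟨$⟩ʳ z ≡ π ⟨$⟩ʳ z) → SameCycle π x y → SameCycle ρ x y
sc-transfer π ρ {x} h s = proj₂ (sc-induction π (λ z → SameCycle π x z × SameCycle ρ x z)
  (λ z (s , t) → sc-trans π s (sc-step π z) , subst (SameCycle ρ x) (h z s) (sc-trans ρ t (sc-step ρ z)))
  (sc-refl π , sc-refl ρ) s)

sc-flip : (π : Permutation′ n) {x y : Fin n} → SameCycle (flip π) x y → SameCycle π x y
sc-flip π {x} = sc-induction (flip π) (SameCycle π x)
  (λ z s → sc-trans π s (sc-sym π (subst (SameCycle π (π ⟨$⟩ˡ z)) (inverseʳ π) (sc-step π _)))) (sc-refl π)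

sc-flip⁻ : (π : Permutation′ n) {x y : Fin n} → SameCycle π x y → SameCycle (flip π) x y
sc-flip⁻ π = sc-flip (flip π)

-- As maps, ρ = (a b) ∘ π.
record Transposed (π ρ : Permutation′ n) (a b : Fin n) : Set where
  field
    at-a  : ∀ {x} → π ⟨$⟩ʳ x ≡ a → ρ ⟨$⟩ʳ x ≡ b
    at-b  : ∀ {x} → π ⟨$⟩ʳ x ≡ b → ρ ⟨$⟩ʳ x ≡ a
    other : ∀ {x} → π ⟨$⟩ʳ x ≢ a → π ⟨$⟩ʳ x ≢ b → ρ ⟨$⟩ʳ x ≡ π ⟨$⟩ʳ x

module _ {π ρ : Permutation′ n} {a b : Fin n} (T : Transposed π ρ a b) where
  open Transposed T

  transposed-sym : Transposed ρ π a b
  transposed-sym = record { at-a = at-a′ ; at-b = at-b′ ; other = other′ }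
    where
    at-a′ : ∀ {x} → ρ ⟨$⟩ʳ x ≡ a → π ⟨$⟩ʳ x ≡ b
    at-a′ {x} eq with π ⟨$⟩ʳ x ≟ a | π ⟨$⟩ʳ x ≟ b
    ... | _      | yes e = e
    ... | yes e  | no _  = trans e (trans (sym eq) (at-a e))
    ... | no ≢a  | no ≢b = contradiction (trans (sym (other ≢a ≢b)) eq) ≢a
    at-b′ : ∀ {x} → ρ ⟨$⟩ʳ x ≡ b → π ⟨$⟩ʳ x ≡ a
    at-b′ {x} eq with π ⟨$⟩ʳ x ≟ a | π ⟨$⟩ʳ x ≟ b
    ... | yes e  | _     = e
    ... | no _   | yes e = trans e (trans (sym eq) (at-b e))
    ... | no ≢a  | no ≢b = contradiction (trans (sym (other ≢a ≢b)) eq) ≢b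
    other′ : ∀ {x} → ρ ⟨$⟩ʳ x ≢ a → ρ ⟨$⟩ʳ x ≢ b → π ⟨$⟩ʳ x ≡ ρ ⟨$⟩ʳ x
    other′ {x} ρ≢a ρ≢b with π ⟨$⟩ʳ x ≟ a | π ⟨$⟩ʳ x ≟ b
    ... | yes e  | _     = contradiction (at-a e) ρ≢b
    ... | no _   | yes e = contradiction (at-b e) ρ≢a
    ... | no ≢a  | no ≢b = sym (other ≢a ≢b)

  -- The points met by the π-orbit of a before b form a ρ-invariant set.
  transposed-split : a ≢ b → SameCycle π a b → ¬ SameCycle ρ a b
  transposed-split a≢b ab s with sc-induction ρ W step Wa s
    where
    f = π ⟨$⟩ʳ_
    W : Fin n → Set
    W y = ∃ λ u → iterate f a u ≡ y × (∀ v → v ≤ u → iterate f a v ≢ b)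
    Wa : W a
    Wa = 0 , refl , λ { zero _ → a≢b }
    step : ∀ z → W z → W (ρ ⟨$⟩ʳ z)
    step z (u , refl , avoid) with f z ≟ b | f z ≟ a
    ... | yes e | _     = subst W (sym (at-b e)) Wa
    -- If the orbit came back to a before meeting b, the points met so far would form a π-invariant
    -- set, and b would not be in the cycle of a.
    ... | no _  | yes e = ⊥-elim (avoids (sc-induction π V closed (0 , z≤n , refl) ab))
      where
      V : Fin n → Set
      V y = ∃ λ v → v ≤ u × iterate f a v ≡ y
      avoids : ¬ V b
      avoids (v , v≤u , eq) = avoid v v≤u eq
      closed : ∀ y → V y → V (f y)
      closed y (v , v≤u , refl) with v ℕ.≟ u
      ... | yes refl = 0 , z≤n , sym e
      ... | no  v≢u  = suc v , ℕ.≤∧≢⇒< v≤u v≢u , iterate-suc f a v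
    ... | no ≢b | no ≢a = suc u , trans (iterate-suc f a u) (sym (other ≢a ≢b)) , avoid′
      where
      avoid′ : ∀ v → v ≤ suc u → iterate f a v ≢ b
      avoid′ v v≤ with v ℕ.≟ suc u
      ... | yes refl = λ eq → ≢b (trans (sym (iterate-suc f a u)) eq)
      ... | no  v≢   = avoid v (ℕ.≤-pred (ℕ.≤∧≢⇒< v≤ v≢))
  ... | u , eq , avoid = avoid u ℕ.≤-refl eq

  -- The π-cycle of a does not meet b, so ρ follows it from a as far as the π-preimage e of a, and
  -- then sends e to b.
  transposed-join : ¬ SameCycle π a b → SameCycle ρ a b
  transposed-join ¬ab = sc-trans ρ (proj₂ (walk pre-a)) (subst (SameCycle ρ e) (at-a (inverseʳ π)) (sc-step ρ e))
    where
    e = π ⟨$⟩ˡ a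
    pre-a : SameCycle π a e
    pre-a = sc-sym π (subst (SameCycle π e) (inverseʳ π) (sc-step π e))
    walk : ∀ {y} → SameCycle π a y → SameCycle π a y × SameCycle ρ a y
    walk = sc-induction π (λ y → SameCycle π a y × SameCycle ρ a y) step (sc-refl π , sc-refl ρ)
      where
      step : ∀ z → SameCycle π a z × SameCycle ρ a z → SameCycle π a (π ⟨$⟩ʳ z) × SameCycle ρ a (π ⟨$⟩ʳ z)
      step z (s , t) with π ⟨$⟩ʳ z ≟ a
      ... | yes eq = sc-trans π s (sc-step π z) , subst (SameCycle ρ a) (sym eq) (sc-refl ρ)
      ... | no  ≢a = s′ , subst (SameCycle ρ a) (other ≢a λ eq → ¬ab (subst (SameCycle π a) eq s′)) (sc-trans ρ t (sc-step ρ z))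
        where s′ = sc-trans π s (sc-step π z)

  transposed-outside : {x y : Fin n} → ¬ SameCycle π x a → ¬ SameCycle π x b → SameCycle π x y → SameCycle ρ x y
  transposed-outside {x} ¬a ¬b = sc-transfer π ρ λ z s → other
    (λ eq → ¬a (subst (SameCycle π x) eq (sc-trans π s (sc-step π z))))
    (λ eq → ¬b (subst (SameCycle π x) eq (sc-trans π s (sc-step π z))))

  transposed-outside⁻ : {x y : Fin n} → ¬ SameCycle ρ x a → ¬ SameCycle ρ x b → SameCycle π x y → SameCycle ρ x y
  transposed-outside⁻ {x} ¬a ¬b = sc-induction π (SameCycle ρ x)
    (λ z s → let t = sc-trans ρ s (sc-step ρ z) in subst (SameCycle ρ x)
      (sym (Transposed.other transposed-sym (λ eq → ¬a (subst (SameCycle ρ x) eq t)) (λ eq → ¬b (subst (SameCycle ρ x) eq t)))) t)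
    (sc-refl ρ)

  -- The union of the cycles of a and b is the same for both permutations, as they agree outside of
  -- it; only its division into cycles changes.
  transposed-classes : {x : Fin n} → SameCycle π x a ⊎ SameCycle π x b → SameCycle ρ x a ⊎ SameCycle ρ x b
  transposed-classes {x} s with sameCycle? ρ x a | sameCycle? ρ x b
  ... | yes t | _     = inj₁ t
  ... | no _  | yes t = inj₂ t
  ... | no ¬a | no ¬b = [ (λ t → contradiction (transposed-outside⁻ ¬a ¬b t) ¬a)
                        , (λ t → contradiction (transposed-outside⁻ ¬a ¬b t) ¬b) ]′ s

module _ {P : Fin n → Set} (P? : ∀ x → Dec (P x)) where

  argmin : (key : Fin n → ℕ) {x : Fin n} → P x → ∃ λ y → P y × (∀ z → P z → key y ≤ key z)
  argmin key {x} px = go (suc (key x)) x px ℕ.≤-refl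
    where
    go : ∀ fuel x → P x → key x < fuel → ∃ λ y → P y × (∀ z → P z → key y ≤ key z)
    go (suc fuel) x px k< with any? (λ y → P? y ×-dec (key y ℕ.<? key x))
    ... | yes (y , py , y<x) = go fuel y py (ℕ.<-≤-trans y<x (ℕ.≤-pred k<))
    ... | no  none           = x , px , λ z pz → ℕ.≮⇒≥ (λ z<x → none (z , pz , z<x))

  argmax : (key : Fin n → Fin n) {x : Fin n} → P x → ∃ λ y → P y × (∀ z → P z → key z Fin.≤ key y)
  argmax key px with argmin (λ z → n ∸ toℕ (key z)) px
  ... | y , py , least = y , py , λ z pz → ℕ.≮⇒≥ (λ y<z →
    ℕ.<⇒≱ (ℕ.∸-monoʳ-< y<z (ℕ.<⇒≤ (toℕ<n (key z)))) (least z pz))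

-- A permutation pos encodes a word: it sends each point to its position, and
-- points are compared by their positions.
IsMin : Permutation′ n → Permutation′ n → Fin n → Set
IsMin pos π i = ∀ j → SameCycle π i j → pos ⟨$⟩ʳ i Fin.≤ pos ⟨$⟩ʳ j

isMin? : (pos π : Permutation′ n) (i : Fin n) → Dec (IsMin pos π i)
isMin? pos π i = all? λ j → sameCycle? π i j →-dec (pos ⟨$⟩ʳ i Fin.≤? pos ⟨$⟩ʳ j)

module _ (pos π : Permutation′ n) where

  min-exists : (x : Fin n) → ∃ λ r → IsMin pos π r × SameCycle π x r
  min-exists x with argmin (sameCycle? π x) (λ z → toℕ (pos ⟨$⟩ʳ z)) (sc-refl π)
  ... | r , xr , least = r , (λ j rj → least j (sc-trans π xr rj)) , xr

  min-unique : ∀ {r s} → IsMin pos π r → IsMin pos π s → SameCycle π r s → r ≡ s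
  min-unique mr ms rs = perm-injective pos (toℕ-injective (ℕ.≤-antisym (mr _ rs) (ms _ (sc-sym π rs))))

cycleLength-match : (π ρ g : Permutation′ n) {x y : Fin n} →
  (∀ z → SameCycle π x z → SameCycle ρ y (g ⟨$⟩ʳ z)) → (∀ z → SameCycle ρ y (g ⟨$⟩ʳ z) → SameCycle π x z) →
  cycleLength π x ≡ cycleLength ρ y
cycleLength-match {n} π ρ g {x} {y} to from = count-match {setoid _} {setoid _} (allFin-unique n) (allFin-unique n)
  (sameCycle? π x) (sameCycle? ρ y) (λ u v → g ⟨$⟩ʳ u ≡ v)
  (λ {u} _ s → g ⟨$⟩ʳ u , ∈-allFin _ , to u s , refl)
  (λ {v} _ s → g ⟨$⟩ˡ v , ∈-allFin _ , from _ (subst (SameCycle ρ y) (sym (inverseʳ g)) s) , inverseʳ g)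
  (λ _ _ _ e e′ → perm-injective g (trans e (sym e′)))
  (λ _ _ _ e e′ → trans (sym e) e′)

cycleLength-sc : (π : Permutation′ n) {x y : Fin n} → SameCycle π x y → cycleLength π x ≡ cycleLength π y
cycleLength-sc π s = cycleLength-match π π idₚ (λ z → sc-trans π (sc-sym π s)) (λ z → sc-trans π s)

-- Conjugation carries cycles to cycles but not least points to least points. Two representatives
-- are therefore matched when the image of the one lies in the cycle of the other.
cycleLengths-conj : (π ρ g : Permutation′ n) → (∀ x → g ⟨$⟩ʳ (π ⟨$⟩ʳ x) ≡ ρ ⟨$⟩ʳ (g ⟨$⟩ʳ x)) →
  cycleLengths π ↭ cycleLengths ρ
cycleLengths-conj {n} π ρ g hom = filter-match-↭ {setoid _} {setoid _} (allFin-unique n) (allFin-unique n)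
  (isCycleMin? π) (isCycleMin? ρ) (λ x y → SameCycle ρ (g ⟨$⟩ʳ x) y)
  (λ {x} _ _ → let y , m , s = min-exists idₚ ρ (g ⟨$⟩ʳ x) in y , ∈-allFin _ , m , s)
  (λ {y} _ _ → let x , m , s = min-exists idₚ π (g ⟨$⟩ˡ y) in
    x , ∈-allFin _ , m , sc-sym ρ (subst (λ w → SameCycle ρ w (g ⟨$⟩ʳ x)) (inverseʳ g) (fwd s)))
  (λ m m′ _ s s′ → min-unique idₚ π m m′ (bwd (sc-trans ρ s (sc-sym ρ s′))))
  (λ _ m m′ s s′ → min-unique idₚ ρ m m′ (sc-trans ρ (sc-sym ρ s) s′))
  (λ _ _ s → trans (cycleLength-match π ρ g (λ z → fwd) (λ z → bwd)) (cycleLength-sc ρ s))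
  where
  fwd : ∀ {x y} → SameCycle π x y → SameCycle ρ (g ⟨$⟩ʳ x) (g ⟨$⟩ʳ y)
  fwd = sc-map π ρ (g ⟨$⟩ʳ_) hom
  bwd : ∀ {x y} → SameCycle ρ (g ⟨$⟩ʳ x) (g ⟨$⟩ʳ y) → SameCycle π x y
  bwd s = subst₂ (SameCycle π) (inverseˡ g) (inverseˡ g) (sc-map ρ π (g ⟨$⟩ˡ_)
    (λ x → trans (cong (λ z → g ⟨$⟩ˡ (ρ ⟨$⟩ʳ z)) (sym (inverseʳ g))) (trans (cong (g ⟨$⟩ˡ_) (sym (hom _))) (inverseˡ g))) s)

cycleLengths-cong : (π ρ : Permutation′ n) → π ≈ ρ → cycleLengths π ↭ cycleLengths ρ
cycleLengths-cong π ρ eq = cycleLengths-conj π ρ idₚ eq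

cycleLengths-flip : (π : Permutation′ n) → cycleLengths (flip π) ↭ cycleLengths π
cycleLengths-flip {n} π = filter-match-↭ {setoid _} {setoid _} (allFin-unique n) (allFin-unique n)
  (isCycleMin? (flip π)) (isCycleMin? π) _≡_
  (λ {x} _ m → x , ∈-allFin _ , (λ j s → m j (sc-flip⁻ π s)) , refl)
  (λ {x} _ m → x , ∈-allFin _ , (λ j s → m j (sc-flip π s)) , refl)
  (λ { _ _ _ refl refl → refl }) (λ { _ _ _ refl refl → refl })
  (λ { _ _ refl → cycleLength-match (flip π) π idₚ (λ z → sc-flip π) (λ z → sc-flip⁻ π) })

cycleLength>0 : (π : Permutation′ n) (x : Fin n) → 0 < cycleLength π x
cycleLength>0 {n} π x = subst (1 ≤_) (sym (count≡∑ (sameCycle? π x) (allFin n)))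
  (∑≥1 {f = λ y → 𝟙 (sameCycle? π x y)} (∈-allFin x) (ℕ.≤-reflexive (sym (𝟙-yes (sameCycle? π x x) (sc-refl π)))))

count-one : {xs : List A} {P : A → Set} (P? : ∀ x → Dec (P x)) → UniqueSetoid.Unique (setoid A) xs →
  {r : A} → r ∈ xs → P r → (∀ {s} → P s → s ≡ r) → count P? xs ≡ 1
count-one P? u {r} r∈ pr uniq = count-match {setoid _} {setoid (Fin 1)} u (allFin-unique 1) P? (λ z → yes (refl {x = z}))
  (λ s z → z ≡ z)
  (λ _ _ → zero , here refl , refl , refl) (λ _ _ → r , r∈ , pr , refl)
  (λ p p′ _ _ _ → trans (uniq p) (sym (uniq p′))) (λ { {y = zero} {zero} _ _ _ _ _ → refl })

filter-one : {xs : List A} {P : A → Set} (P? : ∀ x → Dec (P x)) → UniqueSetoid.Unique (setoid A) xs →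
  {r : A} → r ∈ xs → P r → (∀ {s} → P s → s ≡ r) → filter P? xs ≡ r ∷ []
filter-one {xs = xs} P? u r∈ pr uniq with filter P? xs | ∈-filter⁺ P? r∈ pr | count-one P? u r∈ pr uniq
... | _ ∷ [] | here refl | _ = refl

count-none : {P : A → Set} (P? : ∀ x → Dec (P x)) (xs : List A) → (∀ x → ¬ P x) → count P? xs ≡ 0
count-none P? xs h = trans (count≡∑ P? xs) (trans (∑-cong xs (λ x → 𝟙-no (P? x) (h x))) (∑-0 xs))

∑-allFin-suc : ∀ n (f : Fin (suc n) → ℕ) → ∑-syntax (allFin (suc n)) f ≡ f zero + (∑[ i ∈ allFin n ] (f (suc i)))
∑-allFin-suc n f = cong (_+_ (f zero)) (trans (cong (λ xs → sum (map f xs)) (sym (List.map-tabulate id suc))) (∑-map suc (allFin n) f))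

-- Invariant sets of points as unions of cycles

∣∣≡∑ : ∀ {n} (U : Subset n) → ∣ U ∣ ≡ ∑[ x ∈ allFin n ] 𝟙 (x ∈ₛ? U)
∣∣≡∑ []          = refl
∣∣≡∑ {suc n} (b ∷ U) = trans (head b) (sym (trans (∑-allFin-suc n _) (cong (_+_ (𝟙 (zero ∈ₛ? (b ∷ U)))) (∑-cong (allFin n) λ x →
    𝟙-cong (λ { (Vec.there m) → m }) Vec.there (suc x ∈ₛ? (b ∷ U)) (x ∈ₛ? U)))))
  where
  head : ∀ b → ∣ b ∷ U ∣ ≡ 𝟙 (zero ∈ₛ? (b ∷ U)) + (∑[ x ∈ allFin n ] 𝟙 (x ∈ₛ? U))
  head true  = cong suc (∣∣≡∑ U)
  head false = ∣∣≡∑ U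

Stable : Permutation′ n → Subset n → Set
Stable π U = ∀ x → x ∈ₛ U → π ⟨$⟩ʳ x ∈ₛ U

stable? : (π : Permutation′ n) (U : Subset n) → Dec (Stable π U)
stable? π U = all? λ x → (x ∈ₛ? U) →-dec ((π ⟨$⟩ʳ x) ∈ₛ? U)

stable-sc : (π : Permutation′ n) {U : Subset n} → Stable π U → {x y : Fin n} → x ∈ₛ U → SameCycle π x y → y ∈ₛ U
stable-sc π {U} st = sc-induction π (_∈ₛ U) st

inside? : (π : Permutation′ n) (U : Subset n) (a : Fin n) → Dec (IsCycleMin π a × a ∈ₛ U)
inside? π U a = isCycleMin? π a ×-dec (a ∈ₛ? U)

outside? : (π : Permutation′ n) (U : Subset n) (a : Fin n) → Dec (IsCycleMin π a × ¬ (a ∈ₛ U))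
outside? π U a = isCycleMin? π a ×-dec ¬? (a ∈ₛ? U)

inside outside : Permutation′ n → Subset n → List (Fin n)
inside  {n} π U = filter (inside? π U) (allFin n)
outside {n} π U = filter (outside? π U) (allFin n)

#inside : Permutation′ n → Subset n → ℕ
#inside π U = length (inside π U)

-- The cycle type after all cycles inside an invariant set U are regarded as one, which has as many
-- points as U.
merged : Permutation′ n → Subset n → List ℕ
merged π U = ∣ U ∣ ∷ map (cycleLength π) (outside π U)

-- A system of representatives of the cycles that make up U. Cycles are counted by least points,
-- ordered by first points in a word, and after a cut represented by the points at which it was
-- made; any two such systems are equinumerous.
record Reps (π : Permutation′ n) (U : Subset n) (P : Fin n → Set) : Set where
  field
    ⊆U   : ∀ {x} → P x → x ∈ₛ U
    hit  : ∀ {x} → x ∈ₛ U → ∃ λ r → P r × SameCycle π x r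
    uniq : ∀ {r s} → P r → P s → SameCycle π r s → r ≡ s

min-reps : (pos π : Permutation′ n) {U : Subset n} → Stable π U → Reps π U (λ a → IsMin pos π a × a ∈ₛ U)
min-reps pos π st = record
  { ⊆U = proj₂
  ; hit = λ {x} x∈U → let r , m , s = min-exists pos π x in r , (m , stable-sc π st x∈U s) , s
  ; uniq = λ (m , _) (m′ , _) s → min-unique pos π m m′ s
  }

count-reps : (π : Permutation′ n) {U : Subset n} {P Q : Fin n → Set} → Reps π U P → Reps π U Q →
  (P? : ∀ x → Dec (P x)) (Q? : ∀ x → Dec (Q x)) → count P? (allFin n) ≡ count Q? (allFin n)
count-reps {n} π RP RQ P? Q? = count-match {setoid _} {setoid _} (allFin-unique n) (allFin-unique n) P? Q? (SameCycle π)
  (λ _ p → let y , q , s = Reps.hit RQ (Reps.⊆U RP p) in y , ∈-allFin _ , q , s)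
  (λ _ q → let x , p , s = Reps.hit RP (Reps.⊆U RQ q) in x , ∈-allFin _ , p , sc-sym π s)
  (λ p p′ _ s s′ → Reps.uniq RP p p′ (sc-trans π s (sc-sym π s′)))
  (λ _ q q′ s s′ → Reps.uniq RQ q q′ (sc-trans π (sc-sym π s) s′))

#inside≡ : (π : Permutation′ n) {U : Subset n} → Stable π U → {P : Fin n → Set} → Reps π U P →
  (P? : ∀ x → Dec (P x)) → #inside π U ≡ count P? (allFin n)
#inside≡ π {U} st R P? = count-reps π (min-reps idₚ π st) R (inside? π U) P?

-- Double counting of the pairs formed by a representative in U and a point of its cycle: each point
-- of U belongs to exactly one pair, and no other point to any.
∑-inside : (π : Permutation′ n) {U : Subset n} → Stable π U → sum (map (cycleLength π) (inside π U)) ≡ ∣ U ∣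
∑-inside {n} π {U} st = begin
  ∑[ a ∈ inside π U ] (cycleLength π a)
    ≡⟨ ∑-filter (inside? π U) (allFin n) (cycleLength π) ⟩
  ∑[ a ∈ allFin n ] (𝟙 (inside? π U a) * cycleLength π a)
    ≡⟨ ∑-cong (allFin n) (λ a → trans (cong (_*_ (𝟙 (inside? π U a))) (count≡∑ (sameCycle? π a) (allFin n)))
         (trans (sym (∑-*ˡ (𝟙 (inside? π U a)) (allFin n) _))
           (∑-cong (allFin n) (λ z → sym (𝟙-× (inside? π U a) (sameCycle? π a z)))))) ⟩
  ∑[ a ∈ allFin n ] (∑[ z ∈ allFin n ] 𝟙 (inside? π U a ×-dec sameCycle? π a z))
    ≡⟨ ∑-swap (allFin n) (allFin n) _ ⟩
  ∑[ z ∈ allFin n ] (∑[ a ∈ allFin n ] 𝟙 (inside? π U a ×-dec sameCycle? π a z))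
    ≡⟨ ∑-cong (allFin n) (λ z → sym (count≡∑ _ (allFin n))) ⟩
  ∑[ z ∈ allFin n ] (count (λ a → inside? π U a ×-dec sameCycle? π a z) (allFin n))
    ≡⟨ ∑-cong (allFin n) one ⟩
  ∑[ z ∈ allFin n ] 𝟙 (z ∈ₛ? U)
    ≡⟨ ∣∣≡∑ U ⟨
  ∣ U ∣ ∎
  where
  open ≡-Reasoning
  one : ∀ z → count (λ a → inside? π U a ×-dec sameCycle? π a z) (allFin n) ≡ 𝟙 (z ∈ₛ? U)
  one z with z ∈ₛ? U
  ... | no z∉ = count-none _ (allFin n) (λ { a ((_ , a∈) , s) → z∉ (stable-sc π st a∈ s) })
  ... | yes z∈ = let r , (m , r∈) , s = Reps.hit (min-reps idₚ π st) z∈ in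
    count-one _ (allFin-unique n) (∈-allFin r) ((m , r∈) , sc-sym π s)
      (λ { ((m′ , _) , s′) → min-unique idₚ π m′ m (sc-trans π s′ s) })

filter-split-↭ : {P Q : A → Set} (P? : ∀ x → Dec (P x)) (Q? : ∀ x → Dec (Q x)) (xs : List A) →
  filter P? xs ↭ filter (λ x → P? x ×-dec Q? x) xs ++ filter (λ x → P? x ×-dec ¬? (Q? x)) xs
filter-split-↭ P? Q? []       = ↭-refl
filter-split-↭ P? Q? (x ∷ xs) with P? x | Q? x
... | yes _ | yes _ = ↭-prep x (filter-split-↭ P? Q? xs)
... | yes _ | no  _ = ↭-trans (↭-prep x (filter-split-↭ P? Q? xs)) (↭-sym (shift x _ _))
... | no  _ | yes _ = filter-split-↭ P? Q? xs
... | no  _ | no  _ = filter-split-↭ P? Q? xs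

cycleLengths-split : (π : Permutation′ n) (U : Subset n) →
  cycleLengths π ↭ map (cycleLength π) (inside π U) ++ map (cycleLength π) (outside π U)
cycleLengths-split {n} π U = ↭-trans (map⁺ (cycleLength π) (filter-split-↭ (isCycleMin? π) (_∈ₛ? U) (allFin n)))
  (↭-reflexive (map-++ (cycleLength π) (inside π U) (outside π U)))

merged-cycle : (π : Permutation′ n) {U : Subset n} (i : Fin n) →
  (∀ {x} → x ∈ₛ U → SameCycle π i x) → (∀ {x} → SameCycle π i x → x ∈ₛ U) →
  cycleLengths π ↭ merged π U
merged-cycle {n} π {U} i sound complete = ↭-trans (cycleLengths-split π U)
  (↭-reflexive (cong (_++ map (cycleLength π) (outside π U)) single))
  where
  st : Stable π U
  st x x∈ = complete (sc-trans π (sound x∈) (sc-step π x))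
  single : map (cycleLength π) (inside π U) ≡ ∣ U ∣ ∷ []
  single with min-exists idₚ π i
  ... | r , m , s with filter-one (inside? π U) (allFin-unique n) (∈-allFin r) (m , complete s)
                        (λ { (m′ , s∈) → min-unique idₚ π m′ m (sc-trans π (sc-sym π (sound s∈)) s) }) | ∑-inside π st
  ... | eq | tot rewrite eq = cong (_∷ []) (trans (sym (ℕ.+-identityʳ _)) tot)

-- By invariance no cycle starting outside U ever enters it, so the cycles outside U are the same
-- for both permutations.
merged-cong : (π ρ : Permutation′ n) {U : Subset n} → Stable π U → Stable ρ U →
  (∀ {x} → ¬ (x ∈ₛ U) → ρ ⟨$⟩ʳ x ≡ π ⟨$⟩ʳ x) → merged π U ≡ merged ρ U
merged-cong {n} π ρ {U} stπ stρ agree = cong (∣ U ∣ ∷_) (trans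
  (cong (map (cycleLength π)) (filter-cong∈ (outside? π U) (outside? ρ U) (allFin n)
    (λ _ (m , x∉) → (λ j s → m j (ρ⇒π x∉ s)) , x∉) (λ _ (m , x∉) → (λ j s → m j (π⇒ρ x∉ s)) , x∉)))
  (map-cong-∈ (λ x∈ → let x∉ = proj₂ (proj₂ (∈-filter⁻ (outside? ρ U) {xs = allFin n} x∈)) in
    cycleLength-match π ρ idₚ (λ z → π⇒ρ x∉) (λ z → ρ⇒π x∉))))
  where
  π⇒ρ : ∀ {x y} → ¬ (x ∈ₛ U) → SameCycle π x y → SameCycle ρ x y
  π⇒ρ x∉ = sc-transfer π ρ (λ z s → agree (λ z∈ → x∉ (stable-sc π stπ z∈ (sc-sym π s))))
  ρ⇒π : ∀ {x y} → ¬ (x ∈ₛ U) → SameCycle ρ x y → SameCycle π x y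
  ρ⇒π x∉ = sc-transfer ρ π (λ z s → sym (agree (λ z∈ → x∉ (stable-sc ρ stρ z∈ (sc-sym ρ s)))))
  map-cong-∈ : ∀ {f g : Fin n → ℕ} {xs} → (∀ {x} → x ∈ xs → f x ≡ g x) → map f xs ≡ map g xs
  map-cong-∈ {xs = []}     h = refl
  map-cong-∈ {xs = x ∷ xs} h = cong₂ _∷_ (h (here refl)) (map-cong-∈ (h ∘ there))

-- Words and the exchange of adjacent intervals

-- The rotation, the exchange of intervals and the conjugating bijection are all given by relations,
-- whose two directions can be treated alike.
permutation-of-relation : (R : Fin n → Fin n → Set) →
  (∀ x → ∃ λ y → R x y) → (∀ y → ∃ λ x → R x y) →
  (∀ {x y y′} → R x y → R x y′ → y ≡ y′) → (∀ {x x′ y} → R x y → R x′ y → x ≡ x′) →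
  Σ[ π ∈ Permutation′ n ] (∀ x → R x (π ⟨$⟩ʳ x))
permutation-of-relation R to from functional injective =
  permutation (λ x → proj₁ (to x)) (λ y → proj₁ (from y))
    (λ y → functional (proj₂ (to _)) (proj₂ (from y))) (λ x → injective (proj₂ (from _)) (proj₂ (to x)))
  , λ x → proj₂ (to x)

Next : ∀ {n} → Fin n → Fin n → Set
Next {n} x y = toℕ y ≡ suc (toℕ x) ⊎ (suc (toℕ x) ≡ n × toℕ y ≡ 0)

next-functional : {x y y′ : Fin n} → Next x y → Next x y′ → y ≡ y′
next-functional (inj₁ e)       (inj₁ e′)       = toℕ-injective (trans e (sym e′))
next-functional {y = y} (inj₁ e) (inj₂ (l , e′)) = contradiction (trans e l) (ℕ.<⇒≢ (toℕ<n y))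
next-functional {y′ = y′} (inj₂ (l , e)) (inj₁ e′) = contradiction (trans e′ l) (ℕ.<⇒≢ (toℕ<n y′))
next-functional (inj₂ (_ , e)) (inj₂ (_ , e′)) = toℕ-injective (trans e (sym e′))

next-injective : {x x′ y : Fin n} → Next x y → Next x′ y → x ≡ x′
next-injective (inj₁ e)       (inj₁ e′)       = toℕ-injective (ℕ.suc-injective (trans (sym e) e′))
next-injective (inj₁ e)       (inj₂ (_ , e′)) = contradiction (trans (sym e′) e) λ ()
next-injective (inj₂ (_ , e)) (inj₁ e′)       = contradiction (trans (sym e) e′) λ ()
next-injective (inj₂ (l , _)) (inj₂ (l′ , _)) = toℕ-injective (ℕ.suc-injective (trans l (sym l′)))

next-total : (x : Fin n) → ∃ λ y → Next x y
next-total {n} x with suc (toℕ x) ℕ.<? n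
... | yes lt = fromℕ< lt , inj₁ (toℕ-fromℕ< lt)
... | no ¬lt = fromℕ< 0<n , inj₂ (ℕ.≤-antisym (toℕ<n x) (ℕ.≮⇒≥ ¬lt) , toℕ-fromℕ< 0<n)
  where 0<n = ℕ.≤-<-trans z≤n (toℕ<n x)

prev-total : (y : Fin n) → ∃ λ x → Next x y
prev-total {suc n} zero    = fromℕ n , inj₂ (cong suc (Fin.toℕ-fromℕ n) , refl)
prev-total {suc n} (suc y) = inject₁ y , inj₁ (cong suc (sym (Fin.toℕ-inject₁ y)))

abstract
  rotation : ∀ n → Σ[ c ∈ Permutation′ n ] (∀ x → Next x (c ⟨$⟩ʳ x))
  rotation n = permutation-of-relation Next next-total prev-total next-functional next-injective

rot : ∀ n → Permutation′ n
rot n = proj₁ (rotation n)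

-- The n-cycle s read off the word: each point goes to the next one, and the last point to the
-- first. It is the conjugate of `rot n` by `pos`.
succ : Permutation′ n → Permutation′ n
succ {n} pos = pos ∘ₚ rot n ∘ₚ flip pos

succ-next : (pos : Permutation′ n) (x : Fin n) → Next (pos ⟨$⟩ʳ x) (pos ⟨$⟩ʳ (succ pos ⟨$⟩ʳ x))
succ-next {n} pos x = subst (Next (pos ⟨$⟩ʳ x)) (sym (inverseʳ pos)) (proj₂ (rotation n) _)

succ-unique : (pos : Permutation′ n) {x y : Fin n} → Next (pos ⟨$⟩ʳ x) (pos ⟨$⟩ʳ y) → succ pos ⟨$⟩ʳ x ≡ y
succ-unique pos {x} nx = perm-injective pos (next-functional (succ-next pos x) nx)

-- The exchange of two adjacent intervals of lengths b and c, the first of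
-- which starts at P.
data Exchange (P b c : ℕ) : ℕ → ℕ → Set where
  before : ∀ {x} → x < P → Exchange P b c x x
  first  : ∀ {j} → j < b → Exchange P b c (P + j) (P + (c + j))
  second : ∀ {j} → j < c → Exchange P b c (P + (b + j)) (P + j)
  after  : ∀ j → Exchange P b c (P + (b + (c + j))) (P + (c + (b + j)))

module _ {P b c : ℕ} where

  exchange-sym : ∀ {x y} → Exchange P b c x y → Exchange P c b y x
  exchange-sym (before lt) = before lt
  exchange-sym (first lt)  = second lt
  exchange-sym (second lt) = first lt
  exchange-sym (after j)   = after j

  exchange-total : ∀ x → ∃ λ y → Exchange P b c x y
  exchange-total x with x ℕ.<? P
  ... | yes x<P = x , before x<P
  ... | no ¬x<P with ℕ.m≤n⇒∃[o]m+o≡n (ℕ.≮⇒≥ ¬x<P)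
  ... | j , refl with j ℕ.<? b
  ... | yes j<b = _ , first j<b
  ... | no ¬j<b with ℕ.m≤n⇒∃[o]m+o≡n (ℕ.≮⇒≥ ¬j<b)
  ... | k , refl with k ℕ.<? c
  ... | yes k<c = _ , second k<c
  ... | no ¬k<c with ℕ.m≤n⇒∃[o]m+o≡n (ℕ.≮⇒≥ ¬k<c)
  ... | l , refl = _ , after l

  private
    clash : ∀ {x} → P + x < P → ⊥
    clash = ℕ.m+n≮m P _
    clash′ : ∀ {j x m} → j < m → P + j ≡ P + (m + x) → ⊥
    clash′ {m = m} j<m e with ℕ.+-cancelˡ-≡ P _ _ e
    ... | refl = ℕ.m+n≮m m _ j<m
    clash″ : ∀ {j x} → j < c → P + (b + j) ≡ P + (b + (c + x)) → ⊥
    clash″ j<c e with ℕ.+-cancelˡ-≡ b _ _ (ℕ.+-cancelˡ-≡ P _ _ e)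
    ... | refl = ℕ.m+n≮m c _ j<c

  exchange-functional : ∀ {x x′ y y′} → Exchange P b c x y → Exchange P b c x′ y′ → x ≡ x′ → y ≡ y′
  exchange-functional (before lt) (before _)  e    = e
  exchange-functional (before lt) (first _)   refl = ⊥-elim (clash lt)
  exchange-functional (before lt) (second _)  refl = ⊥-elim (clash lt)
  exchange-functional (before lt) (after _)   refl = ⊥-elim (clash lt)
  exchange-functional (first _)   (before lt) refl = ⊥-elim (clash lt)
  exchange-functional (second _)  (before lt) refl = ⊥-elim (clash lt)
  exchange-functional (after _)   (before lt) refl = ⊥-elim (clash lt)
  exchange-functional (first lt)  (first _)   e    = cong (λ j → P + (c + j)) (ℕ.+-cancelˡ-≡ P _ _ e)
  exchange-functional (first lt)  (second _)  e    = ⊥-elim (clash′ lt e)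
  exchange-functional (first lt)  (after _)   e    = ⊥-elim (clash′ lt e)
  exchange-functional (second _)  (first lt)  e    = ⊥-elim (clash′ lt (sym e))
  exchange-functional (after _)   (first lt)  e    = ⊥-elim (clash′ lt (sym e))
  exchange-functional (second lt) (second _)  e    = cong (_+_ P) (ℕ.+-cancelˡ-≡ b _ _ (ℕ.+-cancelˡ-≡ P _ _ e))
  exchange-functional (second lt) (after _)   e    = ⊥-elim (clash″ lt e)
  exchange-functional (after _)   (second lt) e    = ⊥-elim (clash″ lt (sym e))
  exchange-functional (after _)   (after _)   e    = cong (λ j → P + (c + (b + j)))
    (ℕ.+-cancelˡ-≡ c _ _ (ℕ.+-cancelˡ-≡ b _ _ (ℕ.+-cancelˡ-≡ P _ _ e)))

  -- Positions after both intervals do not move. In `after` they are nevertheless written with b and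
  -- c in either order, so that the inverse of an exchange is again an exchange without any
  -- rewriting.
  +-exchange : ∀ j → P + (c + (b + j)) ≡ P + (b + (c + j))
  +-exchange j = cong (_+_ P) (trans (sym (ℕ.+-assoc c b j)) (trans (cong (_+ j) (ℕ.+-comm c b)) (ℕ.+-assoc b c j)))

  exchange-< : ∀ {x y n} → P + (b + c) < n → Exchange P b c x y → x < n → y < n
  exchange-< R<n (before _)        x<n = x<n
  exchange-< R<n (first {j} lt)    x<n = ℕ.≤-<-trans (ℕ.+-monoʳ-≤ P (ℕ.≤-trans (ℕ.+-monoʳ-≤ c (ℕ.<⇒≤ lt)) (ℕ.≤-reflexive (ℕ.+-comm c b)))) R<n
  exchange-< R<n (second {j} lt)   x<n = ℕ.≤-<-trans (ℕ.+-monoʳ-≤ P (ℕ.m≤n+m j b)) x<n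
  exchange-< {n = n} R<n (after j) x<n = subst (_< n) (sym (+-exchange j)) x<n

-- pos′ arises from pos by exchanging the interval from a₁ to before a₂ with
-- the interval from a₂ to before a₃.
record Swap {n} (a₁ a₂ a₃ : Fin n) (pos pos′ : Permutation′ n) : Set where
  field
    {P b c} : ℕ
    0<b : 0 < b
    0<c : 0 < c
    at₁ : toℕ (pos ⟨$⟩ʳ a₁) ≡ P
    at₂ : toℕ (pos ⟨$⟩ʳ a₂) ≡ P + b
    at₃ : toℕ (pos ⟨$⟩ʳ a₃) ≡ P + (b + c)
    exch : ∀ x → Exchange P b c (toℕ (pos ⟨$⟩ʳ x)) (toℕ (pos′ ⟨$⟩ʳ x))

  at₂′ : toℕ (pos′ ⟨$⟩ʳ a₂) ≡ P
  at₂′ = trans (exchange-functional (exch a₂) (second 0<c) (trans at₂ (cong (_+_ P) (sym (ℕ.+-identityʳ b))))) (ℕ.+-identityʳ P)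

  at₁′ : toℕ (pos′ ⟨$⟩ʳ a₁) ≡ P + c
  at₁′ = trans (exchange-functional (exch a₁) (first 0<b) (trans at₁ (sym (ℕ.+-identityʳ P)))) (cong (_+_ P) (ℕ.+-identityʳ c))

  at₃′ : toℕ (pos′ ⟨$⟩ʳ a₃) ≡ P + (c + b)
  at₃′ = trans (exchange-functional (exch a₃) (after 0) (trans at₃ (cong (λ k → P + (b + k)) (sym (ℕ.+-identityʳ c)))))
    (cong (λ k → P + (c + k)) (ℕ.+-identityʳ b))

swap-sym : {a₁ a₂ a₃ : Fin n} {pos pos′ : Permutation′ n} → Swap a₁ a₂ a₃ pos pos′ → Swap a₂ a₁ a₃ pos′ pos
swap-sym S = record { 0<b = 0<c ; 0<c = 0<b ; at₁ = at₂′ ; at₂ = at₁′ ; at₃ = at₃′ ; exch = λ x → exchange-sym (exch x) }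
  where open Swap S

-- P, b and c can be read off the positions of the three points, and they determine where every
-- position goes.
swap-functional : {a₁ a₂ a₃ : Fin n} {pos pos′ pos″ : Permutation′ n} →
  Swap a₁ a₂ a₃ pos pos′ → Swap a₁ a₂ a₃ pos pos″ → pos′ ≈ pos″
swap-functional {pos = pos} {pos′} {pos″} S T x = toℕ-injective (go (trans (sym S.at₁) T.at₁) (trans (sym S.at₂) T.at₂) (trans (sym S.at₃) T.at₃) (S.exch x) (T.exch x))
  where
  module S = Swap S
  module T = Swap T
  go : ∀ {P b c P′ b′ c′ x y y′} → P ≡ P′ → P + b ≡ P′ + b′ → P + (b + c) ≡ P′ + (b′ + c′) →
    Exchange P b c x y → Exchange P′ b′ c′ x y′ → y ≡ y′
  go {P} {b} {c} {_} {b′} {c′} refl e₂ e₃ ex ex′ with ℕ.+-cancelˡ-≡ P b b′ e₂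
  ... | refl with ℕ.+-cancelˡ-≡ b c c′ (ℕ.+-cancelˡ-≡ P (b + c) (b + c′) e₃)
  ... | refl = exchange-functional ex ex′ refl

swap-exists : (pos : Permutation′ n) {a₁ a₂ a₃ : Fin n} → pos ⟨$⟩ʳ a₁ Fin.< pos ⟨$⟩ʳ a₂ → pos ⟨$⟩ʳ a₂ Fin.< pos ⟨$⟩ʳ a₃ →
  ∃ λ pos′ → pos′ ∈ permutations n × Swap a₁ a₂ a₃ pos pos′
swap-exists {n} pos {a₁} {a₂} {a₃} lt₁ lt₂ with ℕ.m≤n⇒∃[o]m+o≡n (ℕ.<⇒≤ lt₁) | ℕ.m≤n⇒∃[o]m+o≡n (ℕ.<⇒≤ lt₂)
... | b , eb | c , ec = pos′ , pos′∈ , record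
  { 0<b = ℕ.+-cancelˡ-< P 0 b (subst₂ _<_ (sym (ℕ.+-identityʳ P)) (sym eb) lt₁)
  ; 0<c = ℕ.+-cancelˡ-< _ 0 c (subst₂ _<_ (sym (ℕ.+-identityʳ _)) (sym ec) lt₂)
  ; at₁ = refl ; at₂ = sym eb ; at₃ = e₃
  ; exch = λ x → subst (Exchange P b c (toℕ (pos ⟨$⟩ʳ x))) (cong toℕ (sym (pos′≈ x))) (proj₂ τ (pos ⟨$⟩ʳ x)) }
  where
  P = toℕ (pos ⟨$⟩ʳ a₁)
  e₃ : toℕ (pos ⟨$⟩ʳ a₃) ≡ P + (b + c)
  e₃ = trans (sym ec) (trans (cong (_+ c) (sym eb)) (ℕ.+-assoc P b c))
  R<n : P + (b + c) < n
  R<n = subst (_< n) e₃ (toℕ<n _)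
  R<n′ : P + (c + b) < n
  R<n′ = subst (λ k → P + k < n) (ℕ.+-comm b c) R<n
  total : ∀ {b c} → P + (b + c) < n → (x : Fin n) → ∃ λ (y : Fin n) → Exchange P b c (toℕ x) (toℕ y)
  total R<n x with exchange-total (toℕ x)
  ... | y , ex = fromℕ< y<n , subst (Exchange P _ _ (toℕ x)) (sym (toℕ-fromℕ< y<n)) ex
    where y<n = exchange-< R<n ex (toℕ<n x)
  τ = permutation-of-relation (λ x y → Exchange P b c (toℕ x) (toℕ y))
    (total R<n) (λ y → let x , ex = total R<n′ y in x , exchange-sym ex)
    (λ ex ex′ → toℕ-injective (exchange-functional ex ex′ refl))
    (λ ex ex′ → toℕ-injective (exchange-functional (exchange-sym ex) (exchange-sym ex′) refl))
  -- Counting runs over the listed permutations only, so the composite is replaced by its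
  -- representative in the list.
  complete = permutations-complete (pos ∘ₚ proj₁ τ)
  pos′ = proj₁ complete
  pos′∈ = proj₁ (proj₂ complete)
  pos′≈ = proj₂ (proj₂ complete)

module _ {a₁ a₂ a₃ : Fin n} {pos pos′ : Permutation′ n} (S : Swap a₁ a₂ a₃ pos pos′) where
  open Swap S

  private
    infix 4 _≺_ _≼_ _≺′_ _≼′_
    _≺_ _≼_ _≺′_ _≼′_ : Fin n → Fin n → Set
    x ≺ y = pos ⟨$⟩ʳ x Fin.< pos ⟨$⟩ʳ y
    x ≼ y = pos ⟨$⟩ʳ x Fin.≤ pos ⟨$⟩ʳ y
    x ≺′ y = pos′ ⟨$⟩ʳ x Fin.< pos′ ⟨$⟩ʳ y
    x ≼′ y = pos′ ⟨$⟩ʳ x Fin.≤ pos′ ⟨$⟩ʳ y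

  a₁≺a₂ : a₁ ≺ a₂
  a₁≺a₂ rewrite at₁ | at₂ = ℕ.m<m+n P 0<b

  a₂≺a₃ : a₂ ≺ a₃
  a₂≺a₃ rewrite at₂ | at₃ = ℕ.+-monoʳ-< P (ℕ.m<m+n b 0<c)

  -- The place of a point among the three points in the old and in the new word at once. Their order
  -- is a₁, a₂, a₃ in the old word and a₂, a₁, a₃ in the new one; every comparison between the two
  -- words rests on this.
  data Block (x : Fin n) : Set where
    inA : x ≺ a₁ → x ≺′ a₂ → Block x
    inB : a₁ ≼ x → x ≺ a₂ → a₁ ≼′ x → x ≺′ a₃ → Block x
    inC : a₂ ≼ x → x ≺ a₃ → a₂ ≼′ x → x ≺′ a₁ → Block x
    inE : a₃ ≼ x → a₃ ≼′ x → Block x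

  block : ∀ x → Block x
  block x = go (exch x) refl refl
    where
    go : ∀ {u v} → Exchange P b c u v → toℕ (pos ⟨$⟩ʳ x) ≡ u → toℕ (pos′ ⟨$⟩ʳ x) ≡ v → Block x
    go (before lt)    eu ev = inA (subst₂ _<_ (sym eu) (sym at₁) lt) (subst₂ _<_ (sym ev) (sym at₂′) lt)
    go (first {j} lt) eu ev = inB
      (subst₂ _≤_ (sym at₁) (sym eu) (ℕ.m≤m+n P j)) (subst₂ _<_ (sym eu) (sym at₂) (ℕ.+-monoʳ-< P lt))
      (subst₂ _≤_ (sym at₁′) (sym ev) (ℕ.+-monoʳ-≤ P (ℕ.m≤m+n c j))) (subst₂ _<_ (sym ev) (sym at₃′) (ℕ.+-monoʳ-< P (ℕ.+-monoʳ-< c lt)))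
    go (second {j} lt) eu ev = inC
      (subst₂ _≤_ (sym at₂) (sym eu) (ℕ.+-monoʳ-≤ P (ℕ.m≤m+n b j))) (subst₂ _<_ (sym eu) (sym at₃) (ℕ.+-monoʳ-< P (ℕ.+-monoʳ-< b lt)))
      (subst₂ _≤_ (sym at₂′) (sym ev) (ℕ.m≤m+n P j)) (subst₂ _<_ (sym ev) (sym at₁′) (ℕ.+-monoʳ-< P lt))
    go (after j) eu ev = inE
      (subst₂ _≤_ (sym at₃) (sym eu) (ℕ.+-monoʳ-≤ P (ℕ.+-monoʳ-≤ b (ℕ.m≤m+n c j))))
      (subst₂ _≤_ (sym at₃′) (sym ev) (ℕ.+-monoʳ-≤ P (ℕ.+-monoʳ-≤ c (ℕ.m≤m+n b j))))

  private
    after-fix : ∀ {u v} → P + (b + c) ≤ u → Exchange P b c u v → v ≡ u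
    after-fix R≤u ex with ℕ.m≤n⇒∃[o]m+o≡n R≤u
    ... | j , refl = trans (exchange-functional ex (after j) e) (trans (+-exchange {P} {b} {c} j) (sym e))
      where e = trans (ℕ.+-assoc P (b + c) j) (cong (_+_ P) (ℕ.+-assoc b c j))

    -- The last position is not before that of a₃, so it is outside the exchanged intervals. This
    -- takes care of the step from the end of the word to its beginning.
    last-fix : ∀ {x} → suc (toℕ (pos ⟨$⟩ʳ x)) ≡ n → toℕ (pos′ ⟨$⟩ʳ x) ≡ toℕ (pos ⟨$⟩ʳ x)
    last-fix {x} l = after-fix (ℕ.≤-pred (subst₂ _<_ at₃ (sym l) (toℕ<n (pos ⟨$⟩ʳ a₃)))) (exch x)

    before-fix : ∀ {x} → toℕ (pos ⟨$⟩ʳ x) < P → toℕ (pos′ ⟨$⟩ʳ x) ≡ toℕ (pos ⟨$⟩ʳ x)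
    before-fix {x} lt = exchange-functional (exch x) (before lt) refl

    at-pos : ∀ {y z} → toℕ (pos ⟨$⟩ʳ y) ≡ toℕ (pos ⟨$⟩ʳ z) → y ≡ z
    at-pos e = perm-injective pos (toℕ-injective e)

  -- Neighbours change only at the three seams of the exchange. Altogether the new n-cycle is the
  -- old one followed by the 3-cycle a₁ ↦ a₂ ↦ a₃ ↦ a₁.
  succ-a₁ : ∀ {x} → succ pos ⟨$⟩ʳ x ≡ a₁ → succ pos′ ⟨$⟩ʳ x ≡ a₂
  succ-a₁ {x} refl = succ-unique pos′ (go (succ-next pos x))
    where
    go : Next (pos ⟨$⟩ʳ x) (pos ⟨$⟩ʳ a₁) → Next (pos′ ⟨$⟩ʳ x) (pos′ ⟨$⟩ʳ a₂)
    go (inj₁ e) = inj₁ (trans at₂′ (trans P≡ (cong suc (sym (before-fix (ℕ.≤-reflexive (sym P≡)))))))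
      where P≡ = trans (sym at₁) e
    -- Here P = 0: the word begins with a₁, and its predecessor is the last point, which stays in
    -- place while a₂ becomes the first.
    go (inj₂ (l , e)) = inj₂ (trans (cong suc (last-fix l)) l , trans at₂′ (trans (sym at₁) e))

  succ-a₂ : ∀ {x} → succ pos ⟨$⟩ʳ x ≡ a₂ → succ pos′ ⟨$⟩ʳ x ≡ a₃
  succ-a₂ {x} refl = succ-unique pos′ (go (succ-next pos x))
    where
    go : Next (pos ⟨$⟩ʳ x) (pos ⟨$⟩ʳ a₂) → Next (pos′ ⟨$⟩ʳ x) (pos′ ⟨$⟩ʳ a₃)
    go (inj₂ (_ , e)) = contradiction (subst (0 <_) (trans (sym at₂) e) (ℕ.≤-trans 0<b (ℕ.m≤n+m b P))) λ ()
    -- Writing b = j + 1, the predecessor of a₂ has offset j, the last one in its interval.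
    go (inj₁ e) with ℕ.m≤n⇒∃[o]m+o≡n 0<b
    ... | j , refl = inj₁ (trans at₃′ (trans (cong (_+_ P) (ℕ.+-suc c j)) (trans (ℕ.+-suc P (c + j))
        (cong suc (sym (exchange-functional (exch x) (first ℕ.≤-refl) u≡))))))
      where
      u≡ : toℕ (pos ⟨$⟩ʳ x) ≡ P + j
      u≡ = ℕ.suc-injective (trans (sym e) (trans at₂ (ℕ.+-suc P j)))

  succ-a₃ : ∀ {x} → succ pos ⟨$⟩ʳ x ≡ a₃ → succ pos′ ⟨$⟩ʳ x ≡ a₁
  succ-a₃ {x} refl = succ-unique pos′ (go (succ-next pos x))
    where
    go : Next (pos ⟨$⟩ʳ x) (pos ⟨$⟩ʳ a₃) → Next (pos′ ⟨$⟩ʳ x) (pos′ ⟨$⟩ʳ a₁)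
    go (inj₂ (_ , e)) = contradiction (subst (0 <_) (trans (sym at₃) e) (ℕ.≤-trans 0<b (ℕ.≤-trans (ℕ.m≤m+n b c) (ℕ.m≤n+m _ P)))) λ ()
    go (inj₁ e) with ℕ.m≤n⇒∃[o]m+o≡n 0<c
    ... | j , refl = inj₁ (trans at₁′ (trans (ℕ.+-suc P j)
        (cong suc (sym (exchange-functional (exch x) (second ℕ.≤-refl) u≡)))))
      where
      u≡ : toℕ (pos ⟨$⟩ʳ x) ≡ P + (b + j)
      u≡ = ℕ.suc-injective (trans (sym e) (trans at₃ (trans (cong (_+_ P) (ℕ.+-suc b j)) (ℕ.+-suc P (b + j)))))

  succ-fix : ∀ {x} → succ pos ⟨$⟩ʳ x ≢ a₁ → succ pos ⟨$⟩ʳ x ≢ a₂ → succ pos ⟨$⟩ʳ x ≢ a₃ →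
    succ pos′ ⟨$⟩ʳ x ≡ succ pos ⟨$⟩ʳ x
  succ-fix {x} ≢₁ ≢₂ ≢₃ = succ-unique pos′ (go (succ-next pos x))
    where
    y = succ pos ⟨$⟩ʳ x
    -- Away from the seams, a point and its successor lie in the same of the four intervals and move
    -- together.
    step : ∀ {u v} → Exchange P b c u v → toℕ (pos ⟨$⟩ʳ x) ≡ u → toℕ (pos ⟨$⟩ʳ y) ≡ suc u → Exchange P b c (suc u) (suc v)
    step (before {u} lt) eu ey with ℕ.m≤n⇒m<n∨m≡n lt
    ... | inj₁ lt′  = before lt′
    ... | inj₂ refl = contradiction (at-pos (trans ey (sym at₁))) ≢₁
    step (first {j} lt) eu ey with ℕ.m≤n⇒m<n∨m≡n lt
    ... | inj₁ lt′  = subst₂ (Exchange P b c) (ℕ.+-suc P j) (trans (cong (_+_ P) (ℕ.+-suc c j)) (ℕ.+-suc P (c + j))) (first lt′)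
    ... | inj₂ refl = contradiction (at-pos (trans ey (sym (trans at₂ (ℕ.+-suc P j))))) ≢₂
    step (second {j} lt) eu ey with ℕ.m≤n⇒m<n∨m≡n lt
    ... | inj₁ lt′  = subst₂ (Exchange P b c) (trans (cong (_+_ P) (ℕ.+-suc b j)) (ℕ.+-suc P (b + j))) (ℕ.+-suc P j) (second lt′)
    ... | inj₂ refl = contradiction (at-pos (trans ey (sym (trans at₃ (trans (cong (_+_ P) (ℕ.+-suc b j)) (ℕ.+-suc P (b + j))))))) ≢₃
    step (after j) eu ey = subst₂ (Exchange P b c) (shunt b c) (shunt c b) (after (suc j))
      where
      shunt : ∀ b c → P + (b + (c + suc j)) ≡ suc (P + (b + (c + j)))
      shunt b c = trans (cong (_+_ P) (trans (cong (_+_ b) (ℕ.+-suc c j)) (ℕ.+-suc b (c + j)))) (ℕ.+-suc P _)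
    go : Next (pos ⟨$⟩ʳ x) (pos ⟨$⟩ʳ y) → Next (pos′ ⟨$⟩ʳ x) (pos′ ⟨$⟩ʳ y)
    go (inj₁ e) = inj₁ (exchange-functional (exch y) (step (exch x) refl e) e)
    -- The first point of the word keeps its position unless P = 0, in which case it would be a₁.
    go (inj₂ (l , e)) with P in eP
    ... | zero  = contradiction (at-pos (trans e (trans (sym eP) (sym at₁)))) ≢₁
    ... | suc _ = inj₂ (trans (cong suc (last-fix l)) l , trans (before-fix (subst₂ _<_ (sym e) (sym eP) z<s)) e)

-- Cutting a cycle in three and gluing three cycles

infix 4 _≺⟨_⟩_ _≼⟨_⟩_
_≺⟨_⟩_ _≼⟨_⟩_ : Fin n → Permutation′ n → Fin n → Set
x ≺⟨ pos ⟩ y = pos ⟨$⟩ʳ x Fin.< pos ⟨$⟩ʳ y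
x ≼⟨ pos ⟩ y = pos ⟨$⟩ʳ x Fin.≤ pos ⟨$⟩ʳ y

≼∧≢⇒≺ : (pos : Permutation′ n) {x y : Fin n} → x ≼⟨ pos ⟩ y → x ≢ y → x ≺⟨ pos ⟩ y
≼∧≢⇒≺ pos le ne = ℕ.≤∧≢⇒< le (λ e → ne (perm-injective pos (toℕ-injective e)))

module _ {P : Fin n → Set} (P? : ∀ x → Dec (P x)) (a : Fin n) where

  or? : ∀ x → Dec (P x ⊎ x ≡ a)
  or? x = P? x ⊎-dec (x ≟ a)

  count-or : ¬ P a → count or? (allFin n) ≡ suc (count P? (allFin n))
  count-or ¬pa = begin
    count or? (allFin n)                                                      ≡⟨ count≡∑ or? (allFin n) ⟩
    ∑[ x ∈ allFin n ] 𝟙 (or? x)                                               ≡⟨ ∑-cong (allFin n) step ⟩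
    ∑[ x ∈ allFin n ] (𝟙 (x ≟ a) + 𝟙 (P? x))                                  ≡⟨ ∑-+ (allFin n) _ _ ⟩
    (∑[ x ∈ allFin n ] 𝟙 (x ≟ a)) + (∑[ x ∈ allFin n ] 𝟙 (P? x))              ≡⟨ cong₂ _+_ (sym (count≡∑ (_≟ a) (allFin n))) (sym (count≡∑ P? (allFin n))) ⟩
    count (_≟ a) (allFin n) + count P? (allFin n)                             ≡⟨ cong (_+ count P? (allFin n)) (count-one (_≟ a) (allFin-unique n) (∈-allFin a) refl id) ⟩
    suc (count P? (allFin n))                                                 ∎
    where
    open ≡-Reasoning
    step : ∀ x → 𝟙 (or? x) ≡ 𝟙 (x ≟ a) + 𝟙 (P? x)
    step x with P? x | x ≟ a
    ... | yes p | yes refl = contradiction p ¬pa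
    ... | yes _ | no  _    = refl
    ... | no  _ | yes _    = refl
    ... | no  _ | no  _    = refl

Odd : ℕ → Set
Odd m = m ℕ.% 2 ≡ 1

odd? : ∀ m → Dec (Odd m)
odd? m = m ℕ.% 2 ℕ.≟ 1

odd-2+ : ∀ m → (2 + m) ℕ.% 2 ≡ m ℕ.% 2
odd-2+ m = trans (cong (ℕ._% 2) (ℕ.+-comm 2 m)) (ℕ.[m+n]%n≡m%n m 2)

module Surgery {n : ℕ} (D : Permutation′ n) (Q : List ℕ → Set) (Q? : ∀ μ → Dec (Q μ)) where

  α : Permutation′ n → Permutation′ n
  α pos = flip D ∘ₚ succ pos

  -- If α i = a₂ with i in the cycle of a₁, then `β` sends i back to a₁, so its cycle through a₁
  -- consists of the points that α meets from a₁ on before a₂.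
  β : Permutation′ n → Fin n → Fin n → Permutation′ n
  β pos a₁ a₂ = α pos ∘ₚ transpose a₁ a₂

  Last : Permutation′ n → Subset n → Fin n → Set
  Last pos U i = ∀ b → b ∈ₛ U → IsMin pos (α pos) b → ∀ a → IsMin pos (α pos) a → SameCycle (α pos) a i → b ≼⟨ pos ⟩ a

  abstract
    last? : ∀ pos U i → Dec (Last pos U i)
    last? pos U i = all? λ b → (b ∈ₛ? U) →-dec (isMin? pos (α pos) b →-dec (all? λ a →
      isMin? pos (α pos) a →-dec (sameCycle? (α pos) a i →-dec ((pos ⟨$⟩ʳ b) Fin.≤? (pos ⟨$⟩ʳ a)))))

  -- i is an anti-exceedance of α pos, lying in the last of the cycles in U,
  -- where cycles are ordered by the positions of their first elements.
  record Marked (x : Permutation′ n × Subset n × Fin n) : Set where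
    constructor marked
    private
      pos = proj₁ x
      U   = proj₁ (proj₂ x)
      i   = proj₂ (proj₂ x)
    field
      stable : Stable (α pos) U
      odd    : Odd (#inside (α pos) U)
      i∈U    : i ∈ₛ U
      αi≼i   : (α pos ⟨$⟩ʳ i) ≼⟨ pos ⟩ i
      last   : Last pos U i
      mergesTo : Q (merged (α pos) U)

  abstract
    marked? : ∀ x → Dec (Marked x)
    marked? (pos , U , i) = map′ (λ (st , odd , i∈ , le , last , q) → marked st odd i∈ le last q)
      (λ (marked st odd i∈ le last q) → st , odd , i∈ , le , last , q)
      (stable? (α pos) U ×-dec odd? (#inside (α pos) U) ×-dec (i ∈ₛ? U)
      ×-dec ((pos ⟨$⟩ʳ (α pos ⟨$⟩ʳ i)) Fin.≤? (pos ⟨$⟩ʳ i)) ×-dec last? pos U i ×-dec Q? (merged (α pos) U))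

  record Cuts (pos : Permutation′ n) (U : Subset n) (i a₁ a₂ a₃ : Fin n) : Set where
    field
      min₁  : IsMin pos (α pos) a₁
      a₁~i  : SameCycle (α pos) a₁ i
      αi≡a₂ : α pos ⟨$⟩ʳ i ≡ a₂
      a₁~a₃ : SameCycle (β pos a₁ a₂) a₁ a₃
      a₂<a₃ : a₂ ≺⟨ pos ⟩ a₃
      least : ∀ z → SameCycle (β pos a₁ a₂) a₁ z → a₂ ≺⟨ pos ⟩ z → a₃ ≼⟨ pos ⟩ z

  -- The counterpart of `Cuts` in the new word: a₂ and a₁, in this order, are the first points of
  -- the last two cycles in U other than that of i. The cycle of i is represented by a₃ = α i, which
  -- need not be its first point.
  record Joints (pos : Permutation′ n) (U : Subset n) (i a₁ a₂ a₃ : Fin n) : Set where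
    field
      αi≡a₃ : α pos ⟨$⟩ʳ i ≡ a₃
      min₁  : IsMin pos (α pos) a₁
      min₂  : IsMin pos (α pos) a₂
      a₁∈U  : a₁ ∈ₛ U
      a₂∈U  : a₂ ∈ₛ U
      a₂<a₁ : a₂ ≺⟨ pos ⟩ a₁
      a₁≁i  : ¬ SameCycle (α pos) a₁ i
      a₂≁i  : ¬ SameCycle (α pos) a₂ i
      other : ∀ b → b ∈ₛ U → IsMin pos (α pos) b → SameCycle (α pos) b i ⊎ b ≡ a₁ ⊎ b ≡ a₂ ⊎ b ≺⟨ pos ⟩ a₂

  transposed-β : ∀ pos a₁ a₂ → Transposed (α pos) (β pos a₁ a₂) a₁ a₂
  transposed-β pos a₁ a₂ = record { at-a = λ {x} e → at-a _ e ; at-b = λ {x} e → at-b _ e ; other = λ {x} → oth _ }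
    where
    tr = transpose a₁ a₂ ⟨$⟩ʳ_
    at-a : ∀ y → y ≡ a₁ → tr y ≡ a₂
    at-a y e with y ≟ a₁
    ... | yes _ = refl
    ... | no ne = contradiction e ne
    at-b : ∀ y → y ≡ a₂ → tr y ≡ a₁
    at-b y e with y ≟ a₁
    ... | yes e′ = trans (sym e) e′
    ... | no _ with y ≟ a₂
    ... | yes _ = refl
    ... | no ne = contradiction e ne
    oth : ∀ y → y ≢ a₁ → y ≢ a₂ → tr y ≡ y
    oth y ne₁ ne₂ with y ≟ a₁
    ... | yes e = contradiction e ne₁
    ... | no _ with y ≟ a₂
    ... | yes e = contradiction e ne₂
    ... | no _ = refl

  module _ {pos pos′ : Permutation′ n} {a₁ a₂ a₃ : Fin n} (S : Swap a₁ a₂ a₃ pos pos′) where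
    private
      a = α pos
      a′ = α pos′
      b = β pos a₁ a₂
      T₁ = transposed-β pos a₁ a₂
      module T₁ = Transposed T₁

    a₁≢a₂ : a₁ ≢ a₂
    a₁≢a₂ refl = ℕ.<-irrefl refl (a₁≺a₂ S)

    a₂≢a₃ : a₂ ≢ a₃
    a₂≢a₃ refl = ℕ.<-irrefl refl (a₂≺a₃ S)

    a₁≢a₃ : a₁ ≢ a₃
    a₁≢a₃ refl = ℕ.<-asym (a₁≺a₂ S) (a₂≺a₃ S)

    α-agree : ∀ {x} → a ⟨$⟩ʳ x ≢ a₁ → a ⟨$⟩ʳ x ≢ a₂ → a ⟨$⟩ʳ x ≢ a₃ → a′ ⟨$⟩ʳ x ≡ a ⟨$⟩ʳ x
    α-agree = succ-fix S

    -- As maps, (a₁ a₃)(a₁ a₂) is the 3-cycle a₁ ↦ a₂ ↦ a₃ ↦ a₁ by which the two n-cycles differ;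
    -- the factor on the right leads to `β`, the one on the left from there to the new permutation.
    transposed-β′ : Transposed b a′ a₁ a₃
    transposed-β′ = record { at-a = at-a ; at-b = at-b ; other = oth }
      where
      T₁⁻ = transposed-sym T₁
      module T₁⁻ = Transposed T₁⁻
      at-a : ∀ {x} → b ⟨$⟩ʳ x ≡ a₁ → a′ ⟨$⟩ʳ x ≡ a₃
      at-a {x} e = succ-a₂ S (T₁⁻.at-a {x} e)
      at-b : ∀ {x} → b ⟨$⟩ʳ x ≡ a₃ → a′ ⟨$⟩ʳ x ≡ a₁
      at-b {x} e = succ-a₃ S (trans (T₁⁻.other {x} (λ e₁ → a₁≢a₃ (trans (sym e₁) e)) (λ e₂ → a₂≢a₃ (trans (sym e₂) e))) e)
      oth : ∀ {x} → b ⟨$⟩ʳ x ≢ a₁ → b ⟨$⟩ʳ x ≢ a₃ → a′ ⟨$⟩ʳ x ≡ b ⟨$⟩ʳ x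
      oth {x} ≢₁ ≢₃ = go (a ⟨$⟩ʳ x ≟ a₁)
        where
        go : Dec (a ⟨$⟩ʳ x ≡ a₁) → a′ ⟨$⟩ʳ x ≡ b ⟨$⟩ʳ x
        go (yes e) = trans (succ-a₁ S e) (sym (T₁.at-a {x} e))
        go (no ne) = trans (α-agree ne ne₂ (λ e₃ → ≢₃ (trans b≡a e₃))) (sym b≡a)
          where
          ne₂ = λ e₂ → ≢₁ (T₁.at-b {x} e₂)
          b≡a = T₁.other {x} ne ne₂

    private
      T₂ = transposed-β′

    -- The cycle of a₁ under α pos splits into the three cycles of a₁, a₂ and a₃.
    record Splits : Set where
      field
        a₁~a₂ : SameCycle a a₁ a₂
        a₁~a₃ : SameCycle b a₁ a₃
        a₁≁a₂ : ¬ SameCycle b a₁ a₂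
        a₁≁′a₂ : ¬ SameCycle a′ a₁ a₂
        a₁≁′a₃ : ¬ SameCycle a′ a₁ a₃
        a₂≁′a₃ : ¬ SameCycle a′ a₂ a₃

      b⇒a′ : ∀ {z} → SameCycle b a₁ z → SameCycle a′ z a₁ ⊎ SameCycle a′ z a₃
      b⇒a′ s = transposed-classes T₂ (inj₁ (sc-sym b s))

      a′⇒b : ∀ {z} → SameCycle a′ z a₁ ⊎ SameCycle a′ z a₃ → SameCycle b a₁ z
      a′⇒b s with transposed-classes (transposed-sym T₂) s
      ... | inj₁ t = sc-sym b t
      ... | inj₂ t = sc-trans b a₁~a₃ (sc-sym b t)

      b⇒a : ∀ {z} → SameCycle b a₁ z → SameCycle a a₁ z
      b⇒a s with transposed-classes (transposed-sym T₁) (inj₁ (sc-sym b s))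
      ... | inj₁ t = sc-sym a t
      ... | inj₂ t = sc-trans a a₁~a₂ (sc-sym a t)

      a⇒a′ : ∀ {z} → SameCycle a z a₁ → SameCycle a′ z a₁ ⊎ SameCycle a′ z a₂ ⊎ SameCycle a′ z a₃
      a⇒a′ {z} s with transposed-classes T₁ (inj₁ s)
      ... | inj₁ t = [ inj₁ , inj₂ ∘ inj₂ ]′ (b⇒a′ (sc-sym b t))
      ... | inj₂ t with sameCycle? a′ z a₁ | sameCycle? a′ z a₃
      ... | yes u | _     = inj₁ u
      ... | no _  | yes u = inj₂ (inj₂ u)
      ... | no ¬₁ | no ¬₃ = inj₂ (inj₁ (transposed-outside⁻ T₂ ¬₁ ¬₃ t))

      a₂-a′⇒a : ∀ {z} → SameCycle a′ z a₂ → SameCycle a z a₁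
      a₂-a′⇒a {z} s with transposed-classes (transposed-sym T₁) (inj₂ (transposed-outside (transposed-sym T₂)
          (λ t → a₁≁′a₂ (sc-trans a′ (sc-sym a′ t) s)) (λ t → a₂≁′a₃ (sc-trans a′ (sc-sym a′ s) t)) s))
      ... | inj₁ t = t
      ... | inj₂ t = sc-trans a t (sc-sym a a₁~a₂)

      a′⇒a : ∀ {z} → SameCycle a′ z a₁ ⊎ SameCycle a′ z a₂ ⊎ SameCycle a′ z a₃ → SameCycle a z a₁
      a′⇒a (inj₁ s)        = sc-sym a (b⇒a (a′⇒b (inj₁ s)))
      a′⇒a (inj₂ (inj₁ s)) = a₂-a′⇒a s
      a′⇒a (inj₂ (inj₂ s)) = sc-sym a (b⇒a (a′⇒b (inj₂ s)))

      away : ∀ {z w} → ¬ SameCycle a z a₁ → SameCycle a z w → SameCycle a′ z w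
      away {z} {w} ¬s t = transposed-outside⁻ T₂ (λ u → ¬s (a′⇒a (inj₁ u))) (λ u → ¬s (a′⇒a (inj₂ (inj₂ u))))
        (transposed-outside T₁ ¬s (λ u → ¬s (sc-trans a u (sc-sym a a₁~a₂))) t)

      away⁻ : ∀ {z w} → ¬ SameCycle a z a₁ → SameCycle a′ z w → SameCycle a z w
      away⁻ {z} {w} ¬s t = transposed-outside⁻ (transposed-sym T₁) ¬s (λ u → ¬s (sc-trans a u (sc-sym a a₁~a₂)))
        (transposed-outside (transposed-sym T₂) (λ u → ¬s (a′⇒a (inj₁ u))) (λ u → ¬s (a′⇒a (inj₂ (inj₂ u)))) t)

    -- Both transpositions exchange two points of a common cycle, first of `α pos` and then of `β`,
    -- so each of them splits that cycle in two.
    cuts-split : ∀ {U i} → Cuts pos U i a₁ a₂ a₃ → Splits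
    cuts-split {U} {i} X = record
      { a₁~a₂ = a₁~a₂ ; a₁~a₃ = X.a₁~a₃ ; a₁≁a₂ = a₁≁a₂
      ; a₁≁′a₂ = λ s → [ (λ t → a₁≁a₂ (sc-sym b t)) , (λ t → a₁≁a₂ (sc-trans b X.a₁~a₃ (sc-sym b t))) ]′
          (transposed-classes (transposed-sym T₂) (inj₁ (sc-sym a′ s)))
      ; a₁≁′a₃ = transposed-split T₂ a₁≢a₃ X.a₁~a₃
      ; a₂≁′a₃ = λ s → [ (λ t → a₁≁a₂ (sc-sym b t)) , (λ t → a₁≁a₂ (sc-trans b X.a₁~a₃ (sc-sym b t))) ]′
          (transposed-classes (transposed-sym T₂) (inj₂ s))
      }
      where
      module X = Cuts X
      a₁~a₂ = sc-trans a X.a₁~i (subst (SameCycle a i) X.αi≡a₂ (sc-step a i))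
      a₁≁a₂ = transposed-split T₁ a₁≢a₂ a₁~a₂

    -- Under `α pos′` the points a₁ and a₂ are distinct first points, and a₃ shares the cycle of i,
    -- so the three lie in three cycles. Undoing the transpositions one by one joins these.
    joints-split : ∀ {U i} → Joints pos′ U i a₁ a₂ a₃ → Splits
    joints-split {U} {i} Y = record
      { a₁~a₂ = transposed-join (transposed-sym T₁) a₁≁a₂
      ; a₁~a₃ = transposed-join (transposed-sym T₂) a₁≁′a₃ ; a₁≁a₂ = a₁≁a₂
      ; a₁≁′a₂ = a₁≁′a₂ ; a₁≁′a₃ = a₁≁′a₃ ; a₂≁′a₃ = a₂≁′a₃ }
      where
      module Y = Joints Y
      i~a₃ = subst (SameCycle a′ i) Y.αi≡a₃ (sc-step a′ i)
      a₁≁′a₃ = λ s → Y.a₁≁i (sc-trans a′ s (sc-sym a′ i~a₃))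
      a₂≁′a₃ = λ s → Y.a₂≁i (sc-trans a′ s (sc-sym a′ i~a₃))
      a₁≁′a₂ : ¬ SameCycle a′ a₁ a₂
      a₁≁′a₂ s = a₁≢a₂ (min-unique pos′ a′ Y.min₁ Y.min₂ s)
      a₁≁a₂ : ¬ SameCycle b a₁ a₂
      a₁≁a₂ s = [ (λ t → a₁≁′a₂ (sc-sym a′ t)) , a₂≁′a₃ ]′ (transposed-classes T₂ (inj₁ (sc-sym b s)))

    module _ (C : Splits) {U : Subset n} (a₁∈U : a₁ ∈ₛ U) where
      open Splits C

      stable⁺ : Stable a U → Stable a′ U
      stable⁺ st x x∈U with a ⟨$⟩ʳ x ≟ a₁ | a ⟨$⟩ʳ x ≟ a₂ | a ⟨$⟩ʳ x ≟ a₃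
      ... | yes e | _ | _ = subst (_∈ₛ U) (sym (succ-a₁ S e)) (stable-sc a st a₁∈U a₁~a₂)
      ... | no _ | yes e | _ = subst (_∈ₛ U) (sym (succ-a₂ S e)) (stable-sc a st a₁∈U (b⇒a a₁~a₃))
      ... | no _ | no _ | yes e = subst (_∈ₛ U) (sym (succ-a₃ S e)) a₁∈U
      ... | no e₁ | no e₂ | no e₃ = subst (_∈ₛ U) (sym (α-agree e₁ e₂ e₃)) (st x x∈U)

      stable⁻ : a₂ ∈ₛ U → a₃ ∈ₛ U → Stable a′ U → Stable a U
      stable⁻ a₂∈U a₃∈U st x x∈U with a ⟨$⟩ʳ x ≟ a₁ | a ⟨$⟩ʳ x ≟ a₂ | a ⟨$⟩ʳ x ≟ a₃
      ... | yes e | _ | _ = subst (_∈ₛ U) (sym e) a₁∈U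
      ... | no _ | yes e | _ = subst (_∈ₛ U) (sym e) a₂∈U
      ... | no _ | no _ | yes e = subst (_∈ₛ U) (sym e) a₃∈U
      ... | no e₁ | no e₂ | no e₃ = subst (_∈ₛ U) (α-agree e₁ e₂ e₃) (st x x∈U)

      merged-split : Stable a U → merged a U ≡ merged a′ U
      merged-split st = merged-cong a a′ st (stable⁺ st) λ {x} x∉ →
        α-agree (λ e → x∉ (back x e a₁∈U)) (λ e → x∉ (back x e (stable-sc a st a₁∈U a₁~a₂)))
          (λ e → x∉ (back x e (stable-sc a st a₁∈U (b⇒a a₁~a₃))))
        where
        back : ∀ x {y} → a ⟨$⟩ʳ x ≡ y → y ∈ₛ U → x ∈ₛ U
        back x refl y∈ = stable-sc a st y∈ (sc-sym a (sc-step a x))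

      -- The first points in the old word, together with a₂ and a₃, represent the cycles in U after
      -- the cut. This avoids finding the first point of each cycle in the new word.
      #inside-split : Stable a U → IsMin pos a a₁ → #inside a′ U ≡ 2 + #inside a U
      #inside-split st min₁ = begin
        #inside a′ U                                ≡⟨ #inside≡ a′ (stable⁺ st) reps″ P″? ⟩
        count P″? (allFin n)                        ≡⟨ count-or P′? a₃ ¬P′a₃ ⟩
        suc (count P′? (allFin n))                  ≡⟨ cong suc (count-or P? a₂ ¬Pa₂) ⟩
        2 + count P? (allFin n)                     ≡⟨ cong (_+_ 2) (#inside≡ a st reps P?) ⟨
        2 + #inside a U                             ∎
        where
        open ≡-Reasoning
        P : Fin n → Set
        P x = IsMin pos a x × x ∈ₛ U
        P? : ∀ x → Dec (P x)
        P? x = isMin? pos a x ×-dec (x ∈ₛ? U)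
        P′? = or? P? a₂
        P″? = or? P′? a₃
        reps : Reps a U P
        reps = min-reps pos a st
        Pa₁ : P a₁
        Pa₁ = min₁ , a₁∈U
        is-a₁ : ∀ {x} → P x → SameCycle a x a₁ → x ≡ a₁
        is-a₁ p s = Reps.uniq reps p Pa₁ s
        ¬Pa₂ : ¬ P a₂
        ¬Pa₂ p = a₁≢a₂ (sym (is-a₁ p (sc-sym a a₁~a₂)))
        ¬P′a₃ : ¬ (P a₃ ⊎ a₃ ≡ a₂)
        ¬P′a₃ (inj₁ p) = a₁≢a₃ (sym (is-a₁ p (sc-sym a (b⇒a a₁~a₃))))
        ¬P′a₃ (inj₂ e) = a₂≢a₃ (sym e)
        meets₂ : ∀ {x} → P x → ¬ SameCycle a′ x a₂
        meets₂ p s with is-a₁ p (a′⇒a (inj₂ (inj₁ s)))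
        ... | refl = a₁≁′a₂ s
        meets₃ : ∀ {x} → P x → ¬ SameCycle a′ x a₃
        meets₃ p s with is-a₁ p (a′⇒a (inj₂ (inj₂ s)))
        ... | refl = a₁≁′a₃ s
        reps″ : Reps a′ U (λ x → (P x ⊎ x ≡ a₂) ⊎ x ≡ a₃)
        reps″ = record { ⊆U = sub ; hit = hit ; uniq = uniq }
          where
          sub : ∀ {x} → (P x ⊎ x ≡ a₂) ⊎ x ≡ a₃ → x ∈ₛ U
          sub (inj₁ (inj₁ (_ , x∈))) = x∈
          sub (inj₁ (inj₂ refl)) = stable-sc a st a₁∈U a₁~a₂
          sub (inj₂ refl) = stable-sc a st a₁∈U (b⇒a a₁~a₃)
          hit : ∀ {x} → x ∈ₛ U → ∃ λ r → ((P r ⊎ r ≡ a₂) ⊎ r ≡ a₃) × SameCycle a′ x r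
          hit {x} x∈ with sameCycle? a x a₁
          ... | no ¬s = let r , p , s = Reps.hit reps x∈ in r , inj₁ (inj₁ p) , away ¬s s
          ... | yes s with a⇒a′ s
          ... | inj₁ t = a₁ , inj₁ (inj₁ Pa₁) , t
          ... | inj₂ (inj₁ t) = a₂ , inj₁ (inj₂ refl) , t
          ... | inj₂ (inj₂ t) = a₃ , inj₂ refl , t
          uniq : ∀ {r s} → (P r ⊎ r ≡ a₂) ⊎ r ≡ a₃ → (P s ⊎ s ≡ a₂) ⊎ s ≡ a₃ → SameCycle a′ r s → r ≡ s
          uniq {r} {s} (inj₁ (inj₁ p)) (inj₁ (inj₁ p′)) t with sameCycle? a r a₁
          ... | no ¬u = Reps.uniq reps p p′ (away⁻ ¬u t)
          ... | yes u with is-a₁ p u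
          ... | refl = sym (is-a₁ p′ (a′⇒a (inj₁ (sc-sym a′ t))))
          uniq (inj₁ (inj₁ p)) (inj₁ (inj₂ refl)) t = contradiction t (meets₂ p)
          uniq (inj₁ (inj₁ p)) (inj₂ refl) t = contradiction t (meets₃ p)
          uniq (inj₁ (inj₂ refl)) (inj₁ (inj₁ p)) t = contradiction (sc-sym a′ t) (meets₂ p)
          uniq (inj₂ refl) (inj₁ (inj₁ p)) t = contradiction (sc-sym a′ t) (meets₃ p)
          uniq (inj₁ (inj₂ refl)) (inj₁ (inj₂ refl)) t = refl
          uniq (inj₁ (inj₂ refl)) (inj₂ refl) t = contradiction t a₂≁′a₃
          uniq (inj₂ refl) (inj₁ (inj₂ refl)) t = contradiction (sc-sym a′ t) a₂≁′a₃
          uniq (inj₂ refl) (inj₂ refl) t = refl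

-- The correspondence between marks

module Transfer {n : ℕ} (D : Permutation′ n) (Q : List ℕ → Set) (Q? : ∀ μ → Dec (Q μ)) where
  open Surgery D Q Q?

  TrivialMark LoneCycle : Permutation′ n × Subset n × Fin n → Set
  TrivialMark (pos , U , i) = IsMin pos (α pos) (α pos ⟨$⟩ʳ i)
  LoneCycle (pos , U , i) = #inside (α pos) U ≡ 1

  abstract
    trivialMark? : ∀ x → Dec (TrivialMark x)
    trivialMark? (pos , U , i) = isMin? pos (α pos) (α pos ⟨$⟩ʳ i)

    loneCycle? : ∀ x → Dec (LoneCycle x)
    loneCycle? (pos , U , i) = #inside (α pos) U ℕ.≟ 1

  -- A candidate for a₃ exists, namely i: it ends the arc from a₁, and it comes after a₂ = α i,
  -- being an anti-exceedance and not a fixed point. A fixed point would be the first point of its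
  -- cycle, so its mark would be trivial.
  cuts-exist : ∀ {pos U i} → Marked (pos , U , i) → ¬ TrivialMark (pos , U , i) →
    ∃ λ a₁ → ∃ λ a₂ → ∃ λ a₃ → Cuts pos U i a₁ a₂ a₃ × a₁ ≺⟨ pos ⟩ a₂
  cuts-exist {pos} {U} {i} (marked _ _ _ αi≼i _ _) ¬triv with min-exists pos (α pos) i
  ... | a₁ , min₁ , i~a₁ = a₁ , a₂ , a₃ , record
      { min₁ = min₁ ; a₁~i = sc-sym a i~a₁ ; αi≡a₂ = refl ; a₁~a₃ = a₁~a₃ ; a₂<a₃ = a₂<a₃ ; least = λ z s lt → least z (s , lt) } , a₁≺αi
    where
    a = α pos
    a₂ = a ⟨$⟩ʳ i
    b = β pos a₁ a₂
    a₁≢αi : a₁ ≢ a₂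
    a₁≢αi e = ¬triv (subst (IsMin pos a) e min₁)
    a₁≺αi = ≼∧≢⇒≺ pos (min₁ a₂ (sc-trans a (sc-sym a i~a₁) (sc-step a i))) a₁≢αi
    αi≢i : a₂ ≢ i
    αi≢i e = a₁≢αi (trans (sc-induction a (_≡ i) (λ { z refl → e }) refl i~a₁) (sym e))
    a₁~i : SameCycle b a₁ i
    a₁~i = sc-sym b (subst (SameCycle b i) (Transposed.at-b (transposed-β pos a₁ a₂) {i} refl) (sc-step b i))
    found = argmin (λ z → sameCycle? b a₁ z ×-dec ((pos ⟨$⟩ʳ a₂) Fin.<? (pos ⟨$⟩ʳ z))) (λ z → toℕ (pos ⟨$⟩ʳ z))
      {i} (a₁~i , ≼∧≢⇒≺ pos αi≼i αi≢i)
    a₃ = proj₁ found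
    a₁~a₃ = proj₁ (proj₁ (proj₂ found))
    a₂<a₃ = proj₂ (proj₁ (proj₂ found))
    least = proj₂ (proj₂ found)

  cuts-unique : ∀ {pos U i a₁ a₂ a₃ e₁ e₂ e₃} → Cuts pos U i a₁ a₂ a₃ → Cuts pos U i e₁ e₂ e₃ →
    a₁ ≡ e₁ × a₂ ≡ e₂ × a₃ ≡ e₃
  cuts-unique {pos} {U} {i} X Y with min-unique pos (α pos) (Cuts.min₁ X) (Cuts.min₁ Y) (sc-trans (α pos) (Cuts.a₁~i X) (sc-sym (α pos) (Cuts.a₁~i Y)))
    | trans (sym (Cuts.αi≡a₂ X)) (Cuts.αi≡a₂ Y)
  ... | refl | refl = refl , refl , perm-injective pos (toℕ-injective (ℕ.≤-antisym
    (Cuts.least X _ (Cuts.a₁~a₃ Y) (Cuts.a₂<a₃ Y)) (Cuts.least Y _ (Cuts.a₁~a₃ X) (Cuts.a₂<a₃ X))))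

  joints-exist : ∀ {pos U i} → Marked (pos , U , i) → ¬ LoneCycle (pos , U , i) →
    ∃ λ a₁ → ∃ λ a₂ → ∃ λ a₃ → Joints pos U i a₁ a₂ a₃ × a₁ ≺⟨ pos ⟩ a₃ × a₃ ∈ₛ U
  joints-exist {pos} {U} {i} (marked st odd i∈U αi≼i last _) ¬lone with min-exists pos (α pos) i
  ... | m , minₘ , i~m = go₁ (any? R₁?)
    where
    a = α pos
    P R₁ : Fin n → Set
    P x = IsMin pos a x × x ∈ₛ U
    P? : ∀ x → Dec (P x)
    P? x = isMin? pos a x ×-dec (x ∈ₛ? U)
    R₁ x = P x × ¬ SameCycle a x i
    R₁? : ∀ x → Dec (R₁ x)
    R₁? x = P? x ×-dec ¬? (sameCycle? a x i)
    Pm : P m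
    Pm = minₘ , stable-sc a st i∈U i~m
    is-m : ∀ {x} → P x → SameCycle a x i → x ≡ m
    is-m p s = min-unique pos a (proj₁ p) minₘ (sc-trans a s i~m)
    #≡ : #inside a U ≡ count P? (allFin n)
    #≡ = #inside≡ a st (min-reps pos a st) P?
    goal = ∃ λ a₁ → ∃ λ a₂ → ∃ λ a₃ → Joints pos U i a₁ a₂ a₃ × a₁ ≺⟨ pos ⟩ a₃ × a₃ ∈ₛ U
    go₁ : Dec (∃ R₁) → goal
    go₁ (no none) = ⊥-elim (¬lone (trans #≡ (count-one P? (allFin-unique n) (∈-allFin m) Pm only)))
      where
      only : ∀ {x} → P x → x ≡ m
      only {x} p with sameCycle? a x i
      ... | yes s = is-m p s
      ... | no ¬s = contradiction (x , p , ¬s) none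
    go₁ (yes (_ , r₁)) with argmax R₁? (pos ⟨$⟩ʳ_) r₁
    ... | a₁ , (p₁ , a₁≁i) , greatest₁ = go₂ (any? R₂?)
      where
      R₂ : Fin n → Set
      R₂ x = R₁ x × x ≢ a₁
      R₂? : ∀ x → Dec (R₂ x)
      R₂? x = R₁? x ×-dec ¬? (x ≟ a₁)
      go₂ : Dec (∃ R₂) → goal
      -- Only the cycles of m and a₁ would be left in U, but their number is odd.
      go₂ (no none) = contradiction (subst Odd (trans #≡ two) odd) λ ()
        where
        m? = or? (_≟ m) a₁
        to : ∀ {x} → P x → x ≡ m ⊎ x ≡ a₁
        to {x} p with sameCycle? a x i | x ≟ a₁
        ... | yes s | _     = inj₁ (is-m p s)
        ... | no _  | yes e = inj₂ e
        ... | no ¬s | no ne = contradiction (x , (p , ¬s) , ne) none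
        two : count P? (allFin n) ≡ 2
        two = trans (count-cong P? m? (allFin n) (λ _ → to) (λ { _ (inj₁ refl) → Pm ; _ (inj₂ refl) → p₁ }))
          (trans (count-or (_≟ m) a₁ (λ { refl → a₁≁i (sc-sym a i~m) }))
            (cong suc (count-one (_≟ m) (allFin-unique n) (∈-allFin m) refl id)))
      go₂ (yes (_ , r₂)) with argmax R₂? (pos ⟨$⟩ʳ_) r₂
      ... | a₂ , (r₁ , a₂≢a₁) , greatest₂ = a₁ , a₂ , a₃ , record
          { αi≡a₃ = refl ; min₁ = proj₁ p₁ ; min₂ = proj₁ (proj₁ r₁) ; a₁∈U = proj₂ p₁ ; a₂∈U = proj₂ (proj₁ r₁)
          ; a₂<a₁ = ≼∧≢⇒≺ pos (greatest₁ a₂ r₁) a₂≢a₁ ; a₁≁i = a₁≁i ; a₂≁i = proj₂ r₁ ; other = other }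
          -- The cycle of i is the last one, so a₁ comes no later than its first point m, and m no
          -- later than a₃.
          , ≼∧≢⇒≺ pos (ℕ.≤-trans (last a₁ (proj₂ p₁) (proj₁ p₁) m minₘ (sc-sym a i~m)) (minₘ a₃ (sc-trans a (sc-sym a i~m) (sc-step a i))))
              (λ { refl → a₁≁i (sc-sym a (sc-step a i)) })
          , st i i∈U
        where
        a₃ = a ⟨$⟩ʳ i
        other : ∀ b → b ∈ₛ U → IsMin pos a b → SameCycle a b i ⊎ b ≡ a₁ ⊎ b ≡ a₂ ⊎ b ≺⟨ pos ⟩ a₂
        other b b∈ minb with sameCycle? a b i | b ≟ a₁ | b ≟ a₂
        ... | yes s | _     | _     = inj₁ s
        ... | no _  | yes e | _     = inj₂ (inj₁ e)
        ... | no _  | no _  | yes e = inj₂ (inj₂ (inj₁ e))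
        ... | no ¬s | no n₁ | no n₂ = inj₂ (inj₂ (inj₂ (≼∧≢⇒≺ pos (greatest₂ b (((minb , b∈) , ¬s) , n₁)) n₂)))

  joints-unique : ∀ {pos U i a₁ a₂ a₃ e₁ e₂ e₃} → Joints pos U i a₁ a₂ a₃ → Joints pos U i e₁ e₂ e₃ →
    a₁ ≡ e₁ × a₂ ≡ e₂ × a₃ ≡ e₃
  joints-unique {pos} {U} {i} {a₁} {a₂} {_} {e₁} {e₂} X Y =
    a₁≡e₁ , a₂≡e₂ a₁≡e₁ , trans (sym (Joints.αi≡a₃ X)) (Joints.αi≡a₃ Y)
    where
    module X = Joints X
    module Y = Joints Y
    rank : ∀ {a₁ a₂ a₃ e₁ e₂ e₃} (X : Joints pos U i a₁ a₂ a₃) (Y : Joints pos U i e₁ e₂ e₃) →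
      a₁ ≡ e₁ ⊎ a₁ ≡ e₂ ⊎ a₁ ≺⟨ pos ⟩ e₂
    rank X Y = [ (λ s → contradiction s (Joints.a₁≁i X)) , id ]′ (Joints.other Y _ (Joints.a₁∈U X) (Joints.min₁ X))
    below : ∀ {a₁ a₂ a₃ e₁ e₂ e₃} (X : Joints pos U i a₁ a₂ a₃) (Y : Joints pos U i e₁ e₂ e₃) → a₁ ≼⟨ pos ⟩ e₁
    below X Y with rank X Y
    ... | inj₁ refl        = ℕ.≤-refl
    ... | inj₂ (inj₁ refl) = ℕ.<⇒≤ (Joints.a₂<a₁ Y)
    ... | inj₂ (inj₂ lt)   = ℕ.<⇒≤ (ℕ.<-trans lt (Joints.a₂<a₁ Y))
    a₁≡e₁ : a₁ ≡ e₁
    a₁≡e₁ = perm-injective pos (toℕ-injective (ℕ.≤-antisym (below X Y) (below Y X)))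
    below₂ : ∀ {a₁ a₂ a₃ e₂ e₃} (X : Joints pos U i a₁ a₂ a₃) (Y : Joints pos U i a₁ e₂ e₃) → a₂ ≼⟨ pos ⟩ e₂
    below₂ X Y with Joints.other Y _ (Joints.a₂∈U X) (Joints.min₂ X)
    ... | inj₁ s                 = contradiction s (Joints.a₂≁i X)
    ... | inj₂ (inj₁ refl)       = contradiction (Joints.a₂<a₁ X) (ℕ.<-irrefl refl)
    ... | inj₂ (inj₂ (inj₁ refl)) = ℕ.≤-refl
    ... | inj₂ (inj₂ (inj₂ lt))  = ℕ.<⇒≤ lt
    a₂≡e₂ : a₁ ≡ e₁ → a₂ ≡ e₂
    a₂≡e₂ refl = perm-injective pos (toℕ-injective (ℕ.≤-antisym (below₂ X Y) (below₂ Y X)))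

  module _ {pos pos′ : Permutation′ n} {U : Subset n} {i a₁ a₂ a₃ : Fin n} (S : Swap a₁ a₂ a₃ pos pos′) where
    private
      a = α pos
      a′ = α pos′
      a₂≺′a₁ = a₁≺a₂ (swap-sym S)
      a₁≺′a₃ = a₂≺a₃ (swap-sym S)

    -- The order in the new word is at stake. The old cycle has no point before a₁, so the part of
    -- a₂ begins with a₂ there; the choice of a₃ keeps the other two parts from preceding a₁. The
    -- remaining cycles of U begin before a₁ in the old word, a region that does not move, so they
    -- still come earlier than all three.
    forward : Marked (pos , U , i) → Cuts pos U i a₁ a₂ a₃ →
      Marked (pos′ , U , i) × ¬ LoneCycle (pos′ , U , i) × Joints pos′ U i a₁ a₂ a₃
    forward (marked st odd i∈U αi≼i last mQ) X =
      marked (stable⁺ S spl a₁∈U st) (trans (cong (ℕ._% 2) #≡) (trans (odd-2+ (#inside a U)) odd))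
        i∈U (subst (_≼⟨ pos′ ⟩ i) (sym a′i≡a₃) a₃≼′i) last′ (subst Q (merged-split S spl a₁∈U st) mQ)
      , (λ e → contradiction (trans (sym #≡) e) λ ())
      , record
        { αi≡a₃ = a′i≡a₃ ; min₁ = min₁′ ; min₂ = min₂′ ; a₁∈U = a₁∈U ; a₂∈U = stable-sc a st a₁∈U a₁~a₂
        ; a₂<a₁ = a₂≺′a₁ ; a₁≁i = λ s → a₁≁′a₃ (sc-trans a′ s i~′a₃) ; a₂≁i = λ s → a₂≁′a₃ (sc-trans a′ s i~′a₃)
        ; other = other }
      where
      module X = Cuts X
      spl = cuts-split S X
      open Splits spl
      a₁∈U : a₁ ∈ₛ U
      a₁∈U = stable-sc a st i∈U (sc-sym a X.a₁~i)
      #≡ : #inside a′ U ≡ 2 + #inside a U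
      #≡ = #inside-split S spl a₁∈U st X.min₁
      a′i≡a₃ : a′ ⟨$⟩ʳ i ≡ a₃
      a′i≡a₃ = succ-a₂ S X.αi≡a₂
      i~′a₃ : SameCycle a′ i a₃
      i~′a₃ = subst (SameCycle a′ i) a′i≡a₃ (sc-step a′ i)
      -- The arcs of a₁ and a₃ avoid the interval from a₂ to before a₃.
      first-arcs : ∀ {z} → SameCycle (β pos a₁ a₂) a₁ z → (z ≺⟨ pos ⟩ a₂ × a₁ ≼⟨ pos′ ⟩ z) ⊎ a₃ ≼⟨ pos′ ⟩ z
      first-arcs {z} s with block S z
      ... | inA lt _ = contradiction (X.min₁ z (b⇒a s)) (ℕ.<⇒≱ lt)
      ... | inB _ lt le _ = inj₁ (lt , le)
      ... | inC le lt _ _ = contradiction (X.least z s (≼∧≢⇒≺ pos le (λ { refl → a₁≁a₂ s }))) (ℕ.<⇒≱ lt)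
      ... | inE _ le = inj₂ le
      a₁≼′ : ∀ {z} → SameCycle (β pos a₁ a₂) a₁ z → a₁ ≼⟨ pos′ ⟩ z
      a₁≼′ s = [ proj₂ , ℕ.≤-trans (ℕ.<⇒≤ a₁≺′a₃) ]′ (first-arcs s)
      min₁′ : IsMin pos′ a′ a₁
      min₁′ z s = a₁≼′ (a′⇒b (inj₁ (sc-sym a′ s)))
      min₂′ : IsMin pos′ a′ a₂
      min₂′ z s with block S z
      ... | inA lt _ = contradiction (X.min₁ z (sc-sym a (a₂-a′⇒a (sc-sym a′ s)))) (ℕ.<⇒≱ lt)
      ... | inB _ _ le _ = ℕ.≤-trans (ℕ.<⇒≤ a₂≺′a₁) le
      ... | inC _ _ le _ = le
      ... | inE _ le = ℕ.≤-trans (ℕ.<⇒≤ (ℕ.<-trans a₂≺′a₁ a₁≺′a₃)) le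
      a₃≼′i : a₃ ≼⟨ pos′ ⟩ i
      a₃≼′i with first-arcs (a′⇒b (inj₂ i~′a₃))
      -- In the old word i does not precede α i = a₂, so it is not in the first interval.
      ... | inj₁ (lt , _) = contradiction (subst (_≼⟨ pos ⟩ i) X.αi≡a₂ αi≼i) (ℕ.<⇒≱ lt)
      ... | inj₂ le = le
      other : ∀ b → b ∈ₛ U → IsMin pos′ a′ b → SameCycle a′ b i ⊎ b ≡ a₁ ⊎ b ≡ a₂ ⊎ b ≺⟨ pos′ ⟩ a₂
      other b b∈U minb with sameCycle? a b a₁
      ... | yes s with a⇒a′ s
      ... | inj₁ t = inj₂ (inj₁ (min-unique pos′ a′ minb min₁′ t))
      ... | inj₂ (inj₁ t) = inj₂ (inj₂ (inj₁ (min-unique pos′ a′ minb min₂′ t)))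
      ... | inj₂ (inj₂ t) = inj₁ (sc-trans a′ t (sc-sym a′ i~′a₃))
      other b b∈U minb | no ¬s with min-exists pos a b
      ... | m , minₘ , b~m = inj₂ (inj₂ (inj₂ (ℕ.≤-<-trans (minb m (away ¬s b~m)) m≺′a₂)))
        where
        m≺a₁ : m ≺⟨ pos ⟩ a₁
        m≺a₁ = ≼∧≢⇒≺ pos (last m (stable-sc a st b∈U b~m) minₘ a₁ X.min₁ X.a₁~i) (λ { refl → ¬s b~m })
        m≺′a₂ : m ≺⟨ pos′ ⟩ a₂
        m≺′a₂ with block S m
        ... | inA _ lt = lt
        ... | inB le _ _ _ = contradiction le (ℕ.<⇒≱ m≺a₁)
        ... | inC le _ _ _ = contradiction (ℕ.≤-trans (ℕ.<⇒≤ (a₁≺a₂ S)) le) (ℕ.<⇒≱ m≺a₁)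
        ... | inE le _ = contradiction (ℕ.≤-trans (ℕ.<⇒≤ (ℕ.<-trans (a₁≺a₂ S) (a₂≺a₃ S))) le) (ℕ.<⇒≱ m≺a₁)
      last′ : Last pos′ U i
      last′ b b∈U minb m minₘ m~i with other b b∈U minb
      ... | inj₁ s = ℕ.≤-reflexive (cong (λ x → toℕ (pos′ ⟨$⟩ʳ x)) (min-unique pos′ a′ minb minₘ (sc-trans a′ s (sc-sym a′ m~i))))
      ... | inj₂ rest = ℕ.≤-trans (go rest) (a₁≼′ (a′⇒b (inj₂ (sc-trans a′ m~i i~′a₃))))
        where
        go : b ≡ a₁ ⊎ b ≡ a₂ ⊎ b ≺⟨ pos′ ⟩ a₂ → b ≼⟨ pos′ ⟩ a₁
        go (inj₁ refl) = ℕ.≤-refl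
        go (inj₂ (inj₁ refl)) = ℕ.<⇒≤ a₂≺′a₁
        go (inj₂ (inj₂ lt)) = ℕ.<⇒≤ (ℕ.<-trans lt a₂≺′a₁)

    -- In the new word no point of the cycles of a₁ and i precedes a₁, for the cycle of i because it
    -- is the last one. Hence, after the intervals are put back, the glued cycle begins with a₁, and
    -- no point of the arc from a₁ falls between a₂ and a₃.
    backward : Marked (pos′ , U , i) → Joints pos′ U i a₁ a₂ a₃ → a₃ ∈ₛ U →
      Marked (pos , U , i) × ¬ TrivialMark (pos , U , i) × Cuts pos U i a₁ a₂ a₃
    backward (marked st′ odd i∈U αi≼′i last mQ) Y a₃∈U =
      marked st (trans (sym (odd-2+ (#inside a U))) (trans (cong (ℕ._% 2) (sym #≡)) odd))
        i∈U (subst (_≼⟨ pos ⟩ i) (sym ai≡a₂) (ℕ.≤-trans (ℕ.<⇒≤ (a₂≺a₃ S)) a₃≼i)) last⁻ (subst Q (sym (merged-split S spl Y.a₁∈U st)) mQ)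
      , (λ minαi → contradiction (subst (IsMin pos a) ai≡a₂ minαi a₁ (sc-sym a a₁~a₂)) (ℕ.<⇒≱ (a₁≺a₂ S)))
      , record
        { min₁ = min₁ ; a₁~i = a₁~i ; αi≡a₂ = ai≡a₂ ; a₁~a₃ = a₁~a₃ ; a₂<a₃ = a₂≺a₃ S ; least = least }
      where
      module Y = Joints Y
      spl = joints-split S Y
      open Splits spl
      st : Stable a U
      st = stable⁻ S spl Y.a₁∈U Y.a₂∈U a₃∈U st′
      i~′a₃ : SameCycle a′ i a₃
      i~′a₃ = subst (SameCycle a′ i) Y.αi≡a₃ (sc-step a′ i)
      a₁≼′ : ∀ {z} → SameCycle a′ z a₁ ⊎ SameCycle a′ z a₃ → a₁ ≼⟨ pos′ ⟩ z
      a₁≼′ (inj₁ s) = Y.min₁ _ (sc-sym a′ s)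
      a₁≼′ {z} (inj₂ s) with min-exists pos′ a′ z
      ... | m , minₘ , z~m = ℕ.≤-trans (last a₁ Y.a₁∈U Y.min₁ m minₘ (sc-trans a′ (sc-sym a′ z~m) (sc-trans a′ s (sc-sym a′ i~′a₃))))
        (minₘ z (sc-sym a′ z~m))
      a₂≼′ : ∀ {z} → SameCycle a z a₁ → a₂ ≼⟨ pos′ ⟩ z
      a₂≼′ s with a⇒a′ s
      ... | inj₁ t = ℕ.≤-trans (ℕ.<⇒≤ a₂≺′a₁) (a₁≼′ (inj₁ t))
      ... | inj₂ (inj₁ t) = Y.min₂ _ (sc-sym a′ t)
      ... | inj₂ (inj₂ t) = ℕ.≤-trans (ℕ.<⇒≤ a₂≺′a₁) (a₁≼′ (inj₂ t))
      min₁ : IsMin pos a a₁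
      min₁ z s with block S z
      ... | inA _ lt = contradiction (a₂≼′ (sc-sym a s)) (ℕ.<⇒≱ lt)
      ... | inB le _ _ _ = le
      ... | inC le _ _ _ = ℕ.≤-trans (ℕ.<⇒≤ (a₁≺a₂ S)) le
      ... | inE le _ = ℕ.≤-trans (ℕ.<⇒≤ (ℕ.<-trans (a₁≺a₂ S) (a₂≺a₃ S))) le
      #≡ : #inside a′ U ≡ 2 + #inside a U
      #≡ = #inside-split S spl Y.a₁∈U st min₁
      ai≡a₂ : a ⟨$⟩ʳ i ≡ a₂
      ai≡a₂ = Transposed.at-a (transposed-sym (transposed-β pos a₁ a₂)) {i}
        (Transposed.at-b (transposed-sym (transposed-β′ S)) {i} Y.αi≡a₃)
      a₁~i : SameCycle a a₁ i
      a₁~i = sc-trans a a₁~a₂ (sc-sym a (subst (SameCycle a i) ai≡a₂ (sc-step a i)))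
      a₃≼′i : a₃ ≼⟨ pos′ ⟩ i
      a₃≼′i = subst (_≼⟨ pos′ ⟩ i) Y.αi≡a₃ αi≼′i
      a₃≼i : a₃ ≼⟨ pos ⟩ i
      a₃≼i with block S i
      ... | inA _ lt = contradiction a₃≼′i (ℕ.<⇒≱ (ℕ.<-trans lt (ℕ.<-trans a₂≺′a₁ a₁≺′a₃)))
      ... | inB _ _ _ lt = contradiction a₃≼′i (ℕ.<⇒≱ lt)
      ... | inC _ _ _ lt = contradiction a₃≼′i (ℕ.<⇒≱ (ℕ.<-trans lt a₁≺′a₃))
      ... | inE le _ = le
      least : ∀ z → SameCycle (β pos a₁ a₂) a₁ z → a₂ ≺⟨ pos ⟩ z → a₃ ≼⟨ pos ⟩ z
      least z s a₂<z with block S z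
      ... | inA lt _ = contradiction (ℕ.<-trans lt (a₁≺a₂ S)) (ℕ.<-asym a₂<z)
      ... | inB _ lt _ _ = contradiction lt (ℕ.<-asym a₂<z)
      ... | inC _ _ _ lt = contradiction (a₁≼′ (b⇒a′ s)) (ℕ.<⇒≱ lt)
      ... | inE le _ = le
      last⁻ : Last pos U i
      last⁻ b b∈U minb m minₘ m~i with min-unique pos a minₘ min₁ (sc-trans a m~i (sc-sym a a₁~i)) | sameCycle? a b a₁
      ... | refl | yes s = ℕ.≤-reflexive (cong (λ x → toℕ (pos ⟨$⟩ʳ x)) (min-unique pos a minb min₁ s))
      ... | refl | no ¬s with min-exists pos′ a′ b
      ... | r , minᵣ , b~r = ℕ.≤-trans (minb r (away⁻ ¬s b~r)) (ℕ.<⇒≤ r≺a₁)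
        where
        r≺′a₂ : r ≺⟨ pos′ ⟩ a₂
        r≺′a₂ with Y.other r (stable-sc a′ st′ b∈U b~r) minᵣ
        ... | inj₁ t = contradiction (a′⇒a (inj₂ (inj₂ (sc-trans a′ b~r (sc-trans a′ t i~′a₃))))) ¬s
        ... | inj₂ (inj₁ refl) = contradiction (a′⇒a (inj₁ b~r)) ¬s
        ... | inj₂ (inj₂ (inj₁ refl)) = contradiction (a′⇒a (inj₂ (inj₁ b~r))) ¬s
        ... | inj₂ (inj₂ (inj₂ lt)) = lt
        r≺a₁ : r ≺⟨ pos ⟩ a₁
        r≺a₁ with block S r
        ... | inA lt _ = lt
        ... | inB _ _ le _ = contradiction (ℕ.≤-trans (ℕ.<⇒≤ a₂≺′a₁) le) (ℕ.<⇒≱ r≺′a₂)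
        ... | inC _ _ le _ = contradiction le (ℕ.<⇒≱ r≺′a₂)
        ... | inE _ le = contradiction (ℕ.≤-trans (ℕ.<⇒≤ (ℕ.<-trans a₂≺′a₁ a₁≺′a₃)) le) (ℕ.<⇒≱ r≺′a₂)

-- Counting marks in two ways

∈-subsets : ∀ {m} (S : Subset m) → S ∈ subsets m
∈-subsets []          = here refl
∈-subsets (true ∷ S)  = ∈-++⁺ˡ (∈-map⁺ (true ∷_) (∈-subsets S))
∈-subsets (false ∷ S) = ∈-++⁺ʳ _ (∈-map⁺ (false ∷_) (∈-subsets S))

subsets-unique : ∀ m → UniqueSetoid.Unique (setoid (Subset m)) (subsets m)
subsets-unique zero    = [] ∷ []
subsets-unique (suc m) = AllPairs.++⁺ (prefixed true) (prefixed false)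
  (All.map⁺ (All.universal (λ _ → All.map⁺ (All.universal (λ _ ()) _)) _))
  where
  prefixed : ∀ b → UniqueSetoid.Unique (setoid (Subset (suc m))) (map (b ∷_) (subsets m))
  prefixed b = AllPairs.map⁺ (AllPairs.map (λ ne e → ne (Vec.∷-injectiveʳ e)) (subsets-unique m))

subset-of : {P : Fin n → Set} (P? : ∀ x → Dec (P x)) →
  ∃ λ (U : Subset n) → (∀ {x} → x ∈ₛ U → P x) × (∀ {x} → P x → x ∈ₛ U)
subset-of {zero}  P? = [] , (λ { {()} }) , (λ { {()} })
subset-of {suc n} P? with subset-of (P? ∘ suc) | P? zero
... | U , sound , complete | yes p = true ∷ U , (λ { Vec.here → p ; (Vec.there m) → sound m }) , (λ { {zero} _ → Vec.here ; {suc x} q → Vec.there (complete q) })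
... | U , sound , complete | no ¬p = false ∷ U , (λ { (Vec.there m) → sound m }) , (λ { {zero} q → contradiction q ¬p ; {suc x} q → Vec.there (complete q) })

count≡1 : {P : A → Set} (P? : ∀ x → Dec (P x)) {xs : List A} → count P? xs ≡ 1 →
  ∀ {x y} → x ∈ xs → y ∈ xs → P x → P y → x ≡ y
count≡1 P? {xs} one x∈ y∈ px py with filter P? xs | ∈-filter⁺ P? x∈ px | ∈-filter⁺ P? y∈ py
... | _ ∷ [] | here refl | here refl = refl

count>0 : {P : Fin n → Set} (P? : ∀ x → Dec (P x)) → Odd (count P? (allFin n)) → ∃ P
count>0 {n} P? odd with any? P?
... | yes p = p
... | no none = contradiction (subst Odd (count-none P? (allFin n) (λ x p → none (x , p))) odd) λ ()

module MarkCount {n : ℕ} (D : Permutation′ n) (Q : List ℕ → Set) (Q? : ∀ μ → Dec (Q μ))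
  (Q-resp : ∀ {μ ν} → μ ↭ ν → Q μ → Q ν) where
  open Surgery D Q Q?
  open Transfer D Q Q?

  private
    Ω : List (Permutation′ n × Subset n × Fin n)
    Ω = cartesianProduct (permutations n) (cartesianProduct (subsets n) (allFin n))

    ΩS : Setoid 0ℓ 0ℓ
    ΩS = ×-setoid (permSetoid n) (×-setoid (setoid (Subset n)) (setoid (Fin n)))

    Ω-unique : UniqueSetoid.Unique ΩS Ω
    Ω-unique = UniqueSetoid.cartesianProduct⁺ (permSetoid n) (×-setoid (setoid (Subset n)) (setoid (Fin n))) (permutations-unique n)
      (UniqueSetoid.cartesianProduct⁺ (setoid _) (setoid _) (subsets-unique n) (allFin-unique n))

    ∈Ω : ∀ {pos U i} → pos ∈ permutations n → (pos , U , i) ∈ Ω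
    ∈Ω pos∈ = ∈-cartesianProduct⁺ pos∈ (∈-cartesianProduct⁺ (∈-subsets _) (∈-allFin _))

    pos∈G : ∀ {x} → x ∈ Ω → proj₁ x ∈ permutations n
    pos∈G m = proj₁ (∈-cartesianProduct⁻ (permutations n) (cartesianProduct (subsets n) (allFin n)) m)

  -- The relation `R` records the three points as they are seen from either word. They are
  -- determined by the mark on each side, and they determine the exchange, so partners are unique in
  -- both directions.
  nontrivial≡multiple : count (λ x → marked? x ×-dec ¬? (trivialMark? x)) Ω ≡ count (λ x → marked? x ×-dec ¬? (loneCycle? x)) Ω
  nontrivial≡multiple = count-match {ΩS} {ΩS} Ω-unique Ω-unique
    (λ x → marked? x ×-dec ¬? (trivialMark? x)) (λ x → marked? x ×-dec ¬? (loneCycle? x)) R to from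
    (λ _ _ _ → injˡ) (λ _ _ _ → injʳ)
    where
    R : Permutation′ n × Subset n × Fin n → Permutation′ n × Subset n × Fin n → Set
    R (pos , U , i) (pos′ , U′ , i′) = (U ≡ U′ × i ≡ i′) × ∃ λ a₁ → ∃ λ a₂ → ∃ λ a₃ →
      Cuts pos U i a₁ a₂ a₃ × Joints pos′ U i a₁ a₂ a₃ × Swap a₁ a₂ a₃ pos pos′
    to : ∀ {x} → x ∈ Ω → Marked x × ¬ TrivialMark x → ∃ λ y → y ∈ Ω × (Marked y × ¬ LoneCycle y) × R x y
    to {pos , U , i} m (mk , ¬t) =
      let a₁ , a₂ , a₃ , X , lt = cuts-exist mk ¬t
          pos′ , pos′∈ , S = swap-exists pos lt (Cuts.a₂<a₃ X)
          mk′ , ¬l , Y = forward S mk X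
      in (pos′ , U , i) , ∈Ω pos′∈ , (mk′ , ¬l) , (refl , refl) , a₁ , a₂ , a₃ , X , Y , S
    from : ∀ {y} → y ∈ Ω → Marked y × ¬ LoneCycle y → ∃ λ x → x ∈ Ω × (Marked x × ¬ TrivialMark x) × R x y
    from {pos′ , U , i} m (mk , ¬l) =
      let a₁ , a₂ , a₃ , Y , lt , a₃∈ = joints-exist mk ¬l
          pos , pos∈ , S⁻ = swap-exists pos′ (Joints.a₂<a₁ Y) lt
          mk′ , ¬t , X = backward (swap-sym S⁻) mk Y a₃∈
      in (pos , U , i) , ∈Ω pos∈ , (mk′ , ¬t) , (refl , refl) , a₁ , a₂ , a₃ , X , Y , swap-sym S⁻
    along : ∀ {a₁ a₂ a₃ e₁ e₂ e₃ : Fin n} {pos pos′ pos″} → a₁ ≡ e₁ × a₂ ≡ e₂ × a₃ ≡ e₃ →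
      Swap a₁ a₂ a₃ pos pos′ → Swap e₁ e₂ e₃ pos pos″ → pos′ ≈ pos″
    along (refl , refl , refl) S S′ = swap-functional S S′
    along⁻ : ∀ {a₁ a₂ a₃ e₁ e₂ e₃ : Fin n} {pos pos′ pos″} → a₁ ≡ e₁ × a₂ ≡ e₂ × a₃ ≡ e₃ →
      Swap a₁ a₂ a₃ pos′ pos → Swap e₁ e₂ e₃ pos″ pos → pos′ ≈ pos″
    along⁻ (refl , refl , refl) S S′ = swap-functional (swap-sym S) (swap-sym S′)
    injˡ : ∀ {x x′ y} → R x y → R x′ y → Setoid._≈_ ΩS x x′
    injˡ ((refl , refl) , _ , _ , _ , _ , Y , S) ((refl , refl) , _ , _ , _ , _ , Y′ , S′) = along⁻ (joints-unique Y Y′) S S′ , refl , refl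
    injʳ : ∀ {x y y′} → R x y → R x y′ → Setoid._≈_ ΩS y y′
    injʳ ((refl , refl) , _ , _ , _ , X , _ , S) ((refl , refl) , _ , _ , _ , X′ , _ , S′) = along (cuts-unique X X′) S S′ , refl , refl

  trivial≡lone : count (λ x → marked? x ×-dec trivialMark? x) Ω ≡ count (λ x → marked? x ×-dec loneCycle? x) Ω
  trivial≡lone = ℕ.+-cancelʳ-≡ (count (λ x → marked? x ×-dec ¬? (trivialMark? x)) Ω) _ _ (trans (sym (count-split marked? trivialMark? Ω))
    (trans (count-split marked? loneCycle? Ω) (cong (_+_ (count (λ x → marked? x ×-dec loneCycle? x) Ω)) (sym nontrivial≡multiple))))

  record Mergeable (x : Permutation′ n × Subset n) : Set where
    constructor mergeable
    private
      pos = proj₁ x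
      U   = proj₂ x
    field
      stable   : Stable (α pos) U
      odd      : Odd (#inside (α pos) U)
      mergesTo : Q (merged (α pos) U)

  abstract
    mergeable? : ∀ x → Dec (Mergeable x)
    mergeable? (pos , U) = map′ (λ (st , odd , q) → mergeable st odd q) (λ (mergeable st odd q) → st , odd , q)
      (stable? (α pos) U ×-dec odd? (#inside (α pos) U) ×-dec Q? (merged (α pos) U))

  AntiExceedance : Permutation′ n × Fin n → Set
  AntiExceedance (pos , i) = (α pos ⟨$⟩ʳ i) ≼⟨ pos ⟩ i × Q (cycleLengths (α pos))

  abstract
    antiExceedance? : ∀ x → Dec (AntiExceedance x)
    antiExceedance? (pos , i) = ((pos ⟨$⟩ʳ (α pos ⟨$⟩ʳ i)) Fin.≤? (pos ⟨$⟩ʳ i)) ×-dec Q? (cycleLengths (α pos))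

  last-exists : ∀ {pos U} → Mergeable (pos , U) → ∃ λ m → IsMin pos (α pos) m × m ∈ₛ U ×
    (∀ b → IsMin pos (α pos) b × b ∈ₛ U → b ≼⟨ pos ⟩ m)
  last-exists {pos} {U} (mergeable st odd q) =
    let m , (minₘ , m∈) , greatest = argmax P? (pos ⟨$⟩ʳ_) (proj₂ (count>0 P? (subst Odd (#inside≡ (α pos) st (min-reps pos (α pos) st) P?) odd)))
    in m , minₘ , m∈ , greatest
    where
    P? : ∀ x → Dec (IsMin pos (α pos) x × x ∈ₛ U)
    P? x = isMin? pos (α pos) x ×-dec (x ∈ₛ? U)

  -- Take for i the preimage under α of the first point m of the last cycle in U; it is an
  -- anti-exceedance because m precedes or equals every point of its cycle.
  mark-last : ∀ {pos U} → Mergeable (pos , U) → ∃ λ i → Marked (pos , U , i) × TrivialMark (pos , U , i)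
  mark-last {pos} {U} M@(mergeable st odd q) =
    let m , minₘ , m∈ , greatest = last-exists M
        i = a ⟨$⟩ˡ m
        m~i = m~ m
    in i
     , marked st odd (stable-sc a st m∈ m~i) (subst (_≼⟨ pos ⟩ i) (sym (inverseʳ a)) (minₘ i m~i))
        (λ b b∈ minb r minᵣ r~i → subst (b ≼⟨ pos ⟩_) (min-unique pos a minₘ minᵣ (sc-trans a m~i (sc-sym a r~i))) (greatest b (minb , b∈))) q
     , subst (IsMin pos a) (sym (inverseʳ a)) minₘ
    where
    a = α pos
    m~ : ∀ m → SameCycle a m (a ⟨$⟩ˡ m)
    m~ m = sc-sym a (subst (SameCycle a (a ⟨$⟩ˡ m)) (inverseʳ a) (sc-step a (a ⟨$⟩ˡ m)))

  trivial-unique : ∀ {pos U i i′} → Marked (pos , U , i) → Marked (pos , U , i′) →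
    TrivialMark (pos , U , i) → TrivialMark (pos , U , i′) → i ≡ i′
  trivial-unique {pos} {U} {i} {i′} (marked st _ i∈ _ last _) (marked _ _ i′∈ _ last′ _) min min′ =
    perm-injective a (perm-injective pos (toℕ-injective (ℕ.≤-antisym
      (last′ _ (st i i∈) min _ min′ (sc-sym a (sc-step a i′))) (last _ (st i′ i′∈) min′ _ min (sc-sym a (sc-step a i))))))
    where a = α pos

  trivial≡mergeable : count (λ x → marked? x ×-dec trivialMark? x) Ω ≡ count mergeable? (cartesianProduct (permutations n) (subsets n))
  trivial≡mergeable = count-match {ΩS} {×-setoid (permSetoid n) (setoid _)} Ω-unique
    (UniqueSetoid.cartesianProduct⁺ (permSetoid n) (setoid _) (permutations-unique n) (subsets-unique n))
    (λ x → marked? x ×-dec trivialMark? x) mergeable? R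
    (λ {x} x∈ (mk , _) → (proj₁ x , proj₁ (proj₂ x)) , ∈-cartesianProduct⁺ (pos∈G x∈) (∈-subsets _)
       , mergeable (Marked.stable mk) (Marked.odd mk) (Marked.mergesTo mk) , refl)
    (λ {y} y∈ M → let i , mk , t = mark-last M in (proj₁ y , proj₂ y , i)
       , ∈Ω (proj₁ (∈-cartesianProduct⁻ (permutations n) (subsets n) y∈)) , (mk , t) , refl)
    (λ (mk , t) (mk′ , t′) _ r r′ → injˡ mk mk′ t t′ r r′)
    (λ { _ _ _ refl refl → (λ _ → refl) , refl })
    where
    R : Permutation′ n × Subset n × Fin n → Permutation′ n × Subset n → Set
    R (pos , U , i) y = (pos , U) ≡ y
    injˡ : ∀ {x x′ y} → Marked x → Marked x′ → TrivialMark x → TrivialMark x′ → R x y → R x′ y → Setoid._≈_ ΩS x x′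
    injˡ mk mk′ t t′ refl refl = (λ _ → refl) , refl , trivial-unique mk mk′ t t′

  lone-sc : ∀ {pos U i} → Marked (pos , U , i) → LoneCycle (pos , U , i) → ∀ {x} → x ∈ₛ U → SameCycle (α pos) i x
  lone-sc {pos} {U} {i} (marked st _ i∈ _ _ _) l {x} x∈ =
    let r , pr , s = Reps.hit R i∈
        r′ , pr′ , s′ = Reps.hit R x∈
    in sc-trans a s (sc-sym a (subst (SameCycle a x) (sym (count≡1 (inside? a U) {allFin n} l (∈-allFin r) (∈-allFin r′) pr pr′)) s′))
    where
    a = α pos
    R = min-reps idₚ a st

  lone-mark : ∀ {pos i} → AntiExceedance (pos , i) → ∃ λ U → Marked (pos , U , i) × LoneCycle (pos , U , i)
  lone-mark {pos} {i} (le , q) =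
    let U , sound , complete = subset-of (sameCycle? a i) in U , go sound complete
    where
    a = α pos
    go : ∀ {U} → (∀ {x} → x ∈ₛ U → SameCycle a i x) → (∀ {x} → SameCycle a i x → x ∈ₛ U) →
      Marked (pos , U , i) × LoneCycle (pos , U , i)
    go {U} sound complete = marked st (cong (ℕ._% 2) one) i∈ le
        (λ b b∈ minb r minᵣ r~i → ℕ.≤-reflexive (cong (λ x → toℕ (pos ⟨$⟩ʳ x)) (min-unique pos a minb minᵣ (sc-sym a (sc-trans a r~i (sound b∈))))))
        (Q-resp (merged-cycle a i sound complete) q)
      , one
      where
      st : Stable a U
      st x x∈ = complete (sc-trans a (sound x∈) (sc-step a x))
      i∈ : i ∈ₛ U
      i∈ = complete (sc-refl a)
      one : #inside a U ≡ 1
      one = trans (#inside≡ a st (record { ⊆U = λ { refl → i∈ } ; hit = λ x∈ → i , refl , sc-sym a (sound x∈) ; uniq = λ { refl refl _ → refl } }) (_≟ i))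
        (count-one (_≟ i) (allFin-unique n) (∈-allFin i) refl id)

  lone≡antiExceedance : count (λ x → marked? x ×-dec loneCycle? x) Ω ≡ count antiExceedance? (cartesianProduct (permutations n) (allFin n))
  lone≡antiExceedance = count-match {ΩS} {×-setoid (permSetoid n) (setoid _)} Ω-unique
    (UniqueSetoid.cartesianProduct⁺ (permSetoid n) (setoid _) (permutations-unique n) (allFin-unique n))
    (λ x → marked? x ×-dec loneCycle? x) antiExceedance? R
    (λ {x} x∈ (mk , l) → (proj₁ x , proj₂ (proj₂ x)) , ∈-cartesianProduct⁺ (pos∈G x∈) (∈-allFin _)
       , (Marked.αi≼i mk , Q-resp (↭-sym (merged-cycle (α (proj₁ x)) (proj₂ (proj₂ x))
           (lone-sc mk l) (stable-sc (α (proj₁ x)) (Marked.stable mk) (Marked.i∈U mk)))) (Marked.mergesTo mk)) , refl)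
    (λ {y} y∈ M → let U , mk , l = lone-mark M in (proj₁ y , U , proj₂ y)
       , ∈Ω (proj₁ (∈-cartesianProduct⁻ (permutations n) (allFin n) y∈)) , (mk , l) , refl)
    (λ (mk , l) (mk′ , l′) _ r r′ → injˡ mk mk′ l l′ r r′)
    (λ { _ _ _ refl refl → (λ _ → refl) , refl })
    where
    R : Permutation′ n × Subset n × Fin n → Permutation′ n × Fin n → Set
    R (pos , U , i) y = (pos , i) ≡ y
    sub : ∀ {pos U U′ i} → Marked (pos , U , i) → Marked (pos , U′ , i) → LoneCycle (pos , U , i) → ∀ {x} → x ∈ₛ U → x ∈ₛ U′
    sub {pos} mk mk′ l x∈ = stable-sc (α pos) (Marked.stable mk′) (Marked.i∈U mk′) (lone-sc mk l x∈)
    injˡ : ∀ {x x′ y} → Marked x → Marked x′ → LoneCycle x → LoneCycle x′ → R x y → R x′ y → Setoid._≈_ ΩS x x′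
    injˡ mk mk′ l l′ refl refl = (λ _ → refl) , ⊆-antisym (sub mk mk′ l) (sub mk′ mk l′) , refl

  antiExceedance≡mergeable :
    ∑[ pos ∈ permutations n ] (∑[ i ∈ allFin n ] 𝟙 (antiExceedance? (pos , i)))
      ≡ ∑[ pos ∈ permutations n ] (∑[ U ∈ subsets n ] 𝟙 (mergeable? (pos , U)))
  antiExceedance≡mergeable = begin
    ∑[ pos ∈ permutations n ] (∑[ i ∈ allFin n ] 𝟙 (antiExceedance? (pos , i)))
      ≡⟨ ∑-cartesianProduct (permutations n) (allFin n) (λ x → 𝟙 (antiExceedance? x)) ⟨
    ∑[ x ∈ cartesianProduct (permutations n) (allFin n) ] 𝟙 (antiExceedance? x)
      ≡⟨ count≡∑ antiExceedance? (cartesianProduct (permutations n) (allFin n)) ⟨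
    count antiExceedance? (cartesianProduct (permutations n) (allFin n))
      ≡⟨ trans (sym lone≡antiExceedance) (trans (sym trivial≡lone) trivial≡mergeable) ⟩
    count mergeable? (cartesianProduct (permutations n) (subsets n))
      ≡⟨ count≡∑ mergeable? (cartesianProduct (permutations n) (subsets n)) ⟩
    ∑[ x ∈ cartesianProduct (permutations n) (subsets n) ] 𝟙 (mergeable? x)
      ≡⟨ ∑-cartesianProduct (permutations n) (subsets n) (λ x → 𝟙 (mergeable? x)) ⟩
    ∑[ pos ∈ permutations n ] (∑[ U ∈ subsets n ] 𝟙 (mergeable? (pos , U))) ∎
    where open ≡-Reasoning

-- Splitting the parts of a partition

-- The common form of two choices: of the cycles that make up an invariant set, and of the parts to
-- be merged in `κ`. Entries are distinguished by their positions.
splits : List A → List (List A × List A)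
splits []       = ([] , []) ∷ []
splits (x ∷ xs) = map (λ (i , o) → x ∷ i , o) (splits xs) ++ map (λ (i , o) → i , x ∷ o) (splits xs)

∑-splits : (List A → List A → ℕ) → List A → ℕ
∑-splits W xs = ∑[ s ∈ splits xs ] (W (proj₁ s) (proj₂ s))

∑-splits-∷ : (W : List A → List A → ℕ) (x : A) (xs : List A) →
  ∑-splits W (x ∷ xs) ≡ ∑-splits (λ i o → W (x ∷ i) o) xs + ∑-splits (λ i o → W i (x ∷ o)) xs
∑-splits-∷ W x xs = trans (∑-++ (map _ (splits xs)) (map _ (splits xs)) _)
  (cong₂ _+_ (∑-map _ (splits xs) _) (∑-map _ (splits xs) _))

∑-splits-cong : {W W′ : List A → List A → ℕ} → (∀ i o → W i o ≡ W′ i o) → ∀ xs → ∑-splits W xs ≡ ∑-splits W′ xs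
∑-splits-cong h xs = ∑-cong (splits xs) (λ (i , o) → h i o)

-- When the two leading entries are swapped, the two terms that put them on different sides change
-- places.
∑-splits-↭ : (W : List A → List A → ℕ) → (∀ {i i′ o o′} → i ↭ i′ → o ↭ o′ → W i o ≡ W i′ o′) →
  {xs ys : List A} → xs ↭ ys → ∑-splits W xs ≡ ∑-splits W ys
∑-splits-↭ W resp Perm.refl = refl
∑-splits-↭ W resp {x ∷ xs} {_ ∷ ys} (Perm.prep x p) = trans (∑-splits-∷ W x xs) (trans
  (cong₂ _+_ (∑-splits-↭ (λ i o → W (x ∷ i) o) (λ a b → resp (↭-prep x a) b) p)
             (∑-splits-↭ (λ i o → W i (x ∷ o)) (λ a b → resp a (↭-prep x b)) p)) (sym (∑-splits-∷ W x ys)))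
∑-splits-↭ W resp {x ∷ y ∷ xs} {_ ∷ _ ∷ ys} (Perm.swap x y p) = begin
  ∑-splits W (x ∷ y ∷ xs)
    ≡⟨ expand W x y xs ⟩
  (∑-splits (λ i o → W (x ∷ y ∷ i) o) xs + ∑-splits (λ i o → W (x ∷ i) (y ∷ o)) xs) + (∑-splits (λ i o → W (y ∷ i) (x ∷ o)) xs + ∑-splits (λ i o → W i (x ∷ y ∷ o)) xs)
    ≡⟨ +-interchange (∑-splits (λ i o → W (x ∷ y ∷ i) o) xs) _ _ _ ⟩
  (∑-splits (λ i o → W (x ∷ y ∷ i) o) xs + ∑-splits (λ i o → W (y ∷ i) (x ∷ o)) xs) + (∑-splits (λ i o → W (x ∷ i) (y ∷ o)) xs + ∑-splits (λ i o → W i (x ∷ y ∷ o)) xs)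
    ≡⟨ cong₂ _+_ (cong₂ _+_
         (trans (∑-splits-cong (λ i o → resp (Perm.swap x y Perm.refl) Perm.refl) xs) (∑-splits-↭ (λ i o → W (y ∷ x ∷ i) o) (λ a b → resp (↭-prep y (↭-prep x a)) b) p))
         (∑-splits-↭ (λ i o → W (y ∷ i) (x ∷ o)) (λ a b → resp (↭-prep y a) (↭-prep x b)) p)) (cong₂ _+_
         (∑-splits-↭ (λ i o → W (x ∷ i) (y ∷ o)) (λ a b → resp (↭-prep x a) (↭-prep y b)) p)
         (trans (∑-splits-cong (λ i o → resp Perm.refl (Perm.swap x y Perm.refl)) xs) (∑-splits-↭ (λ i o → W i (y ∷ x ∷ o)) (λ a b → resp a (↭-prep y (↭-prep x b))) p))) ⟩
  (∑-splits (λ i o → W (y ∷ x ∷ i) o) ys + ∑-splits (λ i o → W (y ∷ i) (x ∷ o)) ys) + (∑-splits (λ i o → W (x ∷ i) (y ∷ o)) ys + ∑-splits (λ i o → W i (y ∷ x ∷ o)) ys)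
    ≡⟨ expand W y x ys ⟨
  ∑-splits W (y ∷ x ∷ ys) ∎
  where
  open ≡-Reasoning
  expand : ∀ W x y xs → ∑-splits W (x ∷ y ∷ xs) ≡
    (∑-splits (λ i o → W (x ∷ y ∷ i) o) xs + ∑-splits (λ i o → W (x ∷ i) (y ∷ o)) xs) + (∑-splits (λ i o → W (y ∷ i) (x ∷ o)) xs + ∑-splits (λ i o → W i (x ∷ y ∷ o)) xs)
  expand W x y xs = trans (∑-splits-∷ W x (y ∷ xs)) (cong₂ _+_ (∑-splits-∷ _ y xs) (∑-splits-∷ _ y xs))
∑-splits-↭ W resp (Perm.trans p q) = trans (∑-splits-↭ W resp p) (∑-splits-↭ W resp q)

∑-splits-map : (f : A → B) (W : List B → List B → ℕ) (xs : List A) →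
  ∑-splits W (map f xs) ≡ ∑-splits (λ i o → W (map f i) (map f o)) xs
∑-splits-map f W []       = refl
∑-splits-map f W (x ∷ xs) = trans (∑-splits-∷ W (f x) (map f xs)) (trans
  (cong₂ _+_ (∑-splits-map f _ xs) (∑-splits-map f _ xs)) (sym (∑-splits-∷ _ x xs)))

∈-splits⁻ : ∀ x {xs : List A} {s} → s ∈ splits (x ∷ xs) →
  (∃ λ t → t ∈ splits xs × s ≡ (x ∷ proj₁ t , proj₂ t)) ⊎ (∃ λ t → t ∈ splits xs × s ≡ (proj₁ t , x ∷ proj₂ t))
∈-splits⁻ x {xs} s∈ with ∈-++⁻ (map (λ (i , o) → x ∷ i , o) (splits xs)) s∈
... | inj₁ m = inj₁ (∈-map⁻ _ m)
... | inj₂ m = inj₂ (∈-map⁻ _ m)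

splits-++ : {xs : List A} {s : List A × List A} → s ∈ splits xs → proj₁ s ++ proj₂ s ↭ xs
splits-++ {xs = []} (here refl) = ↭-refl
splits-++ {xs = x ∷ xs} s∈ with ∈-splits⁻ x {xs} s∈
... | inj₁ (t , t∈ , refl) = ↭-prep x (splits-++ {xs = xs} t∈)
... | inj₂ ((i , o) , t∈ , refl) = ↭-trans (shift x i o) (↭-prep x (splits-++ {xs = xs} t∈))

splits-length : {xs : List A} {s : List A × List A} → s ∈ splits xs → length (proj₁ s) + length (proj₂ s) ≡ length xs
splits-length {xs = xs} {i , o} s∈ = trans (sym (List.length-++ i)) (↭-length (splits-++ {xs = xs} s∈))

module _ {P : A → Set} (P? : ∀ x → Dec (P x)) where

  filter-∈-splits : (xs : List A) → (filter P? xs , filter (λ x → ¬? (P? x)) xs) ∈ splits xs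
  filter-∈-splits []       = here refl
  filter-∈-splits (x ∷ xs) with P? x
  ... | yes _ = ∈-++⁺ˡ (∈-map⁺ (λ (i , o) → x ∷ i , o) (filter-∈-splits xs))
  ... | no  _ = ∈-++⁺ʳ _ (∈-map⁺ (λ (i , o) → i , x ∷ o) (filter-∈-splits xs))

  splits-filter : {xs : List A} {s : List A × List A} → s ∈ splits xs →
    (∀ {x} → x ∈ proj₁ s → P x) → (∀ {x} → x ∈ proj₂ s → ¬ P x) →
    (filter P? xs , filter (λ x → ¬? (P? x)) xs) ≡ s
  splits-filter {[]} (here refl) allP none = refl
  splits-filter {x ∷ xs} s∈ allP none with ∈-splits⁻ x {xs} s∈
  ... | inj₁ (t , t∈ , refl) with P? x | splits-filter {xs} t∈ (allP ∘ there) none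
  ... | yes _ | refl = refl
  ... | no ¬p | _    = contradiction (allP (here refl)) ¬p
  splits-filter {x ∷ xs} s∈ allP none | inj₂ (t , t∈ , refl) with P? x | splits-filter {xs} t∈ allP (none ∘ there)
  ... | yes p | _    = contradiction p (none (here refl))
  ... | no _  | refl = refl

splits-disjoint : {xs : List A} → UniqueSetoid.Unique (setoid A) xs → {s : List A × List A} → s ∈ splits xs →
  ∀ {x} → x ∈ proj₁ s → x ∈ proj₂ s → ⊥
splits-disjoint {xs = []} u (here refl) () _
splits-disjoint {xs = y ∷ xs} (y∉ ∷ u) s∈ x∈i x∈o with ∈-splits⁻ y {xs} s∈
... | inj₁ (t , t∈ , refl) with x∈i
... | here refl = All.lookup y∉ (∈-resp-↭ (splits-++ {xs = xs} t∈) (∈-++⁺ʳ (proj₁ t) x∈o)) refl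
... | there m = splits-disjoint u t∈ m x∈o
splits-disjoint {xs = y ∷ xs} (y∉ ∷ u) s∈ x∈i x∈o | inj₂ (t , t∈ , refl) with x∈o
... | here refl = All.lookup y∉ (∈-resp-↭ (splits-++ {xs = xs} t∈) (∈-++⁺ˡ x∈i)) refl
... | there m = splits-disjoint u t∈ x∈i m

splits-unique : {xs : List A} → UniqueSetoid.Unique (setoid A) xs → UniqueSetoid.Unique (setoid _) (splits xs)
splits-unique []             = [] ∷ []
splits-unique {xs = x ∷ xs} (x∉ ∷ u) = AllPairs.++⁺
  (AllPairs.map⁺ (AllPairs.map (λ { ne refl → ne refl }) (splits-unique u)))
  (AllPairs.map⁺ (AllPairs.map (λ { ne refl → ne refl }) (splits-unique u)))
  (All.tabulate λ m → All.tabulate λ m′ → clash m m′)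
  where
  clash : ∀ {s s′} → s ∈ map (λ (i , o) → x ∷ i , o) (splits xs) → s′ ∈ map (λ (i , o) → i , x ∷ o) (splits xs) → s ≢ s′
  clash m m′ refl with ∈-map⁻ _ m | ∈-map⁻ _ m′
  ... | t , t∈ , refl | t′ , t′∈ , refl = All.lookup x∉ (∈-resp-↭ (splits-++ {xs = xs} t∈) (∈-++⁺ʳ (proj₁ t) (here refl))) refl

filter-filter : {P Q : A → Set} (P? : ∀ x → Dec (P x)) (Q? : ∀ x → Dec (Q x)) (xs : List A) →
  filter (λ x → P? x ×-dec Q? x) xs ≡ filter Q? (filter P? xs)
filter-filter P? Q? []       = refl
filter-filter P? Q? (x ∷ xs) with P? x
... | no  _ = filter-filter P? Q? xs
... | yes _ with Q? x
... | yes _ = cong (x ∷_) (filter-filter P? Q? xs)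
... | no  _ = filter-filter P? Q? xs

-- An invariant set is determined by the cycles that it contains.
stable-splits : (π : Permutation′ n) →
  map (λ U → inside π U , outside π U) (filter (stable? π) (subsets n)) ↭ splits (filter (isCycleMin? π) (allFin n))
stable-splits {n} π = ↭-trans (match-↭ {R = λ U s → Stable π U × (inside π U , outside π U) ≡ s} to from
    (AllPairs.map (λ ne y (st , e) (st′ , e′) → ne (unique st st′ (trans e (sym e′)))) (AllPairs.filter⁺ (stable? π) (subsets-unique n)))
    (AllPairs.map (λ ne x (_ , e) (_ , e′) → ne (trans (sym e) e′)) (splits-unique L-unique))
    proj₂) (↭-reflexive (List.map-id _))
  where
  L = filter (isCycleMin? π) (allFin n)
  L-unique : UniqueSetoid.Unique (setoid (Fin n)) L
  L-unique = AllPairs.filter⁺ (isCycleMin? π) (allFin-unique n)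
  pair : ∀ U → (inside π U , outside π U) ≡ (filter (_∈ₛ? U) L , filter (λ x → ¬? (x ∈ₛ? U)) L)
  pair U = cong₂ _,_ (filter-filter (isCycleMin? π) (_∈ₛ? U) (allFin n)) (filter-filter (isCycleMin? π) (λ x → ¬? (x ∈ₛ? U)) (allFin n))
  to : ∀ {U} → U ∈ filter (stable? π) (subsets n) → ∃ λ s → s ∈ splits L × Stable π U × (inside π U , outside π U) ≡ s
  to {U} U∈ = _ , subst (_∈ splits L) (sym (pair U)) (filter-∈-splits (_∈ₛ? U) L)
    , proj₂ (∈-filter⁻ (stable? π) {xs = subsets n} U∈) , refl
  from : ∀ {s} → s ∈ splits L → ∃ λ U → U ∈ filter (stable? π) (subsets n) × Stable π U × (inside π U , outside π U) ≡ s
  -- The invariant set sought is the union of the cycles represented in i.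
  from {i , o} s∈ with subset-of (λ x → Any.any? (λ a → sameCycle? π a x) i)
  ... | U , sound , complete = U , ∈-filter⁺ (stable? π) (∈-subsets U) st , st
      , trans (pair U) (splits-filter (_∈ₛ? U) {L} s∈ (λ a∈ → complete (lose a∈ (sc-refl π))) none)
    where
    st : Stable π U
    st x x∈ = complete (Any.map (λ s → sc-trans π s (sc-step π x)) (sound x∈))
    minimal : ∀ {x} → x ∈ i ++ o → IsCycleMin π x
    minimal x∈ = proj₂ (∈-filter⁻ (isCycleMin? π) {xs = allFin n} (∈-resp-↭ (splits-++ {xs = L} s∈) x∈))
    none : ∀ {x} → x ∈ o → ¬ (x ∈ₛ U)
    none {x} x∈o x∈U with find (sound x∈U)
    ... | a , a∈i , s with min-unique idₚ π (minimal (∈-++⁺ˡ a∈i)) (minimal (∈-++⁺ʳ i x∈o)) s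
    ... | refl = splits-disjoint L-unique s∈ a∈i x∈o
  sub : ∀ {U U′} → Stable π U → Stable π U′ → inside π U ≡ inside π U′ → ∀ {x} → x ∈ₛ U → x ∈ₛ U′
  sub {U} {U′} st st′ e {x} x∈ with Reps.hit (min-reps idₚ π st) x∈
  ... | r , pr , s = stable-sc π st′ (proj₂ (proj₂ (∈-filter⁻ (inside? π U′) {xs = allFin n} (subst (r ∈_) e (∈-filter⁺ (inside? π U) (∈-allFin r) pr))))) (sc-sym π s)
  unique : ∀ {U U′} → Stable π U → Stable π U′ → (inside π U , outside π U) ≡ (inside π U′ , outside π U′) → U ≡ U′
  unique st st′ e = ⊆-antisym (sub st st′ (cong proj₁ e)) (sub st′ st (sym (cong proj₁ e)))

∑-stable : (π : Permutation′ n) (W : List ℕ → List ℕ → ℕ) →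
  ∑[ U ∈ subsets n ] (𝟙 (stable? π U) * W (map (cycleLength π) (inside π U)) (map (cycleLength π) (outside π U)))
    ≡ ∑-splits W (cycleLengths π)
∑-stable {n} π W = begin
  ∑[ U ∈ subsets n ] (𝟙 (stable? π U) * W (lens (inside π U)) (lens (outside π U)))
    ≡⟨ ∑-filter (stable? π) (subsets n) _ ⟨
  ∑[ U ∈ filter (stable? π) (subsets n) ] (W (lens (inside π U)) (lens (outside π U)))
    ≡⟨ ∑-map (λ U → inside π U , outside π U) (filter (stable? π) (subsets n)) (λ (i , o) → W (lens i) (lens o)) ⟨
  ∑[ s ∈ map (λ U → inside π U , outside π U) (filter (stable? π) (subsets n)) ] (W (lens (proj₁ s)) (lens (proj₂ s)))
    ≡⟨ sum-↭ (map⁺ (λ (i , o) → W (lens i) (lens o)) (stable-splits π)) ⟩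
  ∑-splits (λ i o → W (lens i) (lens o)) (filter (isCycleMin? π) (allFin n))
    ≡⟨ ∑-splits-map (cycleLength π) W (filter (isCycleMin? π) (allFin n)) ⟨
  ∑-splits W (cycleLengths π) ∎
  where
  open ≡-Reasoning
  lens = map (cycleLength π)

filter-map : (f : A → B) {P : B → Set} (P? : ∀ x → Dec (P x)) (xs : List A) →
  filter P? (map f xs) ≡ map f (filter (P? ∘ f) xs)
filter-map f P? []       = refl
filter-map f P? (x ∷ xs) with P? (f x)
... | yes _ = cong (f x ∷_) (filter-map f P? xs)
... | no  _ = filter-map f P? xs

partsIn-tail : ∀ x μ b (S : Subset (length μ)) →
  map (lookup (x ∷ μ)) (filter (_∈ₛ? (b ∷ S)) (tabulate suc)) ≡ partsIn μ S
partsIn-tail x μ b S = begin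
  map (lookup (x ∷ μ)) (filter (_∈ₛ? (b ∷ S)) (tabulate suc))
    ≡⟨ cong (λ xs → map (lookup (x ∷ μ)) (filter (_∈ₛ? (b ∷ S)) xs)) (sym (List.map-tabulate id suc)) ⟩
  map (lookup (x ∷ μ)) (filter (_∈ₛ? (b ∷ S)) (map suc (allFin (length μ))))
    ≡⟨ cong (map (lookup (x ∷ μ))) (filter-map suc (_∈ₛ? (b ∷ S)) (allFin (length μ))) ⟩
  map (lookup (x ∷ μ)) (map suc (filter (λ j → suc j ∈ₛ? (b ∷ S)) (allFin (length μ))))
    ≡⟨ map-∘ (filter (λ j → suc j ∈ₛ? (b ∷ S)) (allFin (length μ))) ⟨
  map (lookup μ) (filter (λ j → suc j ∈ₛ? (b ∷ S)) (allFin (length μ)))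
    ≡⟨ cong (map (lookup μ)) (filter-cong∈ (λ j → suc j ∈ₛ? (b ∷ S)) (_∈ₛ? S) (allFin (length μ)) (λ { _ (Vec.there m) → m }) (λ _ → Vec.there)) ⟩
  partsIn μ S ∎
  where open ≡-Reasoning

partsIn-∷ : ∀ x μ b (S : Subset (length μ)) →
  partsIn (x ∷ μ) (b ∷ S) ≡ (if b then x ∷ partsIn μ S else partsIn μ S)
partsIn-∷ x μ true  S = cong (x ∷_) (partsIn-tail x μ true S)
partsIn-∷ x μ false S = partsIn-tail x μ false S

∑-subsets : (W : List ℕ → List ℕ → ℕ) (μ : List ℕ) →
  ∑[ S ∈ subsets (length μ) ] (W (partsIn μ S) (partsIn μ (∁ S))) ≡ ∑-splits W μ
∑-subsets W []      = refl
∑-subsets W (x ∷ μ) = begin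
  ∑[ S ∈ subsets (suc (length μ)) ] (W (partsIn (x ∷ μ) S) (partsIn (x ∷ μ) (∁ S)))
    ≡⟨ ∑-++ (map (true ∷_) (subsets (length μ))) _ _ ⟩
  ∑-syntax (map (true ∷_) (subsets (length μ))) _ + ∑-syntax (map (false ∷_) (subsets (length μ))) _
    ≡⟨ cong₂ _+_ (∑-map (true ∷_) (subsets (length μ)) _) (∑-map (false ∷_) (subsets (length μ)) _) ⟩
  (∑[ S ∈ subsets (length μ) ] (W (partsIn (x ∷ μ) (true ∷ S)) (partsIn (x ∷ μ) (false ∷ ∁ S))))
    + (∑[ S ∈ subsets (length μ) ] (W (partsIn (x ∷ μ) (false ∷ S)) (partsIn (x ∷ μ) (true ∷ ∁ S))))
    ≡⟨ cong₂ _+_ (∑-cong (subsets (length μ)) (λ S → cong₂ W (partsIn-∷ x μ true S) (partsIn-∷ x μ false (∁ S))))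
                 (∑-cong (subsets (length μ)) (λ S → cong₂ W (partsIn-∷ x μ false S) (partsIn-∷ x μ true (∁ S)))) ⟩
  (∑[ S ∈ subsets (length μ) ] (W (x ∷ partsIn μ S) (partsIn μ (∁ S)))) + (∑[ S ∈ subsets (length μ) ] (W (partsIn μ S) (x ∷ partsIn μ (∁ S))))
    ≡⟨ cong₂ _+_ (∑-subsets (λ i o → W (x ∷ i) o) μ) (∑-subsets (λ i o → W i (x ∷ o)) μ) ⟩
  ∑-splits (λ i o → W (x ∷ i) o) μ + ∑-splits (λ i o → W i (x ∷ o)) μ
    ≡⟨ ∑-splits-∷ W x μ ⟨
  ∑-splits W (x ∷ μ) ∎
  where open ≡-Reasoning

∣∣≡length-partsIn : ∀ μ (S : Subset (length μ)) → ∣ S ∣ ≡ length (partsIn μ S)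
∣∣≡length-partsIn []      []          = refl
∣∣≡length-partsIn (x ∷ μ) (true ∷ S)  = trans (cong suc (∣∣≡length-partsIn μ S)) (cong length (sym (partsIn-∷ x μ true S)))
∣∣≡length-partsIn (x ∷ μ) (false ∷ S) = trans (∣∣≡length-partsIn μ S) (cong length (sym (partsIn-∷ x μ false S)))

κ≡∑-splits : ∀ μ ν → κ μ ν ≡ ∑-splits (λ i o → 𝟙 ((length i ℕ.≟ length μ ∸ length ν + 1) ×-dec (sum i ∷ o ↭? ν))) μ
κ≡∑-splits μ ν = trans (count≡∑ _ (subsets (length μ))) (trans
  (∑-cong (subsets (length μ)) (λ S → cong (λ m → 𝟙 ((m ℕ.≟ length μ ∸ length ν + 1) ×-dec (mergeParts μ S ↭? ν))) (∣∣≡length-partsIn μ S)))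
  (∑-subsets (λ i o → 𝟙 ((length i ℕ.≟ length μ ∸ length ν + 1) ×-dec (sum i ∷ o ↭? ν))) μ))

∑-splits-lengthˡ : (k : ℕ) (xs : List A) → ∑-splits (λ i o → 𝟙 (length i ℕ.≟ k)) xs ≡ length xs C k
∑-splits-lengthˡ zero    []       = refl
∑-splits-lengthˡ (suc k) []       = refl
∑-splits-lengthˡ zero    (x ∷ xs) = trans (∑-splits-∷ (λ i o → 𝟙 (length i ℕ.≟ 0)) x xs) (cong₂ _+_ (∑-0 (splits xs)) (∑-splits-lengthˡ zero xs))
∑-splits-lengthˡ (suc k) (x ∷ xs) = trans (∑-splits-∷ (λ i o → 𝟙 (length i ℕ.≟ suc k)) x xs) (trans
  (cong₂ _+_ (trans (∑-splits-cong (λ i o → 𝟙-cong ℕ.suc-injective (cong suc) _ _) xs) (∑-splits-lengthˡ k xs)) (∑-splits-lengthˡ (suc k) xs))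
  (nCk+nC[k+1]≡[n+1]C[k+1] (length xs) k))

∑-splits-lengthʳ : (k : ℕ) (xs : List A) → ∑-splits (λ i o → 𝟙 (length o ℕ.≟ k)) xs ≡ length xs C k
∑-splits-lengthʳ zero    []       = refl
∑-splits-lengthʳ (suc k) []       = refl
∑-splits-lengthʳ zero    (x ∷ xs) = trans (∑-splits-∷ (λ i o → 𝟙 (length o ℕ.≟ 0)) x xs) (trans (cong₂ _+_ (∑-splits-lengthʳ zero xs) (∑-0 (splits xs))) (ℕ.+-identityʳ _))
∑-splits-lengthʳ (suc k) (x ∷ xs) = trans (∑-splits-∷ (λ i o → 𝟙 (length o ℕ.≟ suc k)) x xs) (trans
  (cong₂ _+_ (∑-splits-lengthʳ (suc k) xs) (trans (∑-splits-cong (λ i o → 𝟙-cong ℕ.suc-injective (cong suc) _ _) xs) (∑-splits-lengthʳ k xs)))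
  (trans (ℕ.+-comm (length xs C suc k) _) (nCk+nC[k+1]≡[n+1]C[k+1] (length xs) k)))

range-unique : ∀ N → UniqueSetoid.Unique (setoid ℕ) [1⋯ N ]
range-unique N = AllPairs.map⁺ (AllPairs.applyUpTo⁺₁ id N (λ i<j _ e → ℕ.<⇒≢ i<j (ℕ.suc-injective e)))

∈-range⁺ : ∀ {N i} → i < N → suc i ∈ [1⋯ N ]
∈-range⁺ i<N = ∈-map⁺ suc (∈-upTo⁺ i<N)

∈-range⁻ : ∀ {N i} → i ∈ [1⋯ N ] → 1 ≤ i
∈-range⁻ m with ∈-map⁻ suc m
... | _ , _ , refl = s≤s z≤n

odd-2h+1 : ∀ h → Odd (2 * h + 1)
odd-2h+1 zero    = refl
odd-2h+1 (suc h) = trans (cong (ℕ._% 2) (trans (cong (_+ 1) (ℕ.*-suc 2 h)) refl)) (trans (odd-2+ (2 * h + 1)) (odd-2h+1 h))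

odd-half : ∀ {t} → Odd t → ∃ λ h → t ≡ 2 * h + 1
odd-half {t} o = t ℕ./ 2 , trans (ℕ.m≡m%n+[m/n]*n t 2) (trans (cong (_+ (t ℕ./ 2) * 2) o)
  (trans (ℕ.+-comm 1 _) (cong (_+ 1) (ℕ.*-comm (t ℕ./ 2) 2))))

-- Separates t = 1, the source of the terms that end up in the denominator, from t = 2i + 1 with i ≥
-- 1. The bound suffices because t = 2i + 1 forces i ≤ t.
𝟙-odd : ∀ {t N} → t ≤ N → 𝟙 (odd? t) ≡ 𝟙 (t ℕ.≟ 1) + (∑[ i ∈ [1⋯ N ] ] 𝟙 (t ℕ.≟ 2 * i + 1))
𝟙-odd {t} {N} t≤N with odd? t
... | no even = sym (cong₂ _+_ (𝟙-no (t ℕ.≟ 1) (λ { refl → even refl }))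
    (trans (∑-cong [1⋯ N ] (λ i → 𝟙-no (t ℕ.≟ 2 * i + 1) (λ { refl → even (odd-2h+1 i) }))) (∑-0 [1⋯ N ])))
... | yes odd with odd-half {t} odd
... | zero  , refl = sym (cong suc (trans (∑-cong∈ [1⋯ N ] (λ {i} m → 𝟙-no (1 ℕ.≟ 2 * i + 1)
    (λ e → ℕ.<⇒≢ (ℕ.<-≤-trans (∈-range⁻ m) (ℕ.m≤m+n i _)) (ℕ.+-cancelʳ-≡ 1 0 (2 * i) e)))) (∑-0 [1⋯ N ])))
... | suc h , refl = sym (cong₂ _+_ (𝟙-no (2 * suc h + 1 ℕ.≟ 1) (λ e → contradiction (ℕ.+-cancelʳ-≡ 1 (2 * suc h) 0 e) λ ()))
    (trans (sym (count≡∑ (λ i → 2 * suc h + 1 ℕ.≟ 2 * i + 1) [1⋯ N ]))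
      (count-one (λ i → 2 * suc h + 1 ℕ.≟ 2 * i + 1) (range-unique N)
        (∈-range⁺ (ℕ.≤-trans (ℕ.≤-trans (ℕ.m≤m+n (suc h) _) (ℕ.m≤m+n _ 1)) t≤N)) refl
        (λ {s} e → sym (ℕ.*-cancelˡ-≡ (suc h) s 2 (ℕ.+-cancelʳ-≡ 1 _ _ e))))))

weight : {Q : List ℕ → Set} → (∀ μ → Dec (Q μ)) → List ℕ → List ℕ → ℕ
weight Q? i o = 𝟙 (odd? (length i) ×-dec Q? (sum i ∷ o))

-- Merging leaves k′ + 1 parts exactly when k′ parts stay outside, which can be chosen in m C k′
-- ways for m parts; the number of merged parts is then m ∸ k′ and has to be odd. The case m = k′ +
-- 1, a single merged part, gives the coefficient k′ + 1.
∑-splits-length : ∀ k′ N (μ : List ℕ) → length μ ≤ N →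
  ∑-splits (weight (λ ξ → length ξ ℕ.≟ suc k′)) μ
    ≡ 𝟙 (length μ ℕ.≟ suc k′) * suc k′ + (∑[ i ∈ [1⋯ N ] ] (((suc k′ + 2 * i) C k′) * 𝟙 (length μ ℕ.≟ suc k′ + 2 * i)))
∑-splits-length k′ N μ m≤N = begin
  ∑-splits (weight (λ ξ → length ξ ℕ.≟ suc k′)) μ
    ≡⟨ ∑-cong∈ (splits μ) (λ {s} s∈ → trans (𝟙-cong (to s∈) (from s∈) _ (odd? (m ∸ k′) ×-dec (length (proj₂ s) ℕ.≟ k′))) (𝟙-× (odd? (m ∸ k′)) (length (proj₂ s) ℕ.≟ k′))) ⟩
  ∑[ s ∈ splits μ ] (𝟙 (odd? (m ∸ k′)) * 𝟙 (length (proj₂ s) ℕ.≟ k′))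
    ≡⟨ trans (∑-*ˡ (𝟙 (odd? (m ∸ k′))) (splits μ) _) (cong (_*_ (𝟙 (odd? (m ∸ k′)))) (∑-splits-lengthʳ k′ μ)) ⟩
  𝟙 (odd? (m ∸ k′)) * (m C k′)
    ≡⟨ cong (_* (m C k′)) (𝟙-odd (ℕ.≤-trans (ℕ.m∸n≤m m k′) m≤N)) ⟩
  (𝟙 (m ∸ k′ ℕ.≟ 1) + (∑[ i ∈ [1⋯ N ] ] 𝟙 (m ∸ k′ ℕ.≟ 2 * i + 1))) * (m C k′)
    ≡⟨ ℕ.*-distribʳ-+ (m C k′) (𝟙 (m ∸ k′ ℕ.≟ 1)) _ ⟩
  𝟙 (m ∸ k′ ℕ.≟ 1) * (m C k′) + (∑[ i ∈ [1⋯ N ] ] 𝟙 (m ∸ k′ ℕ.≟ 2 * i + 1)) * (m C k′)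
    ≡⟨ cong₂ _+_ (trans (cong (_* (m C k′)) (𝟙-cong sub′ (λ e → unsub 0 (trans e (sym (ℕ.+-identityʳ (suc k′))))) (m ∸ k′ ℕ.≟ 1) (m ℕ.≟ suc k′)))
                   (replace (m ℕ.≟ suc k′) (λ e → trans (cong (_C k′) e) (sucC k′))))
                 (trans (sym (∑-*ʳ (m C k′) [1⋯ N ] _)) (∑-cong [1⋯ N ] term)) ⟩
  𝟙 (m ℕ.≟ suc k′) * suc k′ + (∑[ i ∈ [1⋯ N ] ] (((suc k′ + 2 * i) C k′) * 𝟙 (m ℕ.≟ suc k′ + 2 * i))) ∎
  where
  open ≡-Reasoning
  m = length μ
  sucC : ∀ k → suc k C k ≡ suc k
  sucC k = trans (nCk≡nC[n∸k] (ℕ.n≤1+n k)) (trans (cong (suc k C_) (ℕ.m+n∸n≡m 1 k)) (nC1≡n (suc k)))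
  replace : ∀ {P : Set} (d : Dec P) {a b} → (P → a ≡ b) → 𝟙 d * a ≡ 𝟙 d * b
  replace (yes p) h = cong (1 *_) (h p)
  replace (no _)  h = refl
  sub : ∀ j → m ∸ k′ ≡ suc j → m ≡ suc k′ + j
  sub j e = trans (sym (ℕ.m∸n+n≡m k′≤m)) (trans (cong (_+ k′) e) (cong suc (ℕ.+-comm j k′)))
    where
    k′≤m : k′ ≤ m
    k′≤m = ℕ.<⇒≤ (ℕ.m∸n≢0⇒n<m (λ e′ → contradiction (trans (sym e) e′) λ ()))
  sub′ : m ∸ k′ ≡ 1 → m ≡ suc k′
  sub′ e = trans (sub 0 e) (ℕ.+-identityʳ (suc k′))
  unsub : ∀ j → m ≡ suc k′ + j → m ∸ k′ ≡ suc j
  unsub j e = trans (cong (_∸ k′) (trans e (sym (ℕ.+-suc k′ j)))) (ℕ.m+n∸m≡n k′ (suc j))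
  term : ∀ i → 𝟙 (m ∸ k′ ℕ.≟ 2 * i + 1) * (m C k′) ≡ ((suc k′ + 2 * i) C k′) * 𝟙 (m ℕ.≟ suc k′ + 2 * i)
  term i = trans (cong (_* (m C k′)) (𝟙-cong (λ e → sub (2 * i) (trans e (ℕ.+-comm (2 * i) 1))) (λ e → trans (unsub (2 * i) e) (ℕ.+-comm 1 (2 * i)))
      (m ∸ k′ ℕ.≟ 2 * i + 1) (m ℕ.≟ suc k′ + 2 * i)))
    (trans (replace (m ℕ.≟ suc k′ + 2 * i) (cong (_C k′))) (ℕ.*-comm (𝟙 (m ℕ.≟ suc k′ + 2 * i)) _))
  to : ∀ {s} → s ∈ splits μ → Odd (length (proj₁ s)) × suc (length (proj₂ s)) ≡ suc k′ → Odd (m ∸ k′) × length (proj₂ s) ≡ k′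
  to {i , o} s∈ (odd , refl) = subst Odd (trans (sym (ℕ.m+n∸n≡m (length i) (length o))) (cong (_∸ length o) (splits-length {xs = μ} s∈))) odd , refl
  from : ∀ {s} → s ∈ splits μ → Odd (m ∸ k′) × length (proj₂ s) ≡ k′ → Odd (length (proj₁ s)) × suc (length (proj₂ s)) ≡ suc k′
  from {i , o} s∈ (odd , refl) = subst Odd (sym (trans (sym (ℕ.m+n∸n≡m (length i) (length o))) (cong (_∸ length o) (splits-length {xs = μ} s∈)))) odd , refl

-- Compositions, partitions and the merging of parts

extend-cons : ∀ (as : List ℕ) → 1 ∷ as ∈ extend as
extend-cons []      = here refl
extend-cons (_ ∷ _) = here refl

∈-compositions : ∀ xs → All (0 <_) xs → xs ∈ compositions (sum xs)
∈-compositions [] [] = here refl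
∈-compositions (suc a ∷ as) (_ ∷ pos) = go a
  where
  go : ∀ a → suc a ∷ as ∈ compositions (suc a + sum as)
  go zero    = ∈-concat⁺′ (extend-cons as) (∈-map⁺ extend (∈-compositions as pos))
  go (suc a) = ∈-concat⁺′ (there (here refl)) (∈-map⁺ extend (go a))

compositions-positive : ∀ n {as} → as ∈ compositions n → All (0 <_) as
compositions-positive zero (here refl) = []
compositions-positive (suc n) m with ∈-concat⁻′ (map extend (compositions n)) m
... | _ , m₁ , m₂ with ∈-map⁻ extend m₂
... | [] , m₃ , refl with m₁
... | here refl = z<s ∷ []
compositions-positive (suc n) m | _ , m₁ , m₂ | (a ∷ as) , m₃ , refl with m₁ | compositions-positive n m₃
... | here refl         | ps     = z<s ∷ ps
... | there (here refl) | _ ∷ ps = z<s ∷ ps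

AllPairs-zip : {P : A → Set} {R : A → A → Set} {xs : List A} → All P xs → AllPairs R xs → AllPairs (λ x y → P x × P y × R x y) xs
AllPairs-zip []       []       = []
AllPairs-zip (p ∷ ps) (r ∷ rs) = All.zipWith (λ (q , r) → p , q , r) (ps , r) ∷ AllPairs-zip ps rs

-- Each composition arises from one other only, which `predecessor` recovers. Positivity matters: a
-- leading 1 must not be the result of incrementing a part 0.
compositions-unique : ∀ n → UniqueSetoid.Unique (setoid (List ℕ)) (compositions n)
compositions-unique zero    = [] ∷ []
compositions-unique (suc n) = AllPairs.concat⁺ (All.map⁺ (All.universal extend-unique (compositions n)))
  (AllPairs.map⁺ (AllPairs.map (λ (pos , pos′ , ne) → All.tabulate λ m → All.tabulate λ m′ e →
      ne (trans (sym (predecessor-extend pos m)) (trans (cong predecessor e) (predecessor-extend pos′ m′))))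
    (AllPairs-zip (All.tabulate (compositions-positive n)) (compositions-unique n))))
  where
  predecessor : List ℕ → List ℕ
  predecessor (suc (suc a) ∷ as) = suc a ∷ as
  predecessor (_ ∷ as)           = as
  predecessor []                 = []
  predecessor-extend : ∀ {as bs} → All (0 <_) as → bs ∈ extend as → predecessor bs ≡ as
  predecessor-extend {[]} _ (here refl) = refl
  predecessor-extend {a ∷ as} _ (here refl) = refl
  predecessor-extend {suc a ∷ as} _ (there (here refl)) = refl
  predecessor-extend {zero ∷ as} (() ∷ _) _
  extend-unique : ∀ as → UniqueSetoid.Unique (setoid (List ℕ)) (extend as)
  extend-unique []       = [] ∷ []
  extend-unique (a ∷ as) = ((λ e → ℕ.1+n≢n (cong length e)) ∷ []) ∷ [] ∷ []

≥-decTotalOrder : DecTotalOrder 0ℓ 0ℓ 0ℓ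
≥-decTotalOrder = Flip.decTotalOrder ℕ.≤-decTotalOrder

≥-sorted-unique : ∀ {μ ν} → Linked ℕ._≥_ μ → Linked ℕ._≥_ ν → μ ↭ ν → μ ≡ ν
≥-sorted-unique s t p = Pointwise.Pointwise-≡⇒≡ (Sorted.↗↭↗⇒≋ (DecTotalOrder.totalOrder ≥-decTotalOrder) s t (↭⇒↭ₛ p))

All-resp : {P : ℕ → Set} {xs ys : List ℕ} → xs ↭ ys → All P xs → All P ys
All-resp p a = All.tabulate (λ m → All.lookup a (∈-resp-↭ (↭-sym p) m))

partition-exists : ∀ {xs} → All (0 <_) xs → ∃ λ μ → μ ∈ partitions (sum xs) × xs ↭ μ
partition-exists {xs} pos = μ , ∈-filter⁺ (_⊢? sum xs) (subst (λ s → μ ∈ compositions s) sum≡ (∈-compositions μ pos′))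
    (pos′ , Sort.sort-↗ ≥-decTotalOrder xs , sum≡) , xs↭μ
  where
  μ = Sort.sort ≥-decTotalOrder xs
  xs↭μ : xs ↭ μ
  xs↭μ = ↭-sym (Sort.sort-↭ ≥-decTotalOrder xs)
  sum≡ : sum μ ≡ sum xs
  sum≡ = sum-↭ (↭-sym xs↭μ)
  pos′ : All (0 <_) μ
  pos′ = All-resp xs↭μ pos

∈-partitions⁻ : ∀ {n μ} → μ ∈ partitions n → μ ⊢ n
∈-partitions⁻ {n} m = proj₂ (∈-filter⁻ (_⊢? n) {xs = compositions n} m)

-- A list of positive numbers has exactly one rearrangement among the partitions, its sorted form,
-- so a single term survives.
∑-partitions : ∀ {n xs} → All (0 <_) xs → sum xs ≡ n → (F : List ℕ → ℕ) → (∀ {μ} → xs ↭ μ → F μ ≡ F xs) →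
  ∑[ μ ∈ partitions n ] (𝟙 (xs ↭? μ) * F μ) ≡ F xs
∑-partitions {n} {xs} pos refl F resp = begin
  ∑[ μ ∈ partitions n ] (𝟙 (xs ↭? μ) * F μ)     ≡⟨ ∑-cong (partitions n) (λ μ → step (xs ↭? μ)) ⟩
  ∑[ μ ∈ partitions n ] (𝟙 (xs ↭? μ) * F xs)    ≡⟨ ∑-*ʳ (F xs) (partitions n) _ ⟩
  (∑[ μ ∈ partitions n ] 𝟙 (xs ↭? μ)) * F xs    ≡⟨ cong (_* F xs) one ⟩
  1 * F xs                                      ≡⟨ ℕ.*-identityˡ (F xs) ⟩
  F xs                                          ∎
  where
  open ≡-Reasoning
  step : ∀ {μ} (d : Dec (xs ↭ μ)) → 𝟙 d * F μ ≡ 𝟙 d * F xs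
  step (yes p) = cong (1 *_) (resp p)
  step (no _)  = refl
  one : ∑[ μ ∈ partitions n ] 𝟙 (xs ↭? μ) ≡ 1
  one = let μ₀ , μ₀∈ , p₀ = partition-exists pos
            m , ⊢n = ∈-filter⁻ (_⊢? n) {xs = compositions n} μ₀∈ in begin
    ∑[ μ ∈ partitions n ] 𝟙 (xs ↭? μ)
      ≡⟨ ∑-filter (_⊢? n) (compositions n) (λ μ → 𝟙 (xs ↭? μ)) ⟩
    ∑[ μ ∈ compositions n ] (𝟙 (μ ⊢? n) * 𝟙 (xs ↭? μ))
      ≡⟨ ∑-cong (compositions n) (λ μ → 𝟙-× (μ ⊢? n) (xs ↭? μ)) ⟨
    ∑[ μ ∈ compositions n ] 𝟙 ((μ ⊢? n) ×-dec (xs ↭? μ))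
      ≡⟨ count≡∑ (λ μ → (μ ⊢? n) ×-dec (xs ↭? μ)) (compositions n) ⟨
    count (λ μ → (μ ⊢? n) ×-dec (xs ↭? μ)) (compositions n)
      ≡⟨ count-one (λ μ → (μ ⊢? n) ×-dec (xs ↭? μ)) (compositions-unique n) m (⊢n , p₀)
           (λ { ((_ , sorted , _) , q) → ≥-sorted-unique sorted (proj₁ (proj₂ ⊢n)) (↭-trans (↭-sym q) p₀) }) ⟩
    1 ∎

▷-length : ∀ {μ ν} r → μ ▷[ r ] ν → length μ + 1 ≡ length ν + r
▷-length {μ} {ν} r (j , any) with find any
... | bs , _ , refl , p = begin
  length μ + 1                          ≡⟨ cong (_+ 1) (trans (sym (↭-length p)) (List.length-++ bs)) ⟩
  r + length (removeAt ν j) + 1         ≡⟨ ℕ.+-assoc r _ 1 ⟩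
  r + (length (removeAt ν j) + 1)       ≡⟨ cong (_+_ r) (trans (ℕ.+-comm _ 1) (sym (List.length-removeAt′ ν j))) ⟩
  r + length ν                          ≡⟨ ℕ.+-comm r _ ⟩
  length ν + r                          ∎
  where open ≡-Reasoning

removeAt-↭ : ∀ (ν : List ℕ) j → ν ↭ lookup ν j ∷ removeAt ν j
removeAt-↭ (x ∷ ν) zero    = ↭-refl
removeAt-↭ (x ∷ ν) (suc j) = ↭-trans (↭-prep x (removeAt-↭ ν j)) (Perm.swap x (lookup ν j) ↭-refl)

▷-intro : ∀ {μ ν i o} → All (0 <_) μ → (i , o) ∈ splits μ → sum i ∷ o ↭ ν → μ ▷[ length i ] ν
▷-intro {μ} {ν} {i} {o} pos s∈ p = j , lose (subst (λ s → i ∈ compositions s) look (∈-compositions i i-pos))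
    (refl , ↭-trans (++⁺ˡ i (↭-sym o↭)) i++o)
  where
  i++o : i ++ o ↭ μ
  i++o = splits-++ {xs = μ} s∈
  i-pos : All (0 <_) i
  i-pos = All.++⁻ˡ i (All-resp (↭-sym i++o) pos)
  s∈ν : sum i ∈ ν
  s∈ν = ∈-resp-↭ p (here refl)
  j = Any.index s∈ν
  look : sum i ≡ lookup ν j
  look = Any.lookup-index s∈ν
  o↭ : o ↭ removeAt ν j
  o↭ = drop-∷ (↭-trans p (subst (λ s → ν ↭ s ∷ removeAt ν j) (sym look) (removeAt-↭ ν j)))

-- If merging gives ν, the number of merged parts is forced, and μ splits a part of ν into that
-- many; so at most one j contributes, with `κ μ ν` choices. Merging a single part changes nothing:
-- it contributes only when μ is ν, once for each part.
∑-splits-merge : ∀ {n} N μ ν → n ≤ N → μ ⊢ n →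
  ∑-splits (weight (_↭? ν)) μ ≡ 𝟙 (μ ↭? ν) * length ν + (∑[ j ∈ [1⋯ N ] ] (𝟙 (μ ▷[ 2 * j + 1 ]? ν) * κ μ ν))
∑-splits-merge {n} N μ ν n≤N (pos , _ , sumμ) = begin
  ∑-splits (weight (_↭? ν)) μ
    ≡⟨ ∑-cong∈ (splits μ) (λ {s} s∈ → point (proj₁ s) (proj₂ s) s∈) ⟩
  ∑-splits (λ i o → one i o + (∑[ j ∈ [1⋯ N ] ] (𝟙 (μ ▷[ 2 * j + 1 ]? ν) * kap i o))) μ
    ≡⟨ ∑-+ (splits μ) _ _ ⟩
  ∑-splits one μ + ∑-splits (λ i o → ∑[ j ∈ [1⋯ N ] ] (𝟙 (μ ▷[ 2 * j + 1 ]? ν) * kap i o)) μ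
    ≡⟨ cong₂ _+_ ones (trans (∑-swap (splits μ) [1⋯ N ] _) (∑-cong [1⋯ N ] λ j →
         trans (∑-*ˡ (𝟙 (μ ▷[ 2 * j + 1 ]? ν)) (splits μ) _) (cong (_*_ (𝟙 (μ ▷[ 2 * j + 1 ]? ν))) (sym (κ≡∑-splits μ ν))))) ⟩
  𝟙 (μ ↭? ν) * length ν + (∑[ j ∈ [1⋯ N ] ] (𝟙 (μ ▷[ 2 * j + 1 ]? ν) * κ μ ν)) ∎
  where
  open ≡-Reasoning
  e = length μ ∸ length ν + 1
  one kap : List ℕ → List ℕ → ℕ
  one i o = 𝟙 ((length i ℕ.≟ 1) ×-dec (sum i ∷ o ↭? ν))
  kap i o = 𝟙 ((length i ℕ.≟ e) ×-dec (sum i ∷ o ↭? ν))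
  length≤ : ∀ {xs} → All (0 <_) xs → length xs ≤ sum xs
  length≤ []       = z≤n
  length≤ (p ∷ ps) = ℕ.+-mono-≤ p (length≤ ps)
  point : ∀ i o → (i , o) ∈ splits μ → weight (_↭? ν) i o ≡ one i o + (∑[ j ∈ [1⋯ N ] ] (𝟙 (μ ▷[ 2 * j + 1 ]? ν) * kap i o))
  point i o s∈ = begin
    𝟙 (odd? t ×-dec M?)                                                        ≡⟨ 𝟙-× (odd? t) M? ⟩
    𝟙 (odd? t) * 𝟙 M?                                                          ≡⟨ cong (_* 𝟙 M?) (𝟙-odd t≤N) ⟩
    (𝟙 (t ℕ.≟ 1) + (∑[ j ∈ [1⋯ N ] ] 𝟙 (t ℕ.≟ 2 * j + 1))) * 𝟙 M?              ≡⟨ ℕ.*-distribʳ-+ (𝟙 M?) (𝟙 (t ℕ.≟ 1)) _ ⟩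
    𝟙 (t ℕ.≟ 1) * 𝟙 M? + (∑[ j ∈ [1⋯ N ] ] 𝟙 (t ℕ.≟ 2 * j + 1)) * 𝟙 M?         ≡⟨ cong₂ _+_ (sym (𝟙-× (t ℕ.≟ 1) M?)) (sym (∑-*ʳ (𝟙 M?) [1⋯ N ] _)) ⟩
    one i o + (∑[ j ∈ [1⋯ N ] ] (𝟙 (t ℕ.≟ 2 * j + 1) * 𝟙 M?))                  ≡⟨ cong (_+_ (one i o)) (∑-cong [1⋯ N ] term) ⟩
    one i o + (∑[ j ∈ [1⋯ N ] ] (𝟙 (μ ▷[ 2 * j + 1 ]? ν) * kap i o))           ∎
    where
    t = length i
    M? = sum i ∷ o ↭? ν
    t≤N : t ≤ N
    t≤N = ℕ.≤-trans (ℕ.≤-trans (ℕ.m≤m+n t (length o)) (ℕ.≤-reflexive (splits-length {xs = μ} s∈)))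
      (ℕ.≤-trans (length≤ pos) (ℕ.≤-trans (ℕ.≤-reflexive sumμ) n≤N))
    ▷⇒e : ∀ j → μ ▷[ 2 * j + 1 ] ν → e ≡ 2 * j + 1
    ▷⇒e j d = trans (cong (λ x → x ∸ length ν + 1) (ℕ.+-cancelʳ-≡ 1 _ _ (trans (▷-length {μ} {ν} (2 * j + 1) d) (sym (ℕ.+-assoc (length ν) (2 * j) 1)))))
      (cong (_+ 1) (ℕ.m+n∸m≡n (length ν) (2 * j)))
    term : ∀ j → 𝟙 (t ℕ.≟ 2 * j + 1) * 𝟙 M? ≡ 𝟙 (μ ▷[ 2 * j + 1 ]? ν) * kap i o
    term j = trans (sym (𝟙-× (t ℕ.≟ 2 * j + 1) M?)) (trans
      (𝟙-cong (λ (eq , m) → let d = subst (λ r → μ ▷[ r ] ν) eq (▷-intro pos s∈ m) in d , trans eq (sym (▷⇒e j d)) , m)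
              (λ (d , eq , m) → trans eq (▷⇒e j d) , m) _ ((μ ▷[ 2 * j + 1 ]? ν) ×-dec ((t ℕ.≟ e) ×-dec M?)))
      (𝟙-× (μ ▷[ 2 * j + 1 ]? ν) ((t ℕ.≟ e) ×-dec M?)))
  single : ∀ {i o} → (i , o) ∈ splits μ → length i ≡ 1 → sum i ∷ o ↭ μ
  single {x ∷ []} {o} s∈ _ = subst (λ y → y ∷ o ↭ μ) (sym (ℕ.+-identityʳ x)) (splits-++ {xs = μ} s∈)
  ones : ∑-splits one μ ≡ 𝟙 (μ ↭? ν) * length ν
  ones = begin
    ∑-splits one μ
      ≡⟨ ∑-cong∈ (splits μ) (λ {s} s∈ → trans
           (𝟙-cong (λ (l , m) → ↭-trans (↭-sym (single s∈ l)) m , l) (λ (m , l) → l , ↭-trans (single s∈ l) m) _ ((μ ↭? ν) ×-dec (length (proj₁ s) ℕ.≟ 1)))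
           (𝟙-× (μ ↭? ν) (length (proj₁ s) ℕ.≟ 1))) ⟩
    ∑[ s ∈ splits μ ] (𝟙 (μ ↭? ν) * 𝟙 (length (proj₁ s) ℕ.≟ 1))
      ≡⟨ trans (∑-*ˡ (𝟙 (μ ↭? ν)) (splits μ) _) (cong (_*_ (𝟙 (μ ↭? ν))) (trans (∑-splits-lengthˡ 1 μ) (nC1≡n (length μ)))) ⟩
    𝟙 (μ ↭? ν) * length μ
      ≡⟨ same (μ ↭? ν) ⟩
    𝟙 (μ ↭? ν) * length ν ∎
    where
    same : (d : Dec (μ ↭ ν)) → 𝟙 d * length μ ≡ 𝟙 d * length ν
    same (yes p) = cong (1 *_) (↭-length p)
    same (no _)  = refl

-- Conjugacy

flip-cong : {π ρ : Permutation′ n} → π ≈ ρ → flip π ≈ flip ρ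
flip-cong {π = π} {ρ} h x = perm-injective π (trans (inverseʳ π) (sym (trans (h _) (inverseʳ ρ))))

least-return : (π : Permutation′ n) (a : Fin n) →
  ∃ λ L → 0 < L × iterate (π ⟨$⟩ʳ_) a L ≡ a × (∀ d → 0 < d → iterate (π ⟨$⟩ʳ_) a d ≡ a → L ≤ d)
least-return {n} π a with returns π a
... | d , nz , d≤n , ret with argmin {suc n} (λ j → (0 ℕ.<? toℕ j) ×-dec (iterate (π ⟨$⟩ʳ_) a (toℕ j) ≟ a)) toℕ
        {fromℕ< (s≤s d≤n)} (subst (λ m → 0 < m × iterate (π ⟨$⟩ʳ_) a m ≡ a) (sym (toℕ-fromℕ< (s≤s d≤n))) (ℕ.>-nonZero⁻¹ d {{nz}} , ret))
... | j , (0<j , retj) , least = toℕ j , 0<j , retj , smallest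
  where
  smallest : ∀ e → 0 < e → iterate (π ⟨$⟩ʳ_) a e ≡ a → toℕ j ≤ e
  smallest e 0<e rete with e ℕ.≤? n
  ... | no  e≰n = ℕ.≤-trans (ℕ.≤-pred (toℕ<n j)) (ℕ.<⇒≤ (ℕ.≰⇒> e≰n))
  ... | yes e≤n = subst (toℕ j ≤_) eq (least (fromℕ< (s≤s e≤n)) (subst (λ m → 0 < m × iterate (π ⟨$⟩ʳ_) a m ≡ a) (sym eq) (0<e , rete)))
    where eq = toℕ-fromℕ< (s≤s e≤n)

iterate-% : (f : A → A) {x : A} {L : ℕ} {{_ : NonZero L}} → iterate f x L ≡ x → ∀ m → iterate f x m ≡ iterate f x (m ℕ.% L)
iterate-% f {x} {L} ret m = trans (cong (iterate f x) (trans (ℕ.m≡m%n+[m/n]*n m L) (ℕ.+-comm (m ℕ.% L) _)))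
  (trans (iterate-+ f x ((m ℕ./ L) * L) (m ℕ.% L)) (cong (λ y → iterate f y (m ℕ.% L)) (iterate-* f ret (m ℕ./ L))))

module _ (π : Permutation′ n) (a : Fin n) where
  private
    f = π ⟨$⟩ʳ_
    L = proj₁ (least-return π a)
    0<L = proj₁ (proj₂ (least-return π a))
    ret = proj₁ (proj₂ (proj₂ (least-return π a)))
    least = proj₂ (proj₂ (proj₂ (least-return π a)))
    instance _ = ℕ.>-nonZero 0<L

    distinct : ∀ {u v} → u ≤ v → v < L → iterate f a u ≡ iterate f a v → u ≡ v
    distinct {u} {v} u≤v v<L eq with u ℕ.≟ v
    ... | yes e = e
    ... | no ne = contradiction (least (v ∸ u) (ℕ.m<n⇒0<n∸m (ℕ.≤∧≢⇒< u≤v ne)) (iterate-return π u≤v eq))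
      (ℕ.<⇒≱ (ℕ.≤-<-trans (ℕ.m∸n≤m v u) v<L))

    distinct′ : ∀ {u v} → u < L → v < L → iterate f a u ≡ iterate f a v → u ≡ v
    distinct′ {u} {v} u<L v<L eq with ℕ.≤-total u v
    ... | inj₁ u≤v = distinct u≤v v<L eq
    ... | inj₂ v≤u = sym (distinct v≤u u<L (sym eq))

    cycleLength≡L : cycleLength π a ≡ L
    cycleLength≡L = trans
      (count-match {setoid _} {setoid _} (allFin-unique n) (AllPairs.applyUpTo⁺₁ id L (λ i<j _ → ℕ.<⇒≢ i<j)) (sameCycle? π a) (λ u → u ℕ.<? L)
        (λ z u → iterate f a u ≡ z)
        (λ { _ (m , refl) → toℕ m ℕ.% L , ∈-upTo⁺ (ℕ.m%n<n (toℕ m) L) , ℕ.m%n<n (toℕ m) L , sym (iterate-% f ret (toℕ m)) })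
        (λ {u} _ u<L → iterate f a u , ∈-allFin _ , sameCycle⁺ π u refl , refl)
        (λ _ _ _ e e′ → trans (sym e) e′)
        (λ _ u<L v<L e e′ → distinct′ u<L v<L (trans e (sym e′))))
      (trans (cong length (filter-all (λ u → u ℕ.<? L) (All.tabulate ∈-upTo⁻))) (List.length-upTo L))

  iterate-cycleLength : iterate f a (cycleLength π a) ≡ a
  iterate-cycleLength = trans (cong (iterate f a) cycleLength≡L) ret

  return-multiple : ∀ d → iterate f a d ≡ a → ∃ λ q → d ≡ q * cycleLength π a
  return-multiple d retd = d ℕ./ L , trans (ℕ.m≡m%n+[m/n]*n d L)
      (trans (cong (_+ (d ℕ./ L) * L) (rem (d ℕ.% L) (ℕ.m%n<n d L) (trans (sym (iterate-% f ret d)) retd))) (cong (_*_ (d ℕ./ L)) (sym cycleLength≡L)))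
    where
    rem : ∀ r → r < L → iterate f a r ≡ a → r ≡ 0
    rem zero    _   _ = refl
    rem (suc r) r<L e = contradiction (least (suc r) z<s e) (ℕ.<⇒≱ r<L)

-- Exponents that lead to the same point differ by a multiple of the cycle length, which both cycles
-- share. This makes the passage from the m-th iterate of a to the m-th iterate of b well defined.
iterate-cycle-cong : (π ρ : Permutation′ n) {a b : Fin n} → cycleLength π a ≡ cycleLength ρ b → ∀ m m′ →
  iterate (π ⟨$⟩ʳ_) a m ≡ iterate (π ⟨$⟩ʳ_) a m′ → iterate (ρ ⟨$⟩ʳ_) b m ≡ iterate (ρ ⟨$⟩ʳ_) b m′
iterate-cycle-cong π ρ {a} {b} cl m m′ eq = [ (λ le → sym (ordered le eq)) , (λ le → ordered le (sym eq)) ]′ (ℕ.≤-total m m′)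
  where
  ordered : ∀ {m m′} → m ≤ m′ → iterate (π ⟨$⟩ʳ_) a m ≡ iterate (π ⟨$⟩ʳ_) a m′ → iterate (ρ ⟨$⟩ʳ_) b m′ ≡ iterate (ρ ⟨$⟩ʳ_) b m
  ordered {m} {m′} le eq = trans (cong (iterate (ρ ⟨$⟩ʳ_) b) (sym (ℕ.m∸n+n≡m le))) (trans (iterate-+ (ρ ⟨$⟩ʳ_) b (m′ ∸ m) m)
    (cong (λ y → iterate (ρ ⟨$⟩ʳ_) y m) (multiple (return-multiple π a (m′ ∸ m) (iterate-return π le eq)))))
    where
    multiple : ∀ {d} → ∃ (λ q → d ≡ q * cycleLength π a) → iterate (ρ ⟨$⟩ʳ_) b d ≡ b
    multiple (q , e) = trans (cong (iterate (ρ ⟨$⟩ʳ_) b) (trans e (cong (q *_) cl))) (iterate-* (ρ ⟨$⟩ʳ_) (iterate-cycleLength ρ b) q)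

-- Makes an equality of cycle types explicit, as a pairing of cycles of equal length.
pairing : {C : Set} {f : A → C} {g : B → C} (xs : List A) (ys : List B) → map f xs ↭ map g ys →
  ∃ λ (zs : List (A × B)) → map proj₁ zs ≡ xs × map proj₂ zs ↭ ys × All (λ (a , b) → f a ≡ g b) zs
pairing [] []      p = [] , refl , ↭-refl , []
pairing [] (y ∷ ys) p = contradiction (↭-length p) λ ()
pairing {f = f} {g} (x ∷ xs) ys p with ∈-map⁻ g (∈-resp-↭ p (here refl))
... | y , y∈ , e with ∈-∃++ y∈
... | as , bs , refl with pairing xs (as ++ bs) (drop-∷ (↭-trans p (↭-trans (map⁺ g (shift y as bs)) (↭-reflexive (cong (_∷ map g (as ++ bs)) (sym e))))))
... | zs , e₁ , p₂ , h = (x , y) ∷ zs , cong (x ∷_) e₁ , ↭-trans (↭-prep y p₂) (↭-sym (shift y as bs)) , e ∷ h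

∈-proj₁-unique : {zs : List (A × B)} → UniqueSetoid.Unique (setoid A) (map proj₁ zs) →
  ∀ {a b b′} → (a , b) ∈ zs → (a , b′) ∈ zs → b ≡ b′
∈-proj₁-unique u (here refl) (here refl) = refl
∈-proj₁-unique (ne ∷ _) (here refl) (there m) = contradiction refl (All.lookup ne (∈-map⁺ proj₁ m))
∈-proj₁-unique (ne ∷ _) (there m) (here refl) = contradiction refl (All.lookup ne (∈-map⁺ proj₁ m))
∈-proj₁-unique (_ ∷ u) (there m) (there m′) = ∈-proj₁-unique u m m′

∈-proj₂-unique : {zs : List (A × B)} → UniqueSetoid.Unique (setoid B) (map proj₂ zs) →
  ∀ {a a′ b} → (a , b) ∈ zs → (a′ , b) ∈ zs → a ≡ a′
∈-proj₂-unique u (here refl) (here refl) = refl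
∈-proj₂-unique (ne ∷ _) (here refl) (there m) = contradiction refl (All.lookup ne (∈-map⁺ proj₂ m))
∈-proj₂-unique (ne ∷ _) (there m) (here refl) = contradiction refl (All.lookup ne (∈-map⁺ proj₂ m))
∈-proj₂-unique (_ ∷ u) (there m) (there m′) = ∈-proj₂-unique u m m′

Conjugate : Permutation′ n → Permutation′ n → Set
Conjugate {n} π ρ = Σ[ g ∈ Permutation′ n ] (∀ x → g ⟨$⟩ʳ (π ⟨$⟩ʳ x) ≡ ρ ⟨$⟩ʳ (g ⟨$⟩ʳ x))

-- Cycles of equal length are paired through their least points a and b, and g sends the m-th
-- iterate of a under π to the m-th iterate of b under ρ.
cycleLengths⇒conjugate : (π ρ : Permutation′ n) → cycleLengths π ↭ cycleLengths ρ → Conjugate π ρ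
cycleLengths⇒conjugate {n} π ρ p = g , λ x → functional (g-spec _) (step (g-spec x))
  where
  mins : Permutation′ n → List (Fin n)
  mins π = filter (isCycleMin? π) (allFin n)
  paired = pairing (mins π) (mins ρ) p
  zs = proj₁ paired
  zs₁ : map proj₁ zs ≡ mins π
  zs₁ = proj₁ (proj₂ paired)
  zs₂ : map proj₂ zs ↭ mins ρ
  zs₂ = proj₁ (proj₂ (proj₂ paired))
  same : ∀ {a b} → (a , b) ∈ zs → cycleLength π a ≡ cycleLength ρ b
  same = All.lookup (proj₂ (proj₂ (proj₂ paired)))
  u₁ : UniqueSetoid.Unique (setoid (Fin n)) (map proj₁ zs)
  u₁ = subst (UniqueSetoid.Unique (setoid (Fin n))) (sym zs₁) (AllPairs.filter⁺ (isCycleMin? π) (allFin-unique n))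
  u₂ : UniqueSetoid.Unique (setoid (Fin n)) (map proj₂ zs)
  u₂ = AllPairs-resp-↭ (λ ne e → ne (sym e)) (↭-sym zs₂) (AllPairs.filter⁺ (isCycleMin? ρ) (allFin-unique n))
  min₁ : ∀ {a b} → (a , b) ∈ zs → IsCycleMin π a
  min₁ m = proj₂ (∈-filter⁻ (isCycleMin? π) {xs = allFin n} (subst (_ ∈_) zs₁ (∈-map⁺ proj₁ m)))
  min₂ : ∀ {a b} → (a , b) ∈ zs → IsCycleMin ρ b
  min₂ m = proj₂ (∈-filter⁻ (isCycleMin? ρ) {xs = allFin n} (∈-resp-↭ zs₂ (∈-map⁺ proj₂ m)))
  R : Fin n → Fin n → Set
  R x y = ∃ λ a → ∃ λ b → (a , b) ∈ zs × ∃ λ m → iterate (π ⟨$⟩ʳ_) a m ≡ x × iterate (ρ ⟨$⟩ʳ_) b m ≡ y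
  to : ∀ x → ∃ λ y → R x y
  to x with min-exists idₚ π x
  ... | a , minₐ , x~a with ∈-map⁻ proj₁ (subst (a ∈_) (sym zs₁) (∈-filter⁺ (isCycleMin? π) (∈-allFin a) minₐ)) | sc-sym π x~a
  ... | (.a , b) , m , refl | t , e = _ , a , b , m , toℕ t , e , refl
  from : ∀ y → ∃ λ x → R x y
  from y with min-exists idₚ ρ y
  ... | b , min_b , y~b with ∈-map⁻ proj₂ (∈-resp-↭ (↭-sym zs₂) (∈-filter⁺ (isCycleMin? ρ) (∈-allFin b) min_b)) | sc-sym ρ y~b
  ... | (a , .b) , m , refl | t , e = _ , a , b , m , toℕ t , refl , e
  functional : ∀ {x y y′} → R x y → R x y′ → y ≡ y′
  functional (a , b , z , m , refl , refl) (a′ , b′ , z′ , m′ , e , refl)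
    with min-unique idₚ π (min₁ z) (min₁ z′) (sc-trans π (sameCycle⁺ π m refl) (sc-sym π (sameCycle⁺ π m′ e)))
  ... | refl with ∈-proj₁-unique u₁ z z′
  ... | refl = iterate-cycle-cong π ρ (same z) m m′ (sym e)
  injective : ∀ {x x′ y} → R x y → R x′ y → x ≡ x′
  injective (a , b , z , m , refl , refl) (a′ , b′ , z′ , m′ , refl , e)
    with min-unique idₚ ρ (min₂ z) (min₂ z′) (sc-trans ρ (sameCycle⁺ ρ m refl) (sc-sym ρ (sameCycle⁺ ρ m′ e)))
  ... | refl with ∈-proj₂-unique u₂ z z′
  ... | refl = iterate-cycle-cong ρ π (sym (same z)) m m′ (sym e)
  built = permutation-of-relation R to from functional injective
  g = proj₁ built
  g-spec = proj₂ built
  step : ∀ {x y} → R x y → R (π ⟨$⟩ʳ x) (ρ ⟨$⟩ʳ y)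
  step (a , b , z , m , refl , refl) = a , b , z , suc m , iterate-suc (π ⟨$⟩ʳ_) a m , iterate-suc (ρ ⟨$⟩ʳ_) b m

fullCycle-type : (s t : Permutation′ n) → IsFullCycle s → IsFullCycle t → cycleLengths s ↭ cycleLengths t
fullCycle-type {n} s t fs ft = filter-match-↭ {setoid _} {setoid _} (allFin-unique n) (allFin-unique n) (isCycleMin? s) (isCycleMin? t)
  -- The relation that always holds: each side has at most one representative.
  (λ x y → x ≡ x)
  (λ {x} _ _ → let y , m , _ = min-exists idₚ t x in y , ∈-allFin y , m , refl)
  (λ {y} _ _ → let x , m , _ = min-exists idₚ s y in x , ∈-allFin x , m , refl)
  (λ m m′ _ _ _ → min-unique idₚ s m m′ (fs _ _)) (λ _ m m′ _ _ → min-unique idₚ t m m′ (ft _ _))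
  (λ {x} {y} _ _ _ → cycleLength-match s t idₚ (λ z _ → ft y z) (λ z _ → fs x z))

rot-full : ∀ n → IsFullCycle (rot n)
rot-full (suc n) i j = sc-trans (rot (suc n)) (sc-sym (rot (suc n)) (reach i)) (reach j)
  where
  steps : ∀ m → m < suc n → toℕ (iterate (rot (suc n) ⟨$⟩ʳ_) zero m) ≡ m
  steps zero    _   = refl
  steps (suc m) m< with steps m (ℕ.<⇒≤ m<) | proj₂ (rotation (suc n)) (iterate (rot (suc n) ⟨$⟩ʳ_) zero m)
  ... | ih | inj₁ e = trans (cong toℕ (iterate-suc (rot (suc n) ⟨$⟩ʳ_) zero m)) (trans e (cong suc ih))
  ... | ih | inj₂ (l , _) = contradiction (trans (cong suc (sym ih)) l) (ℕ.<⇒≢ m<)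
  reach : ∀ j → SameCycle (rot (suc n)) zero j
  reach j = j , toℕ-injective (steps (toℕ j) (toℕ<n j))

∑-perm-reindex : (f : Permutation′ n → Permutation′ n) →
  (∀ {π ρ} → f π ≈ f ρ → π ≈ ρ) → (∀ {π ρ} → π ≈ ρ → f π ≈ f ρ) → (∀ ρ → ∃ λ π → f π ≈ ρ) →
  (F : Permutation′ n → ℕ) → (∀ {π ρ} → π ≈ ρ → F π ≡ F ρ) →
  ∑[ π ∈ permutations n ] (F (f π)) ≡ ∑[ π ∈ permutations n ] (F π)
∑-perm-reindex {n} f inj cong-f surj F resp = sum-↭ (match-↭ {R = λ π ρ → f π ≈ ρ} to from
  (AllPairs.map (λ ne y e e′ → ne (inj (λ x → trans (e x) (sym (e′ x))))) (permutations-unique n))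
  (AllPairs.map (λ ne y e e′ → ne (λ x → trans (sym (e x)) (e′ x))) (permutations-unique n)) resp)
  where
  to : ∀ {π} → π ∈ permutations n → ∃ λ ρ → ρ ∈ permutations n × f π ≈ ρ
  to {π} _ = let ρ , ρ∈ , e = permutations-complete (f π) in ρ , ρ∈ , λ x → sym (e x)
  from : ∀ {ρ} → ρ ∈ permutations n → ∃ λ π → π ∈ permutations n × f π ≈ ρ
  from {ρ} _ = let π , e = surj ρ ; π′ , π∈ , e′ = permutations-complete π in π′ , π∈ , λ x → trans (cong-f e′ x) (e x)

conj : Permutation′ n → Permutation′ n → Permutation′ n
conj g π = flip g ∘ₚ π ∘ₚ g

∑-conj : (g : Permutation′ n) (F : Permutation′ n → ℕ) → (∀ {π ρ} → π ≈ ρ → F π ≡ F ρ) →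
  ∑[ π ∈ permutations n ] (F (conj g π)) ≡ ∑[ π ∈ permutations n ] (F π)
∑-conj g = ∑-perm-reindex (conj g)
  (λ {π} {ρ} e x → perm-injective g (subst₂ _≡_ (cong (λ y → g ⟨$⟩ʳ (π ⟨$⟩ʳ y)) (inverseˡ g)) (cong (λ y → g ⟨$⟩ʳ (ρ ⟨$⟩ʳ y)) (inverseˡ g)) (e (g ⟨$⟩ʳ x))))
  (λ e x → cong (g ⟨$⟩ʳ_) (e _))
  (λ ρ → conj (flip g) ρ , λ x → trans (inverseʳ g) (cong (ρ ⟨$⟩ʳ_) (inverseʳ g)))

conj-hom : (g π : Permutation′ n) (x : Fin n) → g ⟨$⟩ʳ (π ⟨$⟩ʳ x) ≡ conj g π ⟨$⟩ʳ (g ⟨$⟩ʳ x)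
conj-hom g π x = cong (λ y → g ⟨$⟩ʳ (π ⟨$⟩ʳ y)) (sym (inverseˡ g))

-- The numbers of cycles of s D⁻¹ and of its conjugate D⁻¹ s agree.
#cyclesOf : Permutation′ n → Permutation′ n → ℕ
#cyclesOf s D = #cycles (flip D ∘ₚ s)

#cycles-↭ : (π ρ : Permutation′ n) → cycleLengths π ↭ cycleLengths ρ → #cycles π ≡ #cycles ρ
#cycles-↭ π ρ = ↭-length

#cyclesOf-conj : (g : Permutation′ n) {s t D E : Permutation′ n} →
  (∀ x → g ⟨$⟩ʳ (s ⟨$⟩ʳ x) ≡ t ⟨$⟩ʳ (g ⟨$⟩ʳ x)) → (∀ x → g ⟨$⟩ʳ (D ⟨$⟩ʳ x) ≡ E ⟨$⟩ʳ (g ⟨$⟩ʳ x)) →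
  #cyclesOf s D ≡ #cyclesOf t E
#cyclesOf-conj g {s} {t} {D} {E} hs hD = #cycles-↭ (flip D ∘ₚ s) (flip E ∘ₚ t) (cycleLengths-conj (flip D ∘ₚ s) (flip E ∘ₚ t) g (λ x →
  trans (hs (D ⟨$⟩ˡ x)) (cong (t ⟨$⟩ʳ_) (perm-injective E (trans (sym (hD _)) (trans (cong (g ⟨$⟩ʳ_) (inverseʳ D)) (sym (inverseʳ E))))))))

#cyclesOf-cong : {s t D E : Permutation′ n} → s ≈ t → D ≈ E → #cyclesOf s D ≡ #cyclesOf t E
#cyclesOf-cong {s = s} {t} {D} {E} e e′ = #cyclesOf-conj idₚ {s} {t} {D} {E} e e′

-- The count complementary to `p`: here s is fixed and D varies over a type, whereas `p` fixes D and
-- lets s vary.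
#diagonals : Permutation′ n → ℕ → List ℕ → ℕ
#diagonals {n} s k ν = ∑[ D ∈ permutations n ] (𝟙 (cycleLengths D ↭? ν) * 𝟙 (#cyclesOf s D ℕ.≟ k))

𝟙-type : (π ρ : Permutation′ n) → cycleLengths π ↭ cycleLengths ρ → ∀ ν → 𝟙 (cycleLengths π ↭? ν) ≡ 𝟙 (cycleLengths ρ ↭? ν)
𝟙-type π ρ e ν = 𝟙-cong (↭-trans (↭-sym e)) (↭-trans e) (cycleLengths π ↭? ν) (cycleLengths ρ ↭? ν)

#diagonals-conj : (s t : Permutation′ n) → Conjugate s t → ∀ k ν → #diagonals s k ν ≡ #diagonals t k ν
#diagonals-conj {n} s t (g , hom) k ν = trans (∑-cong (permutations n) step) (∑-conj g (λ D → 𝟙 (cycleLengths D ↭? ν) * 𝟙 (#cyclesOf t D ℕ.≟ k))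
    (λ {π} {ρ} e → cong₂ _*_ (𝟙-type π ρ (cycleLengths-cong π ρ e) ν) (cong (λ c → 𝟙 (c ℕ.≟ k)) (#cyclesOf-cong {s = t} {t} {π} {ρ} (λ _ → refl) e))))
  where
  step : ∀ D → 𝟙 (cycleLengths D ↭? ν) * 𝟙 (#cyclesOf s D ℕ.≟ k) ≡ 𝟙 (cycleLengths (conj g D) ↭? ν) * 𝟙 (#cyclesOf t (conj g D) ℕ.≟ k)
  step D = cong₂ _*_ (𝟙-type D (conj g D) (cycleLengths-conj D (conj g D) g (conj-hom g D)) ν)
    (cong (λ c → 𝟙 (c ℕ.≟ k)) (#cyclesOf-conj g {s} {t} {D} {conj g D} hom (conj-hom g D)))

-- For given s and D, the only π with s π⁻¹ = D is D⁻¹ s.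
p≡∑ : (k : ℕ) (D : Permutation′ n) → p k D ≡ ∑[ s ∈ permutations n ] (𝟙 (isFullCycle? s) * 𝟙 (#cyclesOf s D ℕ.≟ k))
p≡∑ {n} k D = begin
  p k D
    ≡⟨ count≡∑ P? (planePermutations n) ⟩
  ∑[ x ∈ planePermutations n ] 𝟙 (P? x)
    ≡⟨ ∑-filter (λ x → isFullCycle? (proj₁ x)) (cartesianProduct (permutations n) (permutations n)) (λ x → 𝟙 (P? x)) ⟩
  ∑[ x ∈ cartesianProduct (permutations n) (permutations n) ] (𝟙 (isFullCycle? (proj₁ x)) * 𝟙 (P? x))
    ≡⟨ ∑-cartesianProduct (permutations n) (permutations n) (λ x → 𝟙 (isFullCycle? (proj₁ x)) * 𝟙 (P? x)) ⟩
  ∑[ s ∈ permutations n ] (∑[ π ∈ permutations n ] (𝟙 (isFullCycle? s) * 𝟙 (P? (s , π))))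
    ≡⟨ ∑-cong (permutations n) (λ s → trans (∑-*ˡ (𝟙 (isFullCycle? s)) (permutations n) _) (cong (𝟙 (isFullCycle? s) *_)
         (trans (sym (count≡∑ (λ π → P? (s , π)) (permutations n))) (one s (#cyclesOf s D ℕ.≟ k))))) ⟩
  ∑[ s ∈ permutations n ] (𝟙 (isFullCycle? s) * 𝟙 (#cyclesOf s D ℕ.≟ k)) ∎
  where
  open ≡-Reasoning
  P? : (x : Permutation′ n × Permutation′ n) → Dec (diagonal x ≈ D × #cycles (proj₂ x) ≡ k)
  P? (s , π) = (diagonal (s , π) ≈? D) ×-dec (#cycles π ℕ.≟ k)
  solve : ∀ s {π} → diagonal (s , π) ≈ D → π ≈ s ∘ₚ flip D
  solve s {π} e x = perm-injective D (trans (trans (sym (e (π ⟨$⟩ʳ x))) (cong (s ⟨$⟩ʳ_) (inverseˡ π))) (sym (inverseʳ D)))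
  #≡ : ∀ s {π} → π ≈ s ∘ₚ flip D → #cycles π ≡ #cyclesOf s D
  #≡ s {π} e = trans (#cycles-↭ π (s ∘ₚ flip D) (cycleLengths-cong π (s ∘ₚ flip D) e))
    (sym (#cycles-↭ (flip D ∘ₚ s) (s ∘ₚ flip D) (cycleLengths-conj (flip D ∘ₚ s) (s ∘ₚ flip D) (flip D) (λ _ → refl))))
  one : ∀ s (d : Dec (#cyclesOf s D ≡ k)) → count (λ π → P? (s , π)) (permutations n) ≡ 𝟙 d
  one s (no ne) = count-none (λ π → P? (s , π)) (permutations n) (λ π (e , c) → ne (trans (sym (#≡ s {π} (solve s {π} e))) c))
  one s (yes c) = let π , π∈ , e = permutations-complete (s ∘ₚ flip D) in
    count-match {permSetoid n} {setoid (Fin 1)} (permutations-unique n) (allFin-unique 1) (λ π → P? (s , π)) (λ z → yes (refl {x = z})) (λ π z → z ≡ z)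
      (λ _ _ → zero , here refl , refl , refl)
      (λ _ _ → π , π∈ , ((λ x → trans (sym (inverseʳ D)) (cong (D ⟨$⟩ʳ_) (trans (sym (e (π ⟨$⟩ˡ x))) (inverseʳ π)))) , trans (#≡ s {π} e) c) , refl)
      (λ {π} {π′} (e₁ , _) (e₂ , _) _ _ _ x → trans (solve s {π} e₁ x) (sym (solve s {π′} e₂ x)))
      (λ { {y = zero} {zero} _ _ _ _ _ → refl })

p-conj : (k : ℕ) (D E : Permutation′ n) → Conjugate D E → p k D ≡ p k E
p-conj {n} k D E (g , hom) = trans (p≡∑ k D) (trans (trans (∑-cong (permutations n) step)
    (∑-conj g (λ s → 𝟙 (isFullCycle? s) * 𝟙 (#cyclesOf s E ℕ.≟ k))
      (λ {π} {ρ} e → cong₂ _*_ (𝟙-cong (full-cong {π} {ρ} e) (full-cong {ρ} {π} (λ x → sym (e x))) (isFullCycle? π) (isFullCycle? ρ))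
         (cong (λ c → 𝟙 (c ℕ.≟ k)) (#cyclesOf-cong {s = π} {ρ} {E} {E} e (λ _ → refl)))))) (sym (p≡∑ k E)))
  where
  full-map : ∀ {s t : Permutation′ n} (g : Permutation′ n) → (∀ x → g ⟨$⟩ʳ (s ⟨$⟩ʳ x) ≡ t ⟨$⟩ʳ (g ⟨$⟩ʳ x)) → IsFullCycle s → IsFullCycle t
  full-map {s} {t} g h full i j = subst₂ (SameCycle t) (inverseʳ g) (inverseʳ g) (sc-map s t (g ⟨$⟩ʳ_) h (full (g ⟨$⟩ˡ i) (g ⟨$⟩ˡ j)))
  full-cong : ∀ {s t : Permutation′ n} → s ≈ t → IsFullCycle s → IsFullCycle t
  full-cong {s} {t} e = full-map {s} {t} idₚ e
  unconj : ∀ s x → flip g ⟨$⟩ʳ (conj g s ⟨$⟩ʳ x) ≡ s ⟨$⟩ʳ (flip g ⟨$⟩ʳ x)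
  unconj s x = inverseˡ g
  step : ∀ s → 𝟙 (isFullCycle? s) * 𝟙 (#cyclesOf s D ℕ.≟ k) ≡ 𝟙 (isFullCycle? (conj g s)) * 𝟙 (#cyclesOf (conj g s) E ℕ.≟ k)
  step s = cong₂ _*_ (𝟙-cong (full-map {s} {conj g s} g (conj-hom g s)) (full-map {conj g s} {s} (flip g) (unconj s)) (isFullCycle? s) (isFullCycle? (conj g s)))
    (cong (λ c → 𝟙 (c ℕ.≟ k)) (#cyclesOf-conj g {s} {conj g s} {D} {E} (conj-hom g s) hom))

p-type : (k : ℕ) (D E : Permutation′ n) → cycleLengths D ↭ cycleLengths E → p k D ≡ p k E
p-type k D E e = p-conj k D E (cycleLengths⇒conjugate D E e)

#fullCycles : ℕ → ℕ
#fullCycles n = ∑[ s ∈ permutations n ] 𝟙 (isFullCycle? s)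

-- Double counting of the pairs of an n-cycle s and a permutation E of type ν such that s E⁻¹ has k
-- cycles. All E of one type contribute equally, and so do all n-cycles s, being conjugate to
-- `rot n`.
pq≡#diagonals : (k : ℕ) (ν : List ℕ) (D : Permutation′ n) → HasCycleType ν D → p k D * q n ν ≡ #fullCycles n * #diagonals (rot n) k ν
pq≡#diagonals {n} k ν D D↭ν = begin
  p k D * q n ν
    ≡⟨ cong (p k D *_) (count≡∑ (λ E → cycleLengths E ↭? ν) (permutations n)) ⟩
  p k D * (∑[ E ∈ permutations n ] 𝟙 (cycleLengths E ↭? ν))
    ≡⟨ ∑-*ˡ (p k D) (permutations n) _ ⟨
  ∑[ E ∈ permutations n ] (p k D * 𝟙 (cycleLengths E ↭? ν))
    ≡⟨ ∑-cong (permutations n) (λ E → trans (ℕ.*-comm (p k D) _) (same E (cycleLengths E ↭? ν))) ⟩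
  ∑[ E ∈ permutations n ] (𝟙 (cycleLengths E ↭? ν) * (∑[ s ∈ permutations n ] (𝟙 (isFullCycle? s) * 𝟙 (#cyclesOf s E ℕ.≟ k))))
    ≡⟨ ∑-cong (permutations n) (λ E → trans (sym (∑-*ˡ (𝟙 (cycleLengths E ↭? ν)) (permutations n) _))
         (∑-cong (permutations n) (λ s → swap* (𝟙 (cycleLengths E ↭? ν)) (𝟙 (isFullCycle? s)) _))) ⟩
  ∑[ E ∈ permutations n ] (∑[ s ∈ permutations n ] (𝟙 (isFullCycle? s) * (𝟙 (cycleLengths E ↭? ν) * 𝟙 (#cyclesOf s E ℕ.≟ k))))
    ≡⟨ ∑-swap (permutations n) (permutations n) _ ⟩
  ∑[ s ∈ permutations n ] (∑[ E ∈ permutations n ] (𝟙 (isFullCycle? s) * (𝟙 (cycleLengths E ↭? ν) * 𝟙 (#cyclesOf s E ℕ.≟ k))))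
    ≡⟨ ∑-cong (permutations n) (λ s → trans (∑-*ˡ (𝟙 (isFullCycle? s)) (permutations n) _) (full s (isFullCycle? s))) ⟩
  ∑[ s ∈ permutations n ] (𝟙 (isFullCycle? s) * #diagonals (rot n) k ν)
    ≡⟨ ∑-*ʳ (#diagonals (rot n) k ν) (permutations n) _ ⟩
  #fullCycles n * #diagonals (rot n) k ν ∎
  where
  open ≡-Reasoning
  swap* : ∀ a b c → a * (b * c) ≡ b * (a * c)
  swap* a b c = trans (sym (ℕ.*-assoc a b c)) (trans (cong (_* c) (ℕ.*-comm a b)) (ℕ.*-assoc b a c))
  same : ∀ E (d : Dec (cycleLengths E ↭ ν)) → 𝟙 d * p k D ≡ 𝟙 d * (∑[ s ∈ permutations n ] (𝟙 (isFullCycle? s) * 𝟙 (#cyclesOf s E ℕ.≟ k)))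
  same E (yes e) = cong (1 *_) (trans (p-type k D E (↭-trans D↭ν (↭-sym e))) (p≡∑ k E))
  same E (no _)  = refl
  full : ∀ s (d : Dec (IsFullCycle s)) → 𝟙 d * #diagonals s k ν ≡ 𝟙 d * #diagonals (rot n) k ν
  full s (yes f) = cong (1 *_) (#diagonals-conj s (rot n) (cycleLengths⇒conjugate s (rot n) (fullCycle-type s (rot n) f (rot-full n))) k ν)
  full s (no _)  = refl

-- The two sums over anti-exceedances

module _ {n : ℕ} (D : Permutation′ n) (Q : List ℕ → Set) (Q? : ∀ μ → Dec (Q μ)) (Q-resp : ∀ {μ ν} → μ ↭ ν → Q μ → Q ν) where
  private
    module MC = MarkCount D Q Q? Q-resp

  mergeable-splits : ∀ pos → ∑[ U ∈ subsets n ] 𝟙 (MC.mergeable? (pos , U)) ≡ ∑-splits (weight Q?) (cycleLengths (flip D ∘ₚ succ pos))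
  mergeable-splits pos = trans (∑-cong (subsets n) (λ U → point U (stable? a U))) (∑-stable a (weight Q?))
    where
    a = flip D ∘ₚ succ pos
    cl = cycleLength a
    point : ∀ U (d : Dec (Stable a U)) → 𝟙 (MC.mergeable? (pos , U)) ≡ 𝟙 d * weight Q? (map cl (inside a U)) (map cl (outside a U))
    point U (no ¬st) = 𝟙-no (MC.mergeable? (pos , U)) (λ M → ¬st (MC.Mergeable.stable M))
    point U (yes st) = trans (𝟙-cong
        (λ M → subst Odd (sym len) (MC.Mergeable.odd M) , subst (λ t → Q (t ∷ map cl (outside a U))) (sym (∑-inside a st)) (MC.Mergeable.mergesTo M))
        (λ (o , q) → MC.mergeable st (subst Odd len o) (subst (λ t → Q (t ∷ map cl (outside a U))) (∑-inside a st) q))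
        (MC.mergeable? (pos , U)) (odd? (length (map cl (inside a U))) ×-dec Q? (sum (map cl (inside a U)) ∷ map cl (outside a U))))
      (sym (ℕ.*-identityˡ _))
      where len = length-map cl (inside a U)

antiExceedances : Permutation′ n → Permutation′ n → ℕ
antiExceedances {n} pos π = ∑[ i ∈ allFin n ] 𝟙 ((pos ⟨$⟩ʳ (π ⟨$⟩ʳ i)) Fin.≤? (pos ⟨$⟩ʳ i))

∑-antiExceedances : (D : Permutation′ n) {Q : List ℕ → Set} (Q? : ∀ μ → Dec (Q μ)) → (∀ {μ ν} → μ ↭ ν → Q μ → Q ν) →
  ∑[ pos ∈ permutations n ] (𝟙 (Q? (cycleLengths (flip D ∘ₚ succ pos))) * antiExceedances pos (flip D ∘ₚ succ pos))
    ≡ ∑[ pos ∈ permutations n ] (∑-splits (weight Q?) (cycleLengths (flip D ∘ₚ succ pos)))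
∑-antiExceedances {n} D {Q} Q? Q-resp = trans (∑-cong (permutations n) point)
  (trans MC.antiExceedance≡mergeable (∑-cong (permutations n) (mergeable-splits D Q Q? Q-resp)))
  where
  module MC = MarkCount D Q Q? Q-resp
  point : ∀ pos → 𝟙 (Q? (cycleLengths (flip D ∘ₚ succ pos))) * antiExceedances pos (flip D ∘ₚ succ pos)
    ≡ ∑[ i ∈ allFin n ] 𝟙 (MC.antiExceedance? (pos , i))
  point pos = trans (sym (∑-*ˡ (𝟙 (Q? (cycleLengths (flip D ∘ₚ succ pos)))) (allFin n) _)) (∑-cong (allFin n) λ i →
    let le? = (pos ⟨$⟩ʳ ((flip D ∘ₚ succ pos) ⟨$⟩ʳ i)) Fin.≤? (pos ⟨$⟩ʳ i) in
    trans (sym (𝟙-× (Q? (cycleLengths (flip D ∘ₚ succ pos))) le?))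
      (𝟙-cong (λ (q , le) → le , q) (λ (le , q) → q , le) (Q? (cycleLengths (flip D ∘ₚ succ pos)) ×-dec le?) (MC.antiExceedance? (pos , i))))

∑-fin-reindex : (π : Permutation′ n) (F : Fin n → ℕ) → ∑[ i ∈ allFin n ] (F (π ⟨$⟩ʳ i)) ≡ ∑[ i ∈ allFin n ] (F i)
∑-fin-reindex {n} π F = sum-↭ (match-↭ {R = λ x y → π ⟨$⟩ʳ x ≡ y}
  (λ {x} _ → π ⟨$⟩ʳ x , ∈-allFin _ , refl) (λ {y} _ → π ⟨$⟩ˡ y , ∈-allFin _ , inverseʳ π)
  (AllPairs.map (λ ne y e e′ → ne (perm-injective π (trans e (sym e′)))) (allFin-unique n))
  (AllPairs.map (λ ne x e e′ → ne (trans (sym e) e′)) (allFin-unique n)) (λ { refl → refl }))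

-- Put i = D y in the first sum: s y ≼ D y is the negation of D y ≼ y unless
-- y is in the last position, where both hold.
antiExceedances-sum : 1 ≤ n → (pos D : Permutation′ n) →
  antiExceedances pos (flip D ∘ₚ succ pos) + antiExceedances pos D ≡ n + 1
antiExceedances-sum {n@(suc m)} _ pos D = begin
  antiExceedances pos (flip D ∘ₚ succ pos) + antiExceedances pos D
    ≡⟨ cong (_+ antiExceedances pos D) (trans (sym (∑-fin-reindex D (λ i → 𝟙 ((pos ⟨$⟩ʳ ((flip D ∘ₚ succ pos) ⟨$⟩ʳ i)) Fin.≤? (pos ⟨$⟩ʳ i))))) (∑-cong (allFin n) λ y →
         cong (λ z → 𝟙 ((pos ⟨$⟩ʳ (succ pos ⟨$⟩ʳ z)) Fin.≤? (pos ⟨$⟩ʳ (D ⟨$⟩ʳ y)))) (inverseˡ D))) ⟩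
  (∑[ y ∈ allFin n ] 𝟙 ((pos ⟨$⟩ʳ (succ pos ⟨$⟩ʳ y)) Fin.≤? (pos ⟨$⟩ʳ (D ⟨$⟩ʳ y)))) + antiExceedances pos D
    ≡⟨ ∑-+ (allFin n) (λ y → 𝟙 ((pos ⟨$⟩ʳ (succ pos ⟨$⟩ʳ y)) Fin.≤? (pos ⟨$⟩ʳ (D ⟨$⟩ʳ y)))) (λ y → 𝟙 ((pos ⟨$⟩ʳ (D ⟨$⟩ʳ y)) Fin.≤? (pos ⟨$⟩ʳ y))) ⟨
  ∑[ y ∈ allFin n ] (𝟙 ((pos ⟨$⟩ʳ (succ pos ⟨$⟩ʳ y)) Fin.≤? (pos ⟨$⟩ʳ (D ⟨$⟩ʳ y))) + 𝟙 ((pos ⟨$⟩ʳ (D ⟨$⟩ʳ y)) Fin.≤? (pos ⟨$⟩ʳ y)))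
    ≡⟨ ∑-cong (allFin n) (λ y → point y (succ-next pos y)) ⟩
  ∑[ y ∈ allFin n ] (1 + 𝟙 (last? y))
    ≡⟨ ∑-+ (allFin n) (λ _ → 1) (λ y → 𝟙 (last? y)) ⟩
  (∑[ _ ∈ allFin n ] 1) + (∑[ y ∈ allFin n ] 𝟙 (last? y))
    ≡⟨ cong₂ _+_ (trans (∑-const (allFin n) 1) (trans (ℕ.*-identityʳ _) (length-tabulate id))) (trans (sym (count≡∑ last? (allFin n)))
         (count-one last? (allFin-unique n) (∈-allFin end) at-end
           (λ e → perm-injective pos (toℕ-injective (ℕ.suc-injective (trans e (sym at-end))))))) ⟩
  n + 1 ∎
  where
  open ≡-Reasoning
  last? : (y : Fin n) → Dec (suc (toℕ (pos ⟨$⟩ʳ y)) ≡ n)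
  last? y = suc (toℕ (pos ⟨$⟩ʳ y)) ℕ.≟ n
  end = pos ⟨$⟩ˡ fromℕ m
  at-end : suc (toℕ (pos ⟨$⟩ʳ end)) ≡ n
  at-end = cong suc (trans (cong toℕ (inverseʳ pos)) (Fin.toℕ-fromℕ m))
  exclusive : ∀ {a b : Fin n} → (d : Dec (suc (toℕ b) ≤ toℕ a)) (e : Dec (toℕ a ≤ toℕ b)) → 𝟙 d + 𝟙 e ≡ 1
  exclusive (yes p) (yes q) = contradiction q (ℕ.<⇒≱ p)
  exclusive (yes p) (no _)  = refl
  exclusive (no _)  (yes q) = refl
  exclusive (no ¬p) (no ¬q) = contradiction (ℕ.≰⇒> ¬q) ¬p
  point : ∀ y → Next (pos ⟨$⟩ʳ y) (pos ⟨$⟩ʳ (succ pos ⟨$⟩ʳ y)) →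
    𝟙 ((pos ⟨$⟩ʳ (succ pos ⟨$⟩ʳ y)) Fin.≤? (pos ⟨$⟩ʳ (D ⟨$⟩ʳ y))) + 𝟙 ((pos ⟨$⟩ʳ (D ⟨$⟩ʳ y)) Fin.≤? (pos ⟨$⟩ʳ y)) ≡ 1 + 𝟙 (last? y)
  point y (inj₁ e) = trans (cong (_+ 𝟙 ((pos ⟨$⟩ʳ (D ⟨$⟩ʳ y)) Fin.≤? (pos ⟨$⟩ʳ y)))
      (𝟙-cong (subst (_≤ toℕ (pos ⟨$⟩ʳ (D ⟨$⟩ʳ y))) e) (subst (_≤ toℕ (pos ⟨$⟩ʳ (D ⟨$⟩ʳ y))) (sym e)) _ (suc (toℕ (pos ⟨$⟩ʳ y)) ℕ.≤? toℕ (pos ⟨$⟩ʳ (D ⟨$⟩ʳ y)))))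
    (trans (exclusive {pos ⟨$⟩ʳ (D ⟨$⟩ʳ y)} {pos ⟨$⟩ʳ y}
        (suc (toℕ (pos ⟨$⟩ʳ y)) ℕ.≤? toℕ (pos ⟨$⟩ʳ (D ⟨$⟩ʳ y))) ((pos ⟨$⟩ʳ (D ⟨$⟩ʳ y)) Fin.≤? (pos ⟨$⟩ʳ y)))
      (cong suc (sym (𝟙-no (last? y) (λ l → ℕ.<⇒≢ (toℕ<n (pos ⟨$⟩ʳ (succ pos ⟨$⟩ʳ y))) (trans e l))))))
  point y (inj₂ (l , z)) = trans (cong₂ _+_ (𝟙-yes ((pos ⟨$⟩ʳ (succ pos ⟨$⟩ʳ y)) Fin.≤? (pos ⟨$⟩ʳ (D ⟨$⟩ʳ y))) (subst (_≤ toℕ (pos ⟨$⟩ʳ (D ⟨$⟩ʳ y))) (sym z) z≤n))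
      (𝟙-yes ((pos ⟨$⟩ʳ (D ⟨$⟩ʳ y)) Fin.≤? (pos ⟨$⟩ʳ y)) (ℕ.≤-pred (subst (toℕ (pos ⟨$⟩ʳ (D ⟨$⟩ʳ y)) <_) (sym l) (toℕ<n _)))))
    (cong suc (sym (𝟙-yes (last? y) l)))

reversed : Permutation′ n → Permutation′ n
reversed pos = pos ∘ₚ reverse

opposite-next : {x y : Fin n} → Next x y → Next (Fin.opposite y) (Fin.opposite x)
opposite-next {n} {x} {y} (inj₁ e) = inj₁ (trans (Fin.opposite-prop x) (trans shift′ (cong suc (sym (Fin.opposite-prop y)))))
  where
  shift′ : n ∸ suc (toℕ x) ≡ suc (n ∸ suc (toℕ y))
  shift′ = trans (sym (ℕ.suc-pred (n ∸ suc (toℕ x)) {{ℕ.>-nonZero (ℕ.m<n⇒0<n∸m (subst (_< n) e (toℕ<n y)))}}))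
    (cong suc (trans (ℕ.pred[m∸n]≡m∸[1+n] n (suc (toℕ x))) (cong (λ z → n ∸ suc z) (sym e))))
opposite-next {n} {x} {y} (inj₂ (l , z)) = inj₂
  ( trans (cong suc (trans (Fin.opposite-prop y) (cong (λ w → n ∸ suc w) z))) (ℕ.suc-pred n {{ℕ.>-nonZero (ℕ.≤-<-trans z≤n (toℕ<n x))}})
  , trans (Fin.opposite-prop x) (trans (cong (n ∸_) l) (ℕ.n∸n≡0 n)))

succ-reversed : (pos : Permutation′ n) → succ (reversed pos) ≈ flip (succ pos)
succ-reversed {n} pos x = succ-unique (reversed pos) (opposite-next
  (subst (λ z → Next (pos ⟨$⟩ʳ (flip (succ pos) ⟨$⟩ʳ x)) (pos ⟨$⟩ʳ z)) (inverseʳ (succ pos)) (succ-next pos (flip (succ pos) ⟨$⟩ʳ x))))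

opposite-≤ : {x y : Fin n} → x Fin.≤ y → Fin.opposite y Fin.≤ Fin.opposite x
opposite-≤ {n} {x} {y} le = subst₂ _≤_ (sym (Fin.opposite-prop y)) (sym (Fin.opposite-prop x)) (ℕ.∸-monoʳ-≤ n (s≤s le))

opposite-≤⁻ : {x y : Fin n} → Fin.opposite y Fin.≤ Fin.opposite x → x Fin.≤ y
opposite-≤⁻ le = subst₂ Fin._≤_ (Fin.opposite-involutive _) (Fin.opposite-involutive _) (opposite-≤ le)

-- Reversing the word and inverting D each turn the inequality around: i = D j is an anti-exceedance
-- of D⁻¹ in the reversed word exactly when j is one of D in the original word.
antiExceedances-reversed : (pos D : Permutation′ n) → antiExceedances (reversed pos) (flip D) ≡ antiExceedances pos D
antiExceedances-reversed {n} pos D = trans (sym (∑-fin-reindex D (λ i → 𝟙 ((reversed pos ⟨$⟩ʳ (flip D ⟨$⟩ʳ i)) Fin.≤? (reversed pos ⟨$⟩ʳ i))))) (∑-cong (allFin n) λ j →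
  𝟙-cong (λ le → subst (λ z → pos ⟨$⟩ʳ (D ⟨$⟩ʳ j) Fin.≤ pos ⟨$⟩ʳ z) (inverseˡ D) (opposite-≤⁻ le))
         (λ le → opposite-≤ (subst (λ z → pos ⟨$⟩ʳ (D ⟨$⟩ʳ j) Fin.≤ pos ⟨$⟩ʳ z) (sym (inverseˡ D)) le))
         ((reversed pos ⟨$⟩ʳ (D ⟨$⟩ˡ (D ⟨$⟩ʳ j))) Fin.≤? (reversed pos ⟨$⟩ʳ (D ⟨$⟩ʳ j))) ((pos ⟨$⟩ʳ (D ⟨$⟩ʳ j)) Fin.≤? (pos ⟨$⟩ʳ j)))

antiExceedances-cong : {pos pos′ π π′ : Permutation′ n} → pos ≈ pos′ → π ≈ π′ → antiExceedances pos π ≡ antiExceedances pos′ π′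
antiExceedances-cong {n} {pos} {pos′} {π} {π′} e e′ = ∑-cong (allFin n) λ i →
  let eq₁ = trans (e (π ⟨$⟩ʳ i)) (cong (pos′ ⟨$⟩ʳ_) (e′ i)) ; eq₂ = e i in
  cong₂ (λ a b → 𝟙 (a Fin.≤? b)) eq₁ eq₂

succ-cong : {pos pos′ : Permutation′ n} → pos ≈ pos′ → succ pos ≈ succ pos′
succ-cong {pos = pos} {pos′} e x = succ-unique pos (subst₂ Next (sym (e x)) (sym (e _)) (succ-next pos′ x))

-- The recursion summed over all words and all diagonals

module Totals (n k′ : ℕ) (ν : List ℕ) where

  private
    G = permutations n
    k = suc k′

    ofType : Permutation′ n → ℕ
    ofType D = 𝟙 (cycleLengths D ↭? ν)

    withCycles : ℕ → Permutation′ n → Permutation′ n → ℕ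
    withCycles j pos D = 𝟙 (#cyclesOf (succ pos) D ℕ.≟ j)

    ofType-cong : ∀ {D E} → cycleLengths D ↭ cycleLengths E → ofType D ≡ ofType E
    ofType-cong {D} {E} e = 𝟙-type D E e ν

  ∑∑ : (Permutation′ n → Permutation′ n → ℕ) → ℕ
  ∑∑ F = ∑[ pos ∈ G ] (∑[ D ∈ G ] (F pos D))

  ∑∑-cong : ∀ {F H} → (∀ pos D → F pos D ≡ H pos D) → ∑∑ F ≡ ∑∑ H
  ∑∑-cong h = ∑-cong G (λ pos → ∑-cong G (h pos))

  ∑∑-+ : ∀ F H → ∑∑ (λ pos D → F pos D + H pos D) ≡ ∑∑ F + ∑∑ H
  ∑∑-+ F H = trans (∑-cong G (λ pos → ∑-+ G (F pos) (H pos))) (∑-+ G _ _)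

  ∑∑-* : ∀ c F → ∑∑ (λ pos D → c * F pos D) ≡ c * ∑∑ F
  ∑∑-* c F = trans (∑-cong G (λ pos → ∑-*ˡ c G (F pos))) (∑-*ˡ c G _)

  ∑∑-∑ : (xs : List A) (F : A → Permutation′ n → Permutation′ n → ℕ) →
    ∑∑ (λ pos D → ∑[ x ∈ xs ] (F x pos D)) ≡ ∑[ x ∈ xs ] (∑∑ (F x))
  ∑∑-∑ xs F = trans (∑-cong G (λ pos → ∑-swap G xs (λ D x → F x pos D))) (∑-swap G xs (λ pos x → ∑[ D ∈ G ] (F x pos D)))

  -- A word and a permutation D stand for a triple s, α, D with s = α D, where s is cut open to a
  -- word.
  triples : ℕ → List ℕ → ℕ
  triples j μ = ∑∑ (λ pos D → 𝟙 (cycleLengths D ↭? μ) * withCycles j pos D)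

  triples≡#diagonals : ∀ j μ → triples j μ ≡ length G * #diagonals (rot n) j μ
  triples≡#diagonals j μ = trans (∑-cong G (λ pos → #diagonals-conj (succ pos) (rot n) (pos , λ x → inverseʳ pos) j μ)) (∑-const G _)

  private
    *-swap : ∀ a b c → a * (b * c) ≡ b * (a * c)
    *-swap a b c = trans (sym (ℕ.*-assoc a b c)) (trans (cong (_* c) (ℕ.*-comm a b)) (ℕ.*-assoc b a c))

  -- D is held fixed here. The condition on the merged type is only that it has k parts, so the type
  -- of α enters through its number of cycles alone.
  gluing-vertices : ∀ N → n ≤ N →
    ∑∑ (λ pos D → (ofType D * withCycles k pos D) * antiExceedances pos (flip D ∘ₚ succ pos))
      ≡ k * triples k ν + (∑[ i ∈ [1⋯ N ] ] (((k + 2 * i) C k′) * triples (k + 2 * i) ν))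
  gluing-vertices N n≤N = begin
    ∑∑ (λ pos D → (ofType D * withCycles k pos D) * antiExceedances pos (flip D ∘ₚ succ pos))
      ≡⟨ ∑-swap G G _ ⟩
    ∑[ D ∈ G ] (∑[ pos ∈ G ] ((ofType D * withCycles k pos D) * antiExceedances pos (flip D ∘ₚ succ pos)))
      ≡⟨ ∑-cong G (λ D → trans (∑-cong G (λ pos → ℕ.*-assoc (ofType D) _ _)) (trans (∑-*ˡ (ofType D) G _)
           (trans (cong (ofType D *_) (∑-antiExceedances D (λ ξ → length ξ ℕ.≟ k) (λ p e → trans (sym (↭-length p)) e))) (sym (∑-*ˡ (ofType D) G _))))) ⟩
    ∑[ D ∈ G ] (∑[ pos ∈ G ] (ofType D * ∑-splits (weight (λ ξ → length ξ ℕ.≟ k)) (cycleLengths (flip D ∘ₚ succ pos))))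
      ≡⟨ ∑-swap G G _ ⟩
    ∑∑ (λ pos D → ofType D * ∑-splits (weight (λ ξ → length ξ ℕ.≟ k)) (cycleLengths (flip D ∘ₚ succ pos)))
      ≡⟨ ∑∑-cong (λ pos D → trans (cong (ofType D *_) (∑-splits-length k′ N (cycleLengths (flip D ∘ₚ succ pos)) (#≤N (flip D ∘ₚ succ pos))))
           (distribute (ofType D) (withCycles k pos D) (λ i → withCycles (k + 2 * i) pos D))) ⟩
    ∑∑ (λ pos D → k * (ofType D * withCycles k pos D) + (∑[ i ∈ [1⋯ N ] ] (((k + 2 * i) C k′) * (ofType D * withCycles (k + 2 * i) pos D))))
      ≡⟨ trans (∑∑-+ _ _) (cong₂ _+_ (∑∑-* k _) (trans (∑∑-∑ [1⋯ N ] _) (∑-cong [1⋯ N ] (λ i → ∑∑-* ((k + 2 * i) C k′) _)))) ⟩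
    k * triples k ν + (∑[ i ∈ [1⋯ N ] ] (((k + 2 * i) C k′) * triples (k + 2 * i) ν)) ∎
    where
    open ≡-Reasoning
    #≤N : ∀ π → length (cycleLengths π) ≤ N
    #≤N π = ℕ.≤-trans (ℕ.≤-reflexive (length-map (cycleLength π) (filter (isCycleMin? π) (allFin n))))
      (ℕ.≤-trans (List.length-filter (isCycleMin? π) (allFin n)) (ℕ.≤-trans (ℕ.≤-reflexive (length-tabulate {n = n} id)) n≤N))
    distribute : ∀ a b (f : ℕ → ℕ) → a * (b * k + (∑[ i ∈ [1⋯ N ] ] (((k + 2 * i) C k′) * f i)))
      ≡ k * (a * b) + (∑[ i ∈ [1⋯ N ] ] (((k + 2 * i) C k′) * (a * f i)))
    distribute a b f = trans (ℕ.*-distribˡ-+ a (b * k) _) (cong₂ _+_ (trans (sym (ℕ.*-assoc a b k)) (ℕ.*-comm (a * b) k))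
      (trans (sym (∑-*ˡ a [1⋯ N ] _)) (∑-cong [1⋯ N ] (λ i → *-swap a ((k + 2 * i) C k′) (f i)))))

  -- The roles of D and of a = s D⁻¹ are exchanged by passing to the reversed
  -- word, since D⁻¹ = s⁻¹ a.
  dual : (Y : Permutation′ n → Permutation′ n → ℕ) →
    (∀ {pos pos′ π π′} → pos ≈ pos′ → π ≈ π′ → Y pos π ≡ Y pos′ π′) →
    ∑∑ (λ pos D → withCycles k pos D * Y (reversed pos) (flip D))
      ≡ ∑[ a ∈ G ] (𝟙 (#cycles a ℕ.≟ k) * (∑[ pos ∈ G ] (Y pos (flip (flip a) ∘ₚ succ pos))))
  dual Y resp = begin
    ∑∑ (λ pos D → withCycles k pos D * Y (reversed pos) (flip D))
      ≡⟨ ∑-cong G (λ pos → ∑-perm-reindex (quot pos)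
           (λ {a} {b} → quot-injective pos {a} {b}) (λ {a} {b} → quot-cong pos {a} {b}) (quot-surjective pos)
           (λ D → withCycles k pos D * Y (reversed pos) (flip D))
           (λ {D} {E} e → cong₂ _*_ (cong (λ c → 𝟙 (c ℕ.≟ k)) (#cyclesOf-cong {s = succ pos} {succ pos} {D} {E} (λ _ → refl) e)) (resp (λ _ → refl) (flip-cong {π = D} {E} e)))) ⟨
    ∑[ pos ∈ G ] (∑[ a ∈ G ] (withCycles k pos (quot pos a) * Y (reversed pos) (flip (quot pos a))))
      ≡⟨ ∑-swap G G _ ⟩
    ∑[ a ∈ G ] (∑[ pos ∈ G ] (withCycles k pos (quot pos a) * Y (reversed pos) (flip (quot pos a))))
      ≡⟨ ∑-cong G (λ a → trans (∑-cong G (λ pos → cong₂ _*_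
           (cong (λ c → 𝟙 (c ℕ.≟ k)) (#cycles-↭ (flip (quot pos a) ∘ₚ succ pos) a (cycleLengths-cong (flip (quot pos a) ∘ₚ succ pos) a (λ x → inverseʳ (succ pos)))))
           (resp (λ _ → refl) (λ x → sym (succ-reversed pos (a ⟨$⟩ʳ x))))))
           (∑-*ˡ (𝟙 (#cycles a ℕ.≟ k)) G (λ pos → Y (reversed pos) (flip (flip a) ∘ₚ succ (reversed pos))))) ⟩
    ∑[ a ∈ G ] (𝟙 (#cycles a ℕ.≟ k) * (∑[ pos ∈ G ] (Y (reversed pos) (flip (flip a) ∘ₚ succ (reversed pos)))))
      ≡⟨ ∑-cong G (λ a → cong (𝟙 (#cycles a ℕ.≟ k) *_) (∑-perm-reindex reversed
           (λ e x → subst₂ _≡_ (Fin.opposite-involutive _) (Fin.opposite-involutive _) (cong Fin.opposite (e x)))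
           (λ e x → cong Fin.opposite (e x)) (λ ρ → reversed ρ , λ x → Fin.opposite-involutive _)
           (λ pos → Y pos (flip (flip a) ∘ₚ succ pos)) (λ {π} {ρ} e → resp e (λ x → succ-cong {pos = π} {ρ} e (a ⟨$⟩ʳ x))))) ⟩
    ∑[ a ∈ G ] (𝟙 (#cycles a ℕ.≟ k) * (∑[ pos ∈ G ] (Y pos (flip (flip a) ∘ₚ succ pos)))) ∎
    where
    open ≡-Reasoning
    -- As a map this is a⁻¹ s, the permutation D with s D⁻¹ = a; for a given word it runs over all
    -- permutations as a does.
    quot : Permutation′ n → Permutation′ n → Permutation′ n
    quot pos a = succ pos ∘ₚ flip a
    quot-cong : ∀ pos {a b} → a ≈ b → quot pos a ≈ quot pos b
    quot-cong pos {a} {b} e x = flip-cong {π = a} {b} e _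
    quot-injective : ∀ pos {a b} → quot pos a ≈ quot pos b → a ≈ b
    quot-injective pos {a} {b} e = flip-cong {π = flip a} {flip b} (λ x →
      subst (λ y → a ⟨$⟩ˡ y ≡ b ⟨$⟩ˡ y) (inverseʳ (succ pos)) (e (succ pos ⟨$⟩ˡ x)))
    quot-surjective : ∀ pos ρ → ∃ λ a → quot pos a ≈ ρ
    quot-surjective pos ρ = flip ρ ∘ₚ succ pos , λ x → cong (ρ ⟨$⟩ʳ_) (inverseˡ (succ pos))

  -- `dual` is applied twice: to hold a = s D⁻¹ fixed while the cycles of D⁻¹ = s⁻¹ a are merged,
  -- and to return to a sum over D afterwards. There ν is no longer the type of D but the result of
  -- merging its cycles; sorting the D by their types μ brings in `κ μ ν`.
  gluing-faces : ∀ N → n ≤ N → ν ⊢ n →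
    ∑∑ (λ pos D → (ofType D * withCycles k pos D) * antiExceedances pos D)
      ≡ length ν * triples k ν + (∑[ i ∈ [1⋯ N ] ] (∑[ μ ∈ splittings n (2 * i + 1) ν ] (κ μ ν * triples k μ)))
  gluing-faces N n≤N ν⊢n = begin
    ∑∑ (λ pos D → (ofType D * withCycles k pos D) * antiExceedances pos D)
      ≡⟨ ∑∑-cong (λ pos D → trans (cong (_* antiExceedances pos D) (ℕ.*-comm (ofType D) _)) (trans (ℕ.*-assoc (withCycles k pos D) _ _)
           (cong (withCycles k pos D *_) (cong₂ _*_ (ofType-cong {D} {flip D} (↭-sym (cycleLengths-flip D))) (sym (antiExceedances-reversed pos D)))))) ⟩
    ∑∑ (λ pos D → withCycles k pos D * (ofType (flip D) * antiExceedances (reversed pos) (flip D)))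
      ≡⟨ dual (λ pos π → ofType π * antiExceedances pos π) (λ {pos} {pos′} {π} {π′} e e′ →
           cong₂ _*_ (ofType-cong {π} {π′} (cycleLengths-cong π π′ e′)) (antiExceedances-cong {pos = pos} {pos′} {π} {π′} e e′)) ⟩
    ∑[ a ∈ G ] (𝟙 (#cycles a ℕ.≟ k) * (∑[ pos ∈ G ] (ofType (flip (flip a) ∘ₚ succ pos) * antiExceedances pos (flip (flip a) ∘ₚ succ pos))))
      ≡⟨ ∑-cong G (λ a → cong (𝟙 (#cycles a ℕ.≟ k) *_) (∑-antiExceedances (flip a) (_↭? ν) (λ p q → ↭-trans (↭-sym p) q))) ⟩
    ∑[ a ∈ G ] (𝟙 (#cycles a ℕ.≟ k) * (∑[ pos ∈ G ] (merges (cycleLengths (flip (flip a) ∘ₚ succ pos)))))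
      ≡⟨ dual (λ pos π → merges (cycleLengths π)) (λ {_} {_} {π} {π′} _ e → merges-cong (cycleLengths-cong π π′ e)) ⟨
    ∑∑ (λ pos D → withCycles k pos D * merges (cycleLengths (flip D)))
      ≡⟨ ∑∑-cong (λ pos D → trans (cong (withCycles k pos D *_) (trans (merges-cong (cycleLengths-flip D))
             (sym (∑-partitions (positive D) (total D) merges (λ e → sym (merges-cong e))))))
           (trans (sym (∑-*ˡ (withCycles k pos D) (partitions n) _)) (∑-cong (partitions n) (λ μ → rearrange (withCycles k pos D) (𝟙 (cycleLengths D ↭? μ)) (merges μ))))) ⟩
    ∑∑ (λ pos D → ∑[ μ ∈ partitions n ] (merges μ * (𝟙 (cycleLengths D ↭? μ) * withCycles k pos D)))
      ≡⟨ trans (∑∑-∑ (partitions n) _) (∑-cong (partitions n) (λ μ → ∑∑-* (merges μ) _)) ⟩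
    ∑[ μ ∈ partitions n ] (merges μ * triples k μ)
      ≡⟨ ∑-cong∈ (partitions n) (λ {μ} μ∈ → trans (cong (_* triples k μ) (∑-splits-merge N μ ν n≤N (∈-partitions⁻ μ∈))) (expand μ)) ⟩
    ∑[ μ ∈ partitions n ] (𝟙 (ν ↭? μ) * (length ν * triples k μ) + (∑[ i ∈ [1⋯ N ] ] (𝟙 (μ ▷[ 2 * i + 1 ]? ν) * (κ μ ν * triples k μ))))
      ≡⟨ ∑-+ (partitions n) _ _ ⟩
    (∑[ μ ∈ partitions n ] (𝟙 (ν ↭? μ) * (length ν * triples k μ))) + (∑[ μ ∈ partitions n ] (∑[ i ∈ [1⋯ N ] ] (𝟙 (μ ▷[ 2 * i + 1 ]? ν) * (κ μ ν * triples k μ))))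
      ≡⟨ cong₂ _+_ (∑-partitions (proj₁ ν⊢n) (proj₂ (proj₂ ν⊢n)) (λ μ → length ν * triples k μ) (λ e → cong (length ν *_) (triples-cong (↭-sym e))))
           (trans (∑-swap (partitions n) [1⋯ N ] _) (∑-cong [1⋯ N ] (λ i → sym (∑-filter (λ μ → μ ▷[ 2 * i + 1 ]? ν) (partitions n) _)))) ⟩
    length ν * triples k ν + (∑[ i ∈ [1⋯ N ] ] (∑[ μ ∈ splittings n (2 * i + 1) ν ] (κ μ ν * triples k μ))) ∎
    where
    open ≡-Reasoning
    merges : List ℕ → ℕ
    merges = ∑-splits (weight (_↭? ν))
    merges-cong : ∀ {μ μ′} → μ ↭ μ′ → merges μ ≡ merges μ′
    merges-cong = ∑-splits-↭ (weight (_↭? ν)) (λ {i} {i′} {o} {o′} p q → 𝟙-cong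
      (λ (odd , m) → subst Odd (↭-length p) odd , ↭-trans (join (↭-sym p) (↭-sym q)) m)
      (λ (odd , m) → subst Odd (sym (↭-length p)) odd , ↭-trans (join p q) m)
      (odd? (length i) ×-dec (sum i ∷ o ↭? ν)) (odd? (length i′) ×-dec (sum i′ ∷ o′ ↭? ν)))
      where
      join : ∀ {i i′ o o′ : List ℕ} → i ↭ i′ → o ↭ o′ → sum i ∷ o ↭ sum i′ ∷ o′
      join {i′ = i′} p q = ↭-trans (↭-reflexive (cong (_∷ _) (sum-↭ p))) (↭-prep (sum i′) q)
    triples-cong : ∀ {μ μ′} → μ ↭ μ′ → triples k μ ≡ triples k μ′
    triples-cong {μ} {μ′} e = ∑∑-cong (λ pos D → cong (_* withCycles k pos D)
      (𝟙-cong (λ p → ↭-trans p e) (λ p → ↭-trans p (↭-sym e)) (cycleLengths D ↭? μ) (cycleLengths D ↭? μ′)))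
    positive : ∀ D → All (0 <_) (cycleLengths D)
    positive D = All.map⁺ (All.universal (cycleLength>0 D) _)
    total : ∀ D → sum (cycleLengths D) ≡ n
    -- U is the set of all points, so every cycle lies inside it.
    total D = let U , _ , full = subset-of {n} (λ x → yes (refl {x = x})) in
      trans (cong (λ xs → sum (map (cycleLength D) xs)) (filter-cong∈ (isCycleMin? D) (inside? D U) (allFin n) (λ _ m → m , full refl) (λ _ → proj₁)))
        (trans (∑-inside D {U} (λ _ _ → full refl)) (trans (∣∣≡∑ U) (trans (∑-cong (allFin n) (λ x → 𝟙-yes (x ∈ₛ? U) (full refl)))
          (trans (∑-const (allFin n) 1) (trans (ℕ.*-identityʳ _) (length-tabulate {n = n} id))))))
    rearrange : ∀ a b c → a * (b * c) ≡ c * (b * a)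
    rearrange a b c = trans (cong (a *_) (ℕ.*-comm b c)) (trans (*-swap a c b) (cong (c *_) (ℕ.*-comm a b)))
    expand : ∀ μ → (𝟙 (μ ↭? ν) * length ν + (∑[ i ∈ [1⋯ N ] ] (𝟙 (μ ▷[ 2 * i + 1 ]? ν) * κ μ ν))) * triples k μ
      ≡ 𝟙 (ν ↭? μ) * (length ν * triples k μ) + (∑[ i ∈ [1⋯ N ] ] (𝟙 (μ ▷[ 2 * i + 1 ]? ν) * (κ μ ν * triples k μ)))
    expand μ = trans (ℕ.*-distribʳ-+ (triples k μ) (𝟙 (μ ↭? ν) * length ν) _) (cong₂ _+_
      (trans (ℕ.*-assoc (𝟙 (μ ↭? ν)) _ _) (cong (_* (length ν * triples k μ)) (𝟙-cong ↭-sym ↭-sym (μ ↭? ν) (ν ↭? μ))))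
      (trans (sym (∑-*ʳ (triples k μ) [1⋯ N ] _)) (∑-cong [1⋯ N ] (λ i → ℕ.*-assoc (𝟙 (μ ▷[ 2 * i + 1 ]? ν)) _ _))))

  triples-recursion : ∀ N → 1 ≤ n → n ≤ N → ν ⊢ n → (n + 1) * triples k ν ≡
    (k * triples k ν + (∑[ i ∈ [1⋯ N ] ] (((k + 2 * i) C k′) * triples (k + 2 * i) ν)))
    + (length ν * triples k ν + (∑[ i ∈ [1⋯ N ] ] (∑[ μ ∈ splittings n (2 * i + 1) ν ] (κ μ ν * triples k μ))))
  triples-recursion N 1≤n n≤N ν⊢n = trans (sym (∑∑-* (n + 1) _)) (trans
    (∑∑-cong (λ pos D → trans (cong (_* (ofType D * withCycles k pos D)) (sym (antiExceedances-sum 1≤n pos D)))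
      (trans (ℕ.*-comm _ (ofType D * withCycles k pos D)) (ℕ.*-distribˡ-+ (ofType D * withCycles k pos D) (antiExceedances pos (flip D ∘ₚ succ pos)) _))))
    (trans (∑∑-+ _ _) (cong₂ _+_ (gluing-vertices N n≤N) (gluing-faces N n≤N ν⊢n))))

-- From words back to plane permutations, and the quotient

module _ {n : ℕ} (D : List ℕ → Permutation′ n) (D-type : ∀ μ → μ ⊢ n → HasCycleType μ (D μ)) where

  private
    K g : ℕ
    K = #fullCycles n
    g = length (permutations n)

    P : ℕ → List ℕ → ℕ
    P j μ = p j (D μ) * q n μ

    module _ (k′ : ℕ) (ν : List ℕ) where
      open Totals n k′ ν

      -- For every j and μ, `triples j μ` and `P j μ` are in the ratio of g to K, the numbers of
      -- words and of n-cycles. A linear recursion thus passes from the one to the other: it is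
      -- multiplied by K, rewritten, and g is cancelled.
      scale : ∀ j {μ} → μ ⊢ n → K * triples j μ ≡ g * P j μ
      scale j {μ} μ⊢n = begin
        K * triples j μ               ≡⟨ cong (K *_) (triples≡#diagonals j μ) ⟩
        K * (g * #diagonals (rot n) j μ)       ≡⟨ trans (sym (ℕ.*-assoc K g _)) (trans (cong (_* #diagonals (rot n) j μ) (ℕ.*-comm K g)) (ℕ.*-assoc g K _)) ⟩
        g * (K * #diagonals (rot n) j μ)       ≡⟨ cong (g *_) (pq≡#diagonals j μ (D μ) (D-type μ μ⊢n)) ⟨
        g * P j μ                     ∎
        where open ≡-Reasoning

      scale-* : ∀ c j {μ} → μ ⊢ n → K * (c * triples j μ) ≡ g * (c * P j μ)
      scale-* c j {μ} μ⊢n = trans (pull K) (trans (cong (c *_) (scale j μ⊢n)) (sym (pull g)))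
        where
        pull : ∀ a {b} → a * (c * b) ≡ c * (a * b)
        pull a {b} = trans (sym (ℕ.*-assoc a c b)) (trans (cong (_* b) (ℕ.*-comm a c)) (ℕ.*-assoc c a b))

      scale-∑ : (xs : List A) {f h : A → ℕ} → (∀ {x} → x ∈ xs → K * f x ≡ g * h x) → K * ∑-syntax xs f ≡ g * ∑-syntax xs h
      scale-∑ xs {f} {h} e = trans (sym (∑-*ˡ K xs f)) (trans (∑-cong∈ xs e) (∑-*ˡ g xs h))

      scale-+ : ∀ {a b c d} → K * a ≡ g * c → K * b ≡ g * d → K * (a + b) ≡ g * (c + d)
      scale-+ {a} {b} {c} {d} e e′ = trans (ℕ.*-distribˡ-+ K a b) (trans (cong₂ _+_ e e′) (sym (ℕ.*-distribˡ-+ g c d)))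

      g-nonZero : NonZero g
      g-nonZero = ℕ.>-nonZero (nonEmpty (proj₁ (proj₂ (permutations-complete (idₚ {n})))))
        where
        nonEmpty : ∀ {π} {πs : List (Permutation′ n)} → π ∈ πs → 0 < length πs
        nonEmpty (here _)  = z<s
        nonEmpty (there _) = z<s

      pq-recursion : ∀ N → 1 ≤ n → n ≤ N → ν ⊢ n → (n + 1) * P (suc k′) ν ≡
        (suc k′ * P (suc k′) ν + (∑[ i ∈ [1⋯ N ] ] (((suc k′ + 2 * i) C k′) * P (suc k′ + 2 * i) ν)))
        + (length ν * P (suc k′) ν + (∑[ i ∈ [1⋯ N ] ] (∑[ μ ∈ splittings n (2 * i + 1) ν ] (κ μ ν * P (suc k′) μ))))
      pq-recursion N 1≤n n≤N ν⊢n = ℕ.*-cancelˡ-≡ _ _ g {{g-nonZero}} (trans (sym (scale-* (n + 1) (suc k′) ν⊢n))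
        (trans (cong (K *_) (triples-recursion N 1≤n n≤N ν⊢n)) (scale-+
          (scale-+ (scale-* (suc k′) (suc k′) ν⊢n) (scale-∑ [1⋯ N ] (λ {i} _ → scale-* ((suc k′ + 2 * i) C k′) (suc k′ + 2 * i) ν⊢n)))
          (scale-+ (scale-* (length ν) (suc k′) ν⊢n) (scale-∑ [1⋯ N ] (λ {i} _ → scale-∑ (splittings n (2 * i + 1) ν) (λ {μ} μ∈ →
            scale-* (κ μ ν) (suc k′) (∈-partitions⁻ (proj₁ (∈-filter⁻ (λ μ → μ ▷[ 2 * i + 1 ]? ν) {xs = partitions n} μ∈))))))))))

  pq-identity : ∀ k′ ν N → 1 ≤ n → n ≤ N → ν ⊢ n → length ν < n + 1 ∸ suc k′ →
    p (suc k′) (D ν) * (q n ν * (n + 1 ∸ suc k′ ∸ length ν)) ≡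
      (∑[ i ∈ [1⋯ N ] ] (((suc k′ + 2 * i) C k′) * p (suc k′ + 2 * i) (D ν) * q n ν))
      + (∑[ i ∈ [1⋯ N ] ] (∑[ μ ∈ splittings n (2 * i + 1) ν ] (κ μ ν * p (suc k′) (D μ) * q n μ)))
  pq-identity k′ ν N 1≤n n≤N ν⊢n ℓ< = begin
    p k (D ν) * (q n ν * m)    ≡⟨ ℕ.*-assoc (p k (D ν)) (q n ν) m ⟨
    X * m                      ≡⟨ ℕ.*-comm X m ⟩
    m * X                      ≡⟨ ℕ.+-cancelˡ-≡ (k * X + ℓ * X) _ _ cancelled ⟩
    S₁ + S₂                    ≡⟨ cong₂ _+_ (∑-cong [1⋯ N ] (λ i → sym (ℕ.*-assoc ((k + 2 * i) C k′) _ _)))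
                                    (∑-cong [1⋯ N ] (λ i → ∑-cong (splittings n (2 * i + 1) ν) (λ μ → sym (ℕ.*-assoc (κ μ ν) _ _)))) ⟩
    _ ∎
    where
    open ≡-Reasoning
    k = suc k′
    ℓ = length ν
    m = n + 1 ∸ k ∸ ℓ
    X = P k ν
    S₁ = ∑[ i ∈ [1⋯ N ] ] (((k + 2 * i) C k′) * P (k + 2 * i) ν)
    S₂ = ∑[ i ∈ [1⋯ N ] ] (∑[ μ ∈ splittings n (2 * i + 1) ν ] (κ μ ν * P k μ))
    -- The bound on ℓ also yields k < n + 1, so neither truncated subtraction in m loses anything.
    n+1≡ : n + 1 ≡ k + (ℓ + m)
    n+1≡ = sym (trans (cong (_+_ k) (ℕ.m+[n∸m]≡n {ℓ} (ℕ.<⇒≤ ℓ<))) (ℕ.m+[n∸m]≡n {k} (ℕ.<⇒≤ (ℕ.m∸n≢0⇒n<m {n + 1} {k} (λ e → contradiction (subst (ℓ <_) e ℓ<) λ ())))))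
    cancelled : k * X + ℓ * X + m * X ≡ k * X + ℓ * X + (S₁ + S₂)
    cancelled = begin
      k * X + ℓ * X + m * X         ≡⟨ trans (ℕ.+-assoc (k * X) _ _) (cong (_+_ (k * X)) (sym (ℕ.*-distribʳ-+ X ℓ m))) ⟩
      k * X + (ℓ + m) * X           ≡⟨ ℕ.*-distribʳ-+ X k (ℓ + m) ⟨
      (k + (ℓ + m)) * X             ≡⟨ cong (_* X) n+1≡ ⟨
      (n + 1) * X                   ≡⟨ pq-recursion k′ ν N 1≤n n≤N ν⊢n ⟩
      (k * X + S₁) + (ℓ * X + S₂)   ≡⟨ +-interchange (k * X) S₁ (ℓ * X) S₂ ⟩
      k * X + ℓ * X + (S₁ + S₂)     ∎

  q>0 : ∀ {ν} → ν ⊢ n → 0 < q n ν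
  q>0 {ν} ν⊢n = let E , E∈ , e = permutations-complete (D ν) in
    subst (0 <_) (sym (count≡∑ (λ π → cycleLengths π ↭? ν) (permutations n)))
      (∑≥1 {f = λ π → 𝟙 (cycleLengths π ↭? ν)} E∈
        (ℕ.≤-reflexive (sym (𝟙-yes (cycleLengths E ↭? ν) (↭-trans (cycleLengths-cong E (D ν) e) (D-type ν ν⊢n))))))

cross-multiply : ∀ a b d {{_ : NonZero d}} → a * d ≡ b → (+ a) / 1 ≡ (+ b) / d
cross-multiply a b (suc d) e = ℚ.fromℚᵘ-cong {ℚᵘ.mkℚᵘ (+ a) 0} {ℚᵘ.mkℚᵘ (+ b) d} (ℚᵘ.*≡* (begin
  + a ℤ.* + suc d   ≡⟨ ℤ.pos-* a (suc d) ⟨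
  + (a * suc d)     ≡⟨ cong (+_) (trans e (sym (ℕ.*-identityʳ b))) ⟩
  + (b * 1)         ≡⟨ ℤ.pos-* b 1 ⟩
  + b ℤ.* + 1       ∎))
  where open ≡-Reasoning

-- Any N ≥ n may cut off the two infinite sums: a permutation of n points has at most n cycles, and
-- no part of a partition of n splits into more than n parts. `D` supplies a permutation for each
-- cycle type. The denominator is shown to be nonzero as part of the result.
corollary1 : ∀ (n k : ℕ) → 1 ≤ n → 1 ≤ k →
    (D : List ℕ → Permutation′ n) → (∀ μ → μ ⊢ n → HasCycleType μ (D μ)) →
    (ν : List ℕ) → ν ⊢ n → length ν < n + 1 ∸ k →
    (N : ℕ) → n ≤ N →
    Σ[ nonZero ∈ NonZero (q n ν * (n + 1 ∸ k ∸ length ν)) ]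
    (+ p k (D ν)) / 1
    ≡ _/_ (+ ((∑[ i ∈ [1⋯ N ] ] (((k + 2 * i) C (k ∸ 1)) * p (k + 2 * i) (D ν) * q n ν))
    + (∑[ i ∈ [1⋯ N ] ] (∑[ μ ∈ splittings n (2 * i + 1) ν ] (κ μ ν * p k (D μ) * q n μ)))))
    (q n ν * (n + 1 ∸ k ∸ length ν)) {{nonZero}}
corollary1 n (suc k′) 1≤n _ D D-type ν ν⊢n ℓ< N n≤N = nonZero ,
    cross-multiply (p (suc k′) (D ν)) _ (q n ν * (n + 1 ∸ suc k′ ∸ length ν)) {{nonZero}} (pq-identity D D-type k′ ν N 1≤n n≤N ν⊢n ℓ<)
  where
  nonZero : NonZero (q n ν * (n + 1 ∸ suc k′ ∸ length ν))
  nonZero = ℕ.m*n≢0 (q n ν) (n + 1 ∸ suc k′ ∸ length ν) {{ℕ.>-nonZero (q>0 D D-type ν⊢n)}} {{ℕ.>-nonZero (ℕ.m<n⇒0<n∸m ℓ<)}}
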